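{- Every planar graph admits a $4$-local queue layout, and there is a planar graph whose local queue number is at least $3$.
   Context: Graphs are finite, simple and undirected. Given a linear ordering $\prec$ of the vertex set of a graph, two edges $uv$ and $xy$ nest if $u \prec x \prec y \prec v$ or $x \prec u \prec v \prec y$ (for the endpoints named suitably). A queue is a set of edges no two of which nest. A queue layout of $G$ consists of a linear ordering $\prec$ of $V(G)$ and a partition of $E(G)$ into queues; it is $\ell$-local if every vertex has incident edges in at most $\ell$ queues (the total number of queues being arbitrary). The local queue number of $G$ is the smallest $\ell$ such that $G$ has an $\ell$-local queue layout.
   Formalization: Planar is taken to mean drawable without crossings with simple polygonal arcs as edges whose vertices and bends have rational coordinates, instead of in the real plane; a perturbation shows that the same graphs are planar. -}

module Defs where

open import Data.Empty using (⊥)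
open import Data.Fin using (Fin)
open import Data.List using (List; []; _∷_; [_]; _++_; map; filter; reverse; length; deduplicate; allFin)
open import Data.Nat using (ℕ; _≤_)
import Data.Nat.Properties as ℕ
open import Data.Product using (Σ; ∃-syntax; _×_; _,_)
open import Data.Rational as ℚ using (ℚ; 0ℚ; 1ℚ)
open import Data.Sum using (_⊎_)
open import Data.Unit using (⊤)
open import Function.Definitions using (Injective)
open import Level using (0ℓ)
open import Relation.Binary using (Rel; Symmetric; Irreflexive; Decidable; IsStrictTotalOrder)
open import Relation.Binary.PropositionalEquality using (_≡_; _≢_)
open import Relation.Nullary using (¬_)

record Graph : Set₁ where
  field
    order  : ℕ

  V : Set
  V = Fin order

  infix 4 _~_ _~?_
  field
    _~_    : Rel V 0ℓ
    _~?_   : Decidable _~_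
    sym    : Symmetric _~_
    irrefl : Irreflexive _≡_ _~_

  neighbours : V → List V
  neighbours v = filter (v ~?_) (allFin order)

-- (u , v) and (x , y) name the same undirected edge.
SameEdge : {A : Set} → A → A → A → A → Set
SameEdge u v x y = (u ≡ x × v ≡ y) ⊎ (u ≡ y × v ≡ x)

-- A graph is planar if it can be drawn in the plane with simple polygonal
-- arcs as edges. Arcs are given by their vertices, in ℚ². A finite
-- graph with a crossing-free drawing in ℝ² also has one of this form. Two
-- segments with rational endpoints that meet in ℝ² also meet in ℚ², so it
-- is enough to test disjointness on rational points.

Point : Set
Point = ℚ × ℚ

-- The point (1 - t) A + t B.
along : ℚ → Point → Point → Point
along t (a₁ , a₂) (b₁ , b₂) = mix a₁ b₁ , mix a₂ b₂
  where
  mix : ℚ → ℚ → ℚ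
  mix a b = (1ℚ ℚ.- t) ℚ.* a ℚ.+ t ℚ.* b

OnSegment : Point → Point → Point → Set
OnSegment A B P = ∃[ t ] 0ℚ ℚ.≤ t × t ℚ.≤ 1ℚ × P ≡ along t A B

OnArc : List Point → Point → Set
OnArc []           P = ⊥
OnArc (A ∷ [])     P = P ≡ A
OnArc (A ∷ B ∷ As) P = OnSegment A B P ⊎ OnArc (B ∷ As) P

-- The polygonal arc does not meet itself: each segment is non-degenerate
-- and shares only its final point with the remainder of the arc.
SimpleArc : List Point → Set
SimpleArc []           = ⊥
SimpleArc (A ∷ [])     = ⊤
SimpleArc (A ∷ B ∷ As) =
  A ≢ B ×
  (∀ P → OnSegment A B P → OnArc (B ∷ As) P → P ≡ B) ×
  SimpleArc (B ∷ As)

record PlaneDrawing (G : Graph) : Set where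
  open Graph G

  field
    pos           : V → Point
    pos-injective : Injective _≡_ _≡_ pos
    bends         : V → V → List Point
    bends-sym     : ∀ {u v} → u ~ v → bends v u ≡ reverse (bends u v)

  arc : V → V → List Point
  arc u v = pos u ∷ bends u v ++ [ pos v ]

  Interior : V → V → Point → Set
  Interior u v P = OnArc (arc u v) P × P ≢ pos u × P ≢ pos v

  field
    arc-simple  : ∀ {u v} → u ~ v → SimpleArc (arc u v)
    no-vertex   : ∀ {u v} → u ~ v → ∀ w → ¬ Interior u v (pos w)
    no-crossing : ∀ {u v x y} → u ~ v → x ~ y → ¬ SameEdge u v x y →
                  ∀ P → Interior u v P → ¬ OnArc (arc x y) P

Planar : Graph → Set
Planar = PlaneDrawing

module _ (G : Graph) where
  open Graph G

  Nest : Rel V 0ℓ → V → V → V → V → Set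
  Nest _≺_ u v x y = (u ≺ x × x ≺ y × y ≺ v) ⊎ (x ≺ u × u ≺ v × v ≺ y)

  -- E is a symmetric relation, viewed as a set of edges; quantifying over
  -- u, v, x, y covers every naming of the endpoints.
  IsQueue : Rel V 0ℓ → Rel V 0ℓ → Set
  IsQueue _≺_ E = ∀ {u v x y} → E u v → E x y → ¬ Nest _≺_ u v x y

  record QueueLayout : Set₁ where
    infix 4 _≺_
    field
      _≺_       : Rel V 0ℓ
      ≺-isOrder : IsStrictTotalOrder _≡_ _≺_

      -- The partition of the edges, given by a label for the part of each
      -- edge. Values on non-adjacent pairs are irrelevant.
      queue     : V → V → ℕ
      queue-sym : ∀ {u v} → u ~ v → queue u v ≡ queue v u
      isQueue   : ∀ q → IsQueue _≺_ (λ u v → u ~ v × queue u v ≡ q)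

    queuesAt : V → List ℕ
    queuesAt v = deduplicate ℕ._≟_ (map (queue v) (neighbours v))

  IsLocal : ℕ → QueueLayout → Set
  IsLocal ℓ L = ∀ v → length (QueueLayout.queuesAt L v) ≤ ℓ

  HasLocalQueueLayout : ℕ → Set₁
  HasLocalQueueLayout ℓ = Σ QueueLayout (IsLocal ℓ)

  IsLocalQueueNumber : ℕ → Set₁
  IsLocalQueueNumber ℓ =
    HasLocalQueueLayout ℓ × (∀ m → HasLocalQueueLayout m → ℓ ≤ m)

{-# OPTIONS --safe #-}

-- Upper bound. Direct the edges such that all out-degrees are at most 3 and put
-- each edge into the star at its head. Stars are queues for every vertex order,
-- and a vertex meets only its own star and those of its out-neighbours. To find
-- the orientation without Euler's formula, keep of the drawing only the parity
-- of crossings between edges and upward rays from vertices. Two disjoint arcs,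
-- prolonged to infinity by the rays at their ends, cross evenly. The resulting
-- equations survive contraction, and for K₅ their sum over all pairs of
-- independent edges is 0 = 1. An orientation lifts along the contraction of an
-- edge with at most two common neighbours of its ends; the lifting gains from
-- one root with out-degree at most 1. If no edge is of this kind, then counting
-- gives a vertex of degree at most 5, and its neighbourhood contracts to a K₅.
--
-- Lower bound. Let u and v have many common neighbours in adjacent pairs x x′,
-- with many t joined to both x and x′, and many adjacent pairs s s′ joined to
-- both x and t. In a 2-local layout one may assume that all pairs x x′ use the
-- same queues at u and v. If x, or x′, has its edges to u and v in different
-- queues, then the edges x x′ and t x, t x′ have no room. Otherwise the x lie
-- between u and v, and most x have all further edges in a single queue, that of
-- x x′. The same argument for x, x′ and t gives a t with only the edges to x
-- and x′ in this queue, and then s s′ has no room. The graph has a book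
-- embedding with two pages, so it is planar.

module Submission where

-- No edge bound is derived from faces. When all degrees are at least 4 and every edge lies in three
-- triangles, the bound is borrowed from the induction: delete one edge, orient the rest, put the
-- edge back. If S is the sum of the out-degrees before the edge returns, the degree sum is at most
-- 2(S + 1), while the root gives S + 2 ≤ 3n; so the degree sum stays below 6n. A root with
-- out-degree 2 would allow exactly 6n, which is why the root has at most 1. The orientation is then
-- discarded: the vertex of degree at most 5 leads to the contradiction. In the lower bound most
-- steps rest on one observation. If u has edges of one queue to `lo` and to `hi`, both on the same
-- side of u, then a vertex strictly between them that is joined to u in this queue can send its
-- other edges of the queue only to the far side of both. Large index sets serve to provide such
-- extremes; the numbers of copies come from repeated halving by sides or queues and from discarding
-- extremes.

open import Defs
open import Data.Nat using (_≥_)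
open import Data.Product using (∃-syntax; _×_)

-- Ring arithmetic and inequalities in ℚ

module Rationals where

  open import Algebra.Bundles using (CommutativeRing)
  import Algebra.Solver.Ring as Solver
  open import Algebra.Solver.Ring.AlmostCommutativeRing as ACR using (_-Raw-AlmostCommutative⟶_)
  open import Data.Integer as ℤ using (ℤ; +_)
  import Data.Integer.Properties as ℤ
  import Data.Nat as ℕ
  open import Data.Nat.Coprimality as C using (1-coprimeTo)
  open import Data.Rational as ℚ using (ℚ; mkℚ; ↥_; 0ℚ; 1ℚ; _<_; _≤_)
  import Data.Rational.Properties as ℚ
  open import Level using (0ℓ)
  open import Algebra.Structures using (IsCommutativeRing)
  open import Data.Product using (_×_; _,_; ∃-syntax)
  open import Defs using (along)
  open import Relation.Binary.PropositionalEquality as ≡ using (_≡_; refl; cong₂; sym)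
  open import Relation.Nullary using (yes; no)
  open import Data.Maybe using (Maybe; just; nothing)

  -- Built with `mkℚ` and not by a division, so that 0 and 1 become `0ℚ` and `1ℚ` definitionally.
  -- The ring solver takes its coefficients from ℤ along this map.
  fromℤ : ℤ → ℚ
  fromℤ i = mkℚ i 0 (C.sym (1-coprimeTo ℤ.∣ i ∣))

  ℤ-raw = CommutativeRing.rawRing ℤ.+-*-commutativeRing

  infixl 6 _+_
  infixl 7 _*_
  infix 8 -_

  -- The operations of ℚ unfold when they are applied to variables, which makes
  -- unification with rational expressions intractable. Hence opaque copies.
  opaque
    _+_ _*_ : ℚ → ℚ → ℚ
    _+_ = ℚ._+_
    _*_ = ℚ._*_

    -_ : ℚ → ℚ
    -_ = ℚ.-_

    isCommutativeRing : IsCommutativeRing _≡_ _+_ _*_ -_ 0ℚ 1ℚ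
    isCommutativeRing = ℚ.+-*-isCommutativeRing

  ring : CommutativeRing 0ℓ 0ℓ
  ring = record { isCommutativeRing = isCommutativeRing }

  opaque
    unfolding _+_

    /1 : ∀ {j} i → j ≡ i → j ℚ./ 1 ≡ fromℤ i
    /1 i refl = ℚ.↥p/↧p≡p (fromℤ i)

    fromℤ-+ : ∀ i j → fromℤ (i ℤ.+ j) ≡ fromℤ i + fromℤ j
    fromℤ-+ i j = sym (/1 (i ℤ.+ j) (cong₂ ℤ._+_ (ℤ.*-identityʳ i) (ℤ.*-identityʳ j)))

    fromℤ-* : ∀ i j → fromℤ (i ℤ.* j) ≡ fromℤ i * fromℤ j
    fromℤ-* i j = sym (/1 (i ℤ.* j) refl)

    fromℤ-neg : ∀ i → fromℤ (ℤ.- i) ≡ - fromℤ i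
    fromℤ-neg (+ 0) = refl
    fromℤ-neg (+ ℕ.suc n) = refl
    fromℤ-neg ℤ.-[1+ n ] = refl

    +-mono-< : ∀ {p q r s} → p < q → r < s → p + r < q + s
    +-mono-< = ℚ.+-mono-<

    +-monoˡ-< : ∀ r {p q} → p < q → p + r < q + r
    +-monoˡ-< = ℚ.+-monoˡ-<

    +-mono-<-≤ : ∀ {p q r s} → p < q → r ≤ s → p + r < q + s
    +-mono-<-≤ = ℚ.+-mono-<-≤

    +-mono-≤ : ∀ {p q r s} → p ≤ q → r ≤ s → p + r ≤ q + s
    +-mono-≤ = ℚ.+-mono-≤

    neg-mono-< : ∀ {p q} → p < q → - q < - p
    neg-mono-< = ℚ.neg-antimono-<

    neg-mono-≤ : ∀ {p q} → p ≤ q → - q ≤ - p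
    neg-mono-≤ = ℚ.neg-antimono-≤

    *-pos : ∀ {p q} → 0ℚ < p → 0ℚ < q → 0ℚ < p * q
    *-pos {p} {q} 0<p 0<q = ℚ.positive⁻¹ (p ℚ.* q) {{ℚ.pos*pos⇒pos p {{ℚ.positive 0<p}} q {{ℚ.positive 0<q}}}}

    *-mono-≤ : ∀ {p q r} → 0ℚ ≤ r → p ≤ q → p * r ≤ q * r
    *-mono-≤ {r = r} 0≤r = ℚ.*-monoʳ-≤-nonNeg r {{ℚ.nonNegative 0≤r}}

    inverse : ∀ {k} → 0ℚ < k → ∃[ i ] 0ℚ ≤ i × k * i ≡ 1ℚ
    inverse {k} 0<k = ℚ.1/ k , ℚ.nonNegative⁻¹ (ℚ.1/ k) {{ℚ.pos⇒nonNeg (ℚ.1/ k) {{ℚ.1/pos⇒pos k}}}} , ℚ.*-inverseʳ k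
      where
      instance
        k-pos : ℚ.Positive k
        k-pos = ℚ.positive 0<k
        k-nz : ℚ.NonZero k
        k-nz = ℚ.pos⇒nonZero k

    -- The bridge from `along`, which is stated with the operations of ℚ, to their opaque copies.
    along-def : ∀ t a₁ a₂ b₁ b₂ →
      along t (a₁ , a₂) (b₁ , b₂) ≡ ((1ℚ + - t) * a₁ + t * b₁ , (1ℚ + - t) * a₂ + t * b₂)
    along-def t a₁ a₂ b₁ b₂ = refl

  fromℤ-hom : ℤ-raw -Raw-AlmostCommutative⟶ ACR.fromCommutativeRing ring
  fromℤ-hom = record
    { ⟦_⟧ = fromℤ
    ; +-homo = fromℤ-+
    ; *-homo = fromℤ-*
    ; -‿homo = fromℤ-neg
    ; 0-homo = refl
    ; 1-homo = refl
    }

  fromℤ-≟ : ∀ i j → Maybe (fromℤ i ≡ fromℤ j)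
  fromℤ-≟ i j with i ℤ.≟ j
  ... | yes refl = just refl
  ... | no _ = nothing

  open Solver ℤ-raw (ACR.fromCommutativeRing ring) fromℤ-hom fromℤ-≟ public
    using (solve; Polynomial; _:=_; _:+_; _:*_; _:-_; :-_; con)

  open CommutativeRing ring public
    using (+-identityˡ; +-identityʳ; +-comm; *-identityˡ; *-identityʳ; *-comm; *-assoc; zeroˡ; zeroʳ; _-_)
    renaming (-‿inverseʳ to +-inverseʳ)

-- Lexicographic order of points and intersection of segments

module Segments where

  open import Defs
  open import Data.Empty using (⊥; ⊥-elim)
  open import Data.Integer using () renaming (+_ to pos)
  open import Data.Rational using (ℚ; 0ℚ; 1ℚ; _<_; _≤_)
  open import Data.Rational.Properties using (<-irrefl; <-cmp; <⇒≤; ≤-reflexive; positive⁻¹; ≤-refl)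
  open Rationals
  open import Data.Product using (_×_; _,_; proj₁; proj₂)
  open import Relation.Binary using (tri<; tri≈; tri>)
  open import Relation.Binary.PropositionalEquality
  open import Relation.Nullary using (¬_)

  minus-plus : ∀ x y → x ≡ (x - y) + y
  minus-plus = solve 2 (λ x y → x := (x :- y) :+ y) refl

  telescope : ∀ x y z → (y - x) + (z - y) ≡ z - x
  telescope = solve 3 (λ x y z → (y :- x) :+ (z :- y) := z :- x) refl

  +-pos : ∀ {p q} → 0ℚ < p → 0ℚ < q → 0ℚ < p + q
  +-pos {p} {q} 0<p 0<q = subst (_< p + q) (+-identityˡ 0ℚ) (+-mono-< 0<p 0<q)

  neg-0 : - 0ℚ ≡ 0ℚ
  neg-0 = solve 0 (:- con (pos 0) := con (pos 0)) refl

  neg-pos : ∀ {p} → p < 0ℚ → 0ℚ < - p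
  neg-pos {p} p<0 = subst (_< - p) neg-0 (neg-mono-< p<0)

  neg-nonNeg : ∀ {p} → p ≤ 0ℚ → 0ℚ ≤ - p
  neg-nonNeg {p} p≤0 = subst (_≤ - p) neg-0 (neg-mono-≤ p≤0)

  x-y≡0⇒x≡y : ∀ {x y} → x - y ≡ 0ℚ → x ≡ y
  x-y≡0⇒x≡y {x} {y} e = trans (minus-plus x y) (trans (cong (_+ y) e) (+-identityˡ y))

  +-incʳ-≤ : ∀ x {y} → 0ℚ ≤ y → x ≤ x + y
  +-incʳ-≤ x {y} 0≤y = subst (_≤ x + y) (+-identityʳ x) (+-mono-≤ (≤-refl {x}) 0≤y)

  diff-pos : ∀ {x y} → x < y → 0ℚ < y - x
  diff-pos {x} {y} x<y = subst (_< y - x) (+-inverseʳ x) (+-monoˡ-< (- x) x<y)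

  Vector : Set
  Vector = ℚ × ℚ

  infixl 6 _⊕_ _⊖_
  infixr 7 _•_

  _⊕_ _⊖_ : Vector → Vector → Vector
  (a , b) ⊕ (c , d) = a + c , b + d
  (a , b) ⊖ (c , d) = a - c , b - d

  _•_ : ℚ → Vector → Vector
  k • (a , b) = k * a , k * b

  -- Lexicographic positivity. It replaces the usual assumption that no two of
  -- the points in question lie on a vertical line.
  data Pos : Vector → Set where
    right : ∀ {a b} → 0ℚ < a → Pos (a , b)
    up    : ∀ {a b} → a ≡ 0ℚ → 0ℚ < b → Pos (a , b)

  Pos-⊕ : ∀ {v w} → Pos v → Pos w → Pos (v ⊕ w)
  Pos-⊕ (right p) (right q) = right (+-pos p q)
  Pos-⊕ (right p) (up refl _) = right (subst (0ℚ <_) (sym (+-identityʳ _)) p)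
  Pos-⊕ (up refl _) (right q) = right (subst (0ℚ <_) (sym (+-identityˡ _)) q)
  Pos-⊕ (up refl p) (up refl q) = up (+-identityˡ 0ℚ) (+-pos p q)

  Pos-• : ∀ {k v} → 0ℚ < k → Pos v → Pos (k • v)
  Pos-• k>0 (right p) = right (*-pos k>0 p)
  Pos-• {k} k>0 (up refl p) = up (zeroʳ k) (*-pos k>0 p)

  Pos-irrefl : ∀ {a b} → a ≡ 0ℚ → b ≡ 0ℚ → ¬ Pos (a , b)
  Pos-irrefl refl refl (right p) = <-irrefl refl p
  Pos-irrefl refl refl (up _ p) = <-irrefl refl p

  -- Lets the sign of a determinant be read off from a vector identity in which it is a coefficient.
  Pos-•⁻¹ : ∀ {k v} → Pos v → Pos (k • v) → 0ℚ < k
  Pos-•⁻¹ {k} {v₁ , v₂} p q with <-cmp 0ℚ k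
  ... | tri< 0<k _ _ = 0<k
  ... | tri≈ _ refl _ = ⊥-elim (Pos-irrefl (zeroˡ v₁) (zeroˡ v₂) q)
  ... | tri> _ _ k<0 = ⊥-elim (Pos-irrefl (cancel v₁) (cancel v₂) (Pos-⊕ (Pos-• (neg-pos k<0) p) q))
    where
    cancel : ∀ x → - k * x + k * x ≡ 0ℚ
    cancel = solve 2 (λ k x → :- k :* x :+ k :* x := con (pos 0)) refl k

  infix 4 _≺ₚ_
  -- A record and not a synonym, because the points cannot be recovered from the components of
  -- `Q ⊖ P`.
  record _≺ₚ_ (P Q : Point) : Set where
    constructor by
    field pos-diff : Pos (Q ⊖ P)
  open _≺ₚ_ public

  opaque
    ≺ₚ-irrefl : ∀ {P Q} → P ≡ Q → ¬ P ≺ₚ Q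
    ≺ₚ-irrefl {P₁ , P₂} refl p = Pos-irrefl (+-inverseʳ P₁) (+-inverseʳ P₂) (pos-diff p)

    ≺ₚ-trans : ∀ {P Q R} → P ≺ₚ Q → Q ≺ₚ R → P ≺ₚ R
    ≺ₚ-trans {P₁ , P₂} {Q₁ , Q₂} {R₁ , R₂} (by p) (by q) =
      by (subst Pos (cong₂ _,_ (telescope P₁ Q₁ R₁) (telescope P₂ Q₂ R₂)) (Pos-⊕ p q))

    ≺ₚ-asym : ∀ {P Q} → P ≺ₚ Q → ¬ Q ≺ₚ P
    ≺ₚ-asym p q = ≺ₚ-irrefl refl (≺ₚ-trans p q)

  data Compare (P Q : Point) : Set where
    lt : P ≺ₚ Q → Compare P Q
    eq : P ≡ Q → Compare P Q
    gt : Q ≺ₚ P → Compare P Q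

  opaque
    compareₚ : ∀ P Q → Compare P Q
    compareₚ (P₁ , P₂) (Q₁ , Q₂) with <-cmp P₁ Q₁
    ... | tri< p _ _ = lt (by (right (diff-pos p)))
    ... | tri> _ _ p = gt (by (right (diff-pos p)))
    ... | tri≈ _ refl _ with <-cmp P₂ Q₂
    ...   | tri< p _ _ = lt (by (up (+-inverseʳ P₁) (diff-pos p)))
    ...   | tri≈ _ refl _ = eq refl
    ...   | tri> _ _ p = gt (by (up (+-inverseʳ P₁) (diff-pos p)))

  -- Twice the signed area of the triangle ABC.
  det : Point → Point → Point → ℚ
  det (a₁ , a₂) (b₁ , b₂) (c₁ , c₂) = (b₁ - a₁) * (c₂ - a₂) - (b₂ - a₂) * (c₁ - a₁)

  module _ {k m : ℚ} (0<k : 0ℚ < k) (0≤m : 0ℚ ≤ m) (m≤k : m ≤ k) where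
    private
      i = proj₁ (inverse 0<k)
      0≤i = proj₁ (proj₂ (inverse 0<k))
      ki≡1 = proj₂ (proj₂ (inverse 0<k))

    ratio : ℚ
    ratio = m * i

    *-ratio : k * ratio ≡ m
    *-ratio = trans (solve 3 (λ k m i → k :* (m :* i) := m :* (k :* i)) refl k m i)
                    (trans (cong (m *_) ki≡1) (*-identityʳ m))

    0≤ratio : 0ℚ ≤ ratio
    0≤ratio = subst (_≤ ratio) (zeroˡ i) (*-mono-≤ 0≤i 0≤m)

    ratio≤1 : ratio ≤ 1ℚ
    ratio≤1 = subst (ratio ≤_) ki≡1 (*-mono-≤ 0≤i m≤k)

    ratio-along : ∀ {a b p} → k * (p - a) ≡ m * (b - a) → p ≡ (1ℚ - ratio) * a + ratio * b
    ratio-along {a} {b} {p} e = begin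
      p                                ≡⟨ solve 2 (λ a p → p := con (pos 1) :* (p :- a) :+ a) refl a p ⟩
      1ℚ * (p - a) + a                 ≡⟨ cong (λ z → z * (p - a) + a) ki≡1 ⟨
      (k * i) * (p - a) + a            ≡⟨ solve 4 (λ k i a p → (k :* i) :* (p :- a) :+ a := i :* (k :* (p :- a)) :+ a)
                                            refl k i a p ⟩
      i * (k * (p - a)) + a            ≡⟨ cong (λ z → i * z + a) e ⟩
      i * (m * (b - a)) + a            ≡⟨ solve 4 (λ i m a b → i :* (m :* (b :- a)) :+ a
                                             := (con (pos 1) :- m :* i) :* a :+ (m :* i) :* b) refl i m a b ⟩
      (1ℚ - ratio) * a + ratio * b     ∎
      where open ≡-Reasoning

    onSegment : ∀ {a₁ a₂ b₁ b₂ p₁ p₂} → k * (p₁ - a₁) ≡ m * (b₁ - a₁) → k * (p₂ - a₂) ≡ m * (b₂ - a₂) →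
                OnSegment (a₁ , a₂) (b₁ , b₂) (p₁ , p₂)
    onSegment {a₁} {a₂} {b₁} {b₂} e₁ e₂ = ratio , 0≤ratio , ratio≤1 ,
      trans (cong₂ _,_ (ratio-along e₁) (ratio-along e₂)) (sym (along-def ratio a₁ a₂ b₁ b₂))

  module _ {a₁ a₂ b₁ b₂ c₁ c₂ : ℚ} where
    private
      A B C : Point
      A = a₁ , a₂
      B = b₁ , b₂
      C = c₁ , c₂

      times-0 : ∀ x {y} → y ≡ 0ℚ → x * y ≡ 0ℚ
      times-0 x refl = zeroʳ x

      fst≥0 : ∀ {x y} → Pos (x , y) → 0ℚ ≤ x
      fst≥0 (right x>0) = <⇒≤ x>0
      fst≥0 (up x≡0 _) = ≤-reflexive (sym x≡0)

      -- If AB is not vertical, the first coordinates give the ratio at which C divides it, and the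
      -- vanishing determinant settles the second ones. If AB is vertical, C is on the same vertical
      -- line, since two horizontal steps that are not negative add up to 0, and the second
      -- coordinates give the ratio.
      aux : Pos (c₁ - a₁ , c₂ - a₂) → Pos (b₁ - c₁ , b₂ - c₂) → Pos (b₁ - a₁ , b₂ - a₂) → det A B C ≡ 0ℚ → OnSegment A B C
      aux p q (right k>0) d = onSegment k>0 (fst≥0 p)
        (subst (c₁ - a₁ ≤_) (telescope a₁ c₁ b₁) (+-incʳ-≤ (c₁ - a₁) (fst≥0 q)))
        (*-comm (b₁ - a₁) (c₁ - a₁)) (trans (x-y≡0⇒x≡y d) (*-comm (b₂ - a₂) (c₁ - a₁)))
      aux (right x>0) (right y>0) (up e _) d =
        ⊥-elim (<-irrefl (sym e) (subst (0ℚ <_) (telescope a₁ c₁ b₁) (+-pos x>0 y>0)))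
      aux (right x>0) (up y≡0 _) (up e _) d =
        ⊥-elim (<-irrefl (sym e) (subst (λ z → 0ℚ < z - a₁) (sym (x-y≡0⇒x≡y y≡0)) x>0))
      aux (up x≡0 _) (right y>0) (up e _) d =
        ⊥-elim (<-irrefl (sym e) (subst (λ z → 0ℚ < b₁ - z) (x-y≡0⇒x≡y x≡0) y>0))
      aux (up x≡0 x′>0) (up _ y′>0) (up e k>0) d = onSegment k>0 (<⇒≤ x′>0)
        (subst (c₂ - a₂ ≤_) (telescope a₂ c₂ b₂) (+-incʳ-≤ (c₂ - a₂) (<⇒≤ y′>0)))
        (trans (times-0 (b₂ - a₂) x≡0) (sym (times-0 (c₂ - a₂) e))) (*-comm (b₂ - a₂) (c₂ - a₂))

    between⇒onSegment : A ≺ₚ C → C ≺ₚ B → det A B C ≡ 0ℚ → OnSegment A B C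
    between⇒onSegment p q = aux (pos-diff p) (pos-diff q) (pos-diff (≺ₚ-trans p q))

  record Disjoint (A B C D : Point) : Set where
    constructor disjoint
    field apart : ∀ P → OnSegment A B P → ¬ OnSegment C D P
  open Disjoint public

  start-on : ∀ A B → OnSegment A B A
  start-on (a₁ , a₂) (b₁ , b₂) = 0ℚ , ≤-refl , 0≤1 ,
    trans (cong₂ _,_ (mix a₁ b₁) (mix a₂ b₂)) (sym (along-def 0ℚ a₁ a₂ b₁ b₂))
    where
    0≤1 : 0ℚ ≤ 1ℚ
    0≤1 = <⇒≤ (positive⁻¹ 1ℚ)
    mix : ∀ a b → a ≡ (1ℚ - 0ℚ) * a + 0ℚ * b
    mix = solve 2 (λ a b → a := (con (pos 1) :- con (pos 0)) :* a :+ con (pos 0) :* b) refl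

  OnSegment-sym : ∀ {A B P} → OnSegment A B P → OnSegment B A P
  OnSegment-sym {a₁ , a₂} {b₁ , b₂} (t , 0≤t , t≤1 , e) =
    1ℚ - t , subst (_≤ 1ℚ - t) (+-inverseʳ t) (+-mono-≤ t≤1 (≤-refl { - t}))
    , subst (1ℚ - t ≤_) (sym (minus-plus 1ℚ t)) (+-incʳ-≤ (1ℚ - t) 0≤t)
    , trans e (trans (along-def t a₁ a₂ b₁ b₂)
        (trans (cong₂ _,_ (flip-mix a₁ b₁) (flip-mix a₂ b₂)) (sym (along-def (1ℚ - t) b₁ b₂ a₁ a₂))))
    where
    flip-mix : ∀ a b → (1ℚ - t) * a + t * b ≡ (1ℚ - (1ℚ - t)) * b + (1ℚ - t) * a
    flip-mix = solve 3 (λ t a b → (con (pos 1) :- t) :* a :+ t :* b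
                         := (con (pos 1) :- (con (pos 1) :- t)) :* b :+ (con (pos 1) :- t) :* a) refl t

  end-on : ∀ A B → OnSegment A B B
  end-on A B = OnSegment-sym (start-on B A)

  module _ {k n m : ℚ} (k>0 : 0ℚ < k) (n≥0 : 0ℚ ≤ n) (n≤k : n ≤ k) where
    private
      r : ℚ
      r = ratio k>0 n≥0 n≤k

      coordinate : ∀ {a b c d} → k * (c - a) + n * (d - c) ≡ m * (b - a) →
                   k * (((1ℚ - r) * c + r * d) - a) ≡ m * (b - a)
      coordinate {a} {b} {c} {d} e = trans
        (solve 5 (λ k r a c d → k :* (((con (pos 1) :- r) :* c :+ r :* d) :- a)
                   := k :* (c :- a) :+ (k :* r) :* (d :- c)) refl k r a c d)
        (trans (cong (λ z → k * (c - a) + z * (d - c)) (*-ratio k>0 n≥0 n≤k)) e)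

    -- The equations say that the point at ratio m / k of AB is the point at ratio n / k of CD, with
    -- denominators cleared.
    meet : 0ℚ ≤ m → m ≤ k → ∀ {a₁ a₂ b₁ b₂ c₁ c₂ d₁ d₂} →
           k * (c₁ - a₁) + n * (d₁ - c₁) ≡ m * (b₁ - a₁) → k * (c₂ - a₂) + n * (d₂ - c₂) ≡ m * (b₂ - a₂) →
           ¬ Disjoint (a₁ , a₂) (b₁ , b₂) (c₁ , c₂) (d₁ , d₂)
    meet m≥0 m≤k {c₁ = c₁} {c₂} {d₁} {d₂} e₁ e₂ disj = apart disj _
      (onSegment k>0 m≥0 m≤k (coordinate e₁) (coordinate e₂))
      (r , 0≤ratio k>0 n≥0 n≤k , ratio≤1 k>0 n≥0 n≤k , sym (along-def r c₁ c₂ d₁ d₂))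

  module _ {a₁ a₂ b₁ b₂ c₁ c₂ d₁ d₂ : ℚ} where
    private
      A B C D : Point
      A = a₁ , a₂
      B = b₁ , b₂
      C = c₁ , c₂
      D = d₁ , d₂

      :det : ∀ {n} (a₁ a₂ b₁ b₂ c₁ c₂ : Polynomial n) → Polynomial n
      :det a₁ a₂ b₁ b₂ c₁ c₂ = (b₁ :- a₁) :* (c₂ :- a₂) :- (b₂ :- a₂) :* (c₁ :- a₁)

      -- Both sides are the cross product of B - A and D - C. Hence both segments have the same
      -- denominator in the ratios of their intersection.
      sum : det A B D - det A B C ≡ det C D A - det C D B
      sum = solve 8 (λ a₁ a₂ b₁ b₂ c₁ c₂ d₁ d₂ →
        :det a₁ a₂ b₁ b₂ d₁ d₂ :- :det a₁ a₂ b₁ b₂ c₁ c₂ := :det c₁ c₂ d₁ d₂ a₁ a₂ :- :det c₁ c₂ d₁ d₂ b₁ b₂)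
        refl a₁ a₂ b₁ b₂ c₁ c₂ d₁ d₂

    -- If C and D lie on different sides of AB, and A and B on different sides of
    -- CD, then AB and CD meet in (fD C - fC D) / (fD - fC), where f = det A B.
    crossing : det A B C < 0ℚ → 0ℚ < det A B D → det C D B ≤ 0ℚ → 0ℚ ≤ det C D A → ¬ Disjoint A B C D
    crossing fC<0 fD>0 gB≤0 gA≥0 = meet (+-pos fD>0 (neg-pos fC<0)) (<⇒≤ (neg-pos fC<0))
      (subst (- det A B C ≤_) (+-comm _ _) (+-incʳ-≤ (- det A B C) (<⇒≤ fD>0)))
      gA≥0 (subst (det C D A ≤_) (sym sum) (+-incʳ-≤ (det C D A) (neg-nonNeg gB≤0)))
      (solve 8 (λ a₁ a₂ b₁ b₂ c₁ c₂ d₁ d₂ →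
        (:det a₁ a₂ b₁ b₂ d₁ d₂ :- :det a₁ a₂ b₁ b₂ c₁ c₂) :* (c₁ :- a₁) :+ :- :det a₁ a₂ b₁ b₂ c₁ c₂ :* (d₁ :- c₁)
          := :det c₁ c₂ d₁ d₂ a₁ a₂ :* (b₁ :- a₁))
        refl a₁ a₂ b₁ b₂ c₁ c₂ d₁ d₂)
      (solve 8 (λ a₁ a₂ b₁ b₂ c₁ c₂ d₁ d₂ →
        (:det a₁ a₂ b₁ b₂ d₁ d₂ :- :det a₁ a₂ b₁ b₂ c₁ c₂) :* (c₂ :- a₂) :+ :- :det a₁ a₂ b₁ b₂ c₁ c₂ :* (d₂ :- c₂)
          := :det c₁ c₂ d₁ d₂ a₁ a₂ :* (b₂ :- a₂))
        refl a₁ a₂ b₁ b₂ c₁ c₂ d₁ d₂)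

-- Crossing parity of two segments

module CrossingParity where

  open import Defs
  open Rationals
  open Segments
  open import Data.Bool using (Bool; true; false; _∧_; _∨_; _xor_; not)
  open import Data.Bool.Properties using (∨-comm; ∧-zeroʳ; xor-∧-commutativeRing; not-involutive; xor-comm; xor-identityʳ)
  open import Algebra.Bundles using (CommutativeRing)
  open import Data.Empty using (⊥; ⊥-elim)
  open import Data.Rational using (ℚ; 0ℚ; _<_; _≤_)
  open import Data.Rational.Properties using (<-cmp; <⇒≤; _<?_; <-asym)
  open import Data.Product using (_,_; proj₁; proj₂)
  open import Relation.Binary using (tri<; tri≈; tri>)
  open import Relation.Binary.PropositionalEquality
  open import Relation.Nullary.Decidable using (does; dec-true; dec-false)

  module xor = CommutativeRing xor-∧-commutativeRing
  open import Algebra.Properties.CommutativeSemigroup xor.+-commutativeSemigroup public using (interchange)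

  not-xor-not : ∀ p q → not p xor not q ≡ p xor q
  not-xor-not true  q = refl
  not-xor-not false q = not-involutive q

  isLt : ∀ {P Q} → Compare P Q → Bool
  isLt (lt _) = true
  isLt _ = false

  opaque
    less : Point → Point → Bool
    less P Q = isLt (compareₚ P Q)

    less-true : ∀ {P Q} → P ≺ₚ Q → less P Q ≡ true
    less-true {P} {Q} p with compareₚ P Q
    ... | lt _ = refl
    ... | eq q = ⊥-elim (≺ₚ-irrefl q p)
    ... | gt q = ⊥-elim (≺ₚ-asym p q)

    less-false : ∀ {P Q} → Q ≺ₚ P → less P Q ≡ false
    less-false {P} {Q} p with compareₚ P Q
    ... | lt q = ⊥-elim (≺ₚ-asym p q)
    ... | eq _ = refl
    ... | gt _ = refl

    less-not : ∀ {P Q} → P ≢ Q → less P Q ≡ not (less Q P)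
    less-not {P} {Q} ne with compareₚ P Q
    ... | lt p = cong not (sym (less-false p))
    ... | eq e = ⊥-elim (ne e)
    ... | gt p = cong not (sym (less-true p))

    -- If A is to the left of B, a negative area means that C lies below the line AB.
    below : Point → Point → Point → Bool
    below A B C = does (det A B C <? 0ℚ)

    below-true : ∀ {A B C} → det A B C < 0ℚ → below A B C ≡ true
    below-true {A} {B} {C} p = dec-true (det A B C <? 0ℚ) p

    below-false : ∀ {A B C} → 0ℚ < det A B C → below A B C ≡ false
    below-false {A} {B} {C} p = dec-false (det A B C <? 0ℚ) (<-asym p)

  opaque
    -- Whether the upward ray from C meets AB.
    cross : Point → Point → Point → Bool
    cross A B C = (less A C ∧ less C B ∧ below A B C) ∨ (less B C ∧ less C A ∧ below B A C)

    cross-sym : ∀ A B C → cross A B C ≡ cross B A C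
    cross-sym A B C = ∨-comm (less A C ∧ less C B ∧ below A B C) (less B C ∧ less C A ∧ below B A C)

    cross-left : ∀ {A B C} → C ≺ₚ A → C ≺ₚ B → cross A B C ≡ false
    cross-left p q rewrite less-false p | less-false q = refl

    cross-right : ∀ {A B C} → A ≺ₚ C → B ≺ₚ C → cross A B C ≡ false
    cross-right {A} {B} {C} p q rewrite less-false p | less-false q = cong₂ _∨_ (∧-zeroʳ (less A C)) (∧-zeroʳ (less B C))

    cross-between : ∀ {A B C} → A ≺ₚ C → C ≺ₚ B → cross A B C ≡ below A B C
    cross-between {A} {B} {C} p q rewrite less-true p | less-true q | less-false q with below A B C
    ... | true = refl
    ... | false = refl

  -- The crossing parity of two disjoint arcs, completed to infinity by upward
  -- rays at their endpoints, depends only on whether the endpoints interleave.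
  Even : Point → Point → Point → Point → Bool → Bool → Bool → Bool → Set
  Even A B C D p q r s = (p xor q) xor (r xor s) ≡ (less A C xor less A D) xor (less B C xor less B D)

  EvenSeg : Point → Point → Point → Point → Set
  EvenSeg A B C D = Even A B C D (cross A B C) (cross A B D) (cross C D A) (cross C D B)

  opaque
    Disjoint-flipˡ : ∀ {A B C D} → Disjoint A B C D → Disjoint B A C D
    Disjoint-flipˡ (disjoint d) = disjoint λ P p → d P (OnSegment-sym p)

    Disjoint-flipʳ : ∀ {A B C D} → Disjoint A B C D → Disjoint A B D C
    Disjoint-flipʳ (disjoint d) = disjoint λ P p q → d P p (OnSegment-sym q)

    Disjoint-swap : ∀ {A B C D} → Disjoint A B C D → Disjoint C D A B
    Disjoint-swap (disjoint d) = disjoint λ P p q → d P q p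

  opaque
    AC-distinct : ∀ {A B C D} → Disjoint A B C D → A ≢ C
    AC-distinct {A} {B} {C} {D} (disjoint d) refl = d A (start-on A B) (start-on A D)

    on-line : ∀ {A B C D} → Disjoint A B C D → A ≺ₚ C → C ≺ₚ B → det A B C ≢ 0ℚ
    on-line {C = C} {D} (disjoint d) p q e = d C (between⇒onSegment p q e) (start-on C D)

  data Sign (x : ℚ) : Set where
    neg : x < 0ℚ → Sign x
    pos : 0ℚ < x → Sign x

  sign : ∀ {x} → x ≢ 0ℚ → Sign x
  sign {x} ne with <-cmp x 0ℚ
  ... | tri< p _ _ = neg p
  ... | tri≈ _ e _ = ⊥-elim (ne e)
  ... | tri> _ _ p = pos p

  module _ {v w z : Vector} {p q r : ℚ}
           (v>0 : Pos v) (w>0 : Pos w) (z>0 : Pos z) (e : p • v ≡ (- q) • w ⊕ (- r) • z) where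

    opposite-pos : q < 0ℚ → r < 0ℚ → 0ℚ < p
    opposite-pos q<0 r<0 = Pos-•⁻¹ v>0 (subst Pos (sym e) (Pos-⊕ (Pos-• (neg-pos q<0) w>0) (Pos-• (neg-pos r<0) z>0)))

    opposite-neg : 0ℚ < q → 0ℚ < r → p < 0ℚ
    opposite-neg q>0 r>0 = subst (_< 0ℚ) (neg-neg p) (pos-neg (Pos-•⁻¹ v>0
      (subst Pos (cong₂ _,_ (flip-signs (cong proj₁ e)) (flip-signs (cong proj₂ e))) (Pos-⊕ (Pos-• q>0 w>0) (Pos-• r>0 z>0)))))
      where
      neg-neg : ∀ x → - (- x) ≡ x
      neg-neg = solve 1 (λ x → :- (:- x) := x) refl
      pos-neg : ∀ {x} → 0ℚ < x → - x < 0ℚ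
      pos-neg {x} x>0 = subst (- x <_) neg-0 (neg-mono-< x>0)
      flip-signs : ∀ {a b c} → p * a ≡ - q * b + - r * c → q * b + r * c ≡ - p * a
      flip-signs {a} {b} {c} e = trans
        (solve 4 (λ q b r c → q :* b :+ r :* c := :- (:- q :* b :+ :- r :* c)) refl q b r c)
        (trans (cong -_ (sym e)) (solve 2 (λ p a → :- (p :* a) := :- p :* a) refl p a))

  :det : ∀ {n} (a₁ a₂ b₁ b₂ c₁ c₂ : Polynomial n) → Polynomial n
  :det a₁ a₂ b₁ b₂ c₁ c₂ = (b₁ :- a₁) :* (c₂ :- a₂) :- (b₂ :- a₂) :* (c₁ :- a₁)

  det-flip : ∀ A B C → det B A C ≡ - det A B C
  det-flip (a₁ , a₂) (b₁ , b₂) (c₁ , c₂) = solve 6 (λ a₁ a₂ b₁ b₂ c₁ c₂ →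
    :det b₁ b₂ a₁ a₂ c₁ c₂ := :- :det a₁ a₂ b₁ b₂ c₁ c₂) refl a₁ a₂ b₁ b₂ c₁ c₂

  module _ (A B C D : Point) where
    private
      a₁ = proj₁ A
      a₂ = proj₂ A
      b₁ = proj₁ B
      b₂ = proj₂ B
      c₁ = proj₁ C
      c₂ = proj₂ C
      d₁ = proj₁ D
      d₂ = proj₂ D

    -- The names abbreviate `det A B` by f and `det C D` by g. Once the four points are ordered, the
    -- difference vectors in these identities are lexicographically positive, and two signs among
    -- the coefficients force the third.
    gA-BC : det C D A • (B ⊖ C) ≡ (- det C D B) • (C ⊖ A) ⊕ (- det A B C) • (D ⊖ C)
    gA-BC = cong₂ _,_
      (solve 8 (λ a₁ a₂ b₁ b₂ c₁ c₂ d₁ d₂ → :det c₁ c₂ d₁ d₂ a₁ a₂ :* (b₁ :- c₁)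
        := :- :det c₁ c₂ d₁ d₂ b₁ b₂ :* (c₁ :- a₁) :+ :- :det a₁ a₂ b₁ b₂ c₁ c₂ :* (d₁ :- c₁))
        refl a₁ a₂ b₁ b₂ c₁ c₂ d₁ d₂)
      (solve 8 (λ a₁ a₂ b₁ b₂ c₁ c₂ d₁ d₂ → :det c₁ c₂ d₁ d₂ a₁ a₂ :* (b₂ :- c₂)
        := :- :det c₁ c₂ d₁ d₂ b₁ b₂ :* (c₂ :- a₂) :+ :- :det a₁ a₂ b₁ b₂ c₁ c₂ :* (d₂ :- c₂))
        refl a₁ a₂ b₁ b₂ c₁ c₂ d₁ d₂)

    fD-BC : det A B D • (B ⊖ C) ≡ (- det C D B) • (B ⊖ A) ⊕ (- det A B C) • (D ⊖ B)
    fD-BC = cong₂ _,_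
      (solve 8 (λ a₁ a₂ b₁ b₂ c₁ c₂ d₁ d₂ → :det a₁ a₂ b₁ b₂ d₁ d₂ :* (b₁ :- c₁)
        := :- :det c₁ c₂ d₁ d₂ b₁ b₂ :* (b₁ :- a₁) :+ :- :det a₁ a₂ b₁ b₂ c₁ c₂ :* (d₁ :- b₁))
        refl a₁ a₂ b₁ b₂ c₁ c₂ d₁ d₂)
      (solve 8 (λ a₁ a₂ b₁ b₂ c₁ c₂ d₁ d₂ → :det a₁ a₂ b₁ b₂ d₁ d₂ :* (b₂ :- c₂)
        := :- :det c₁ c₂ d₁ d₂ b₁ b₂ :* (b₂ :- a₂) :+ :- :det a₁ a₂ b₁ b₂ c₁ c₂ :* (d₂ :- b₂))
        refl a₁ a₂ b₁ b₂ c₁ c₂ d₁ d₂)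

    gA-BA : det C D A • (B ⊖ A) ≡ det A B D • (C ⊖ A) ⊕ (- det A B C) • (D ⊖ A)
    gA-BA = cong₂ _,_
      (solve 8 (λ a₁ a₂ b₁ b₂ c₁ c₂ d₁ d₂ → :det c₁ c₂ d₁ d₂ a₁ a₂ :* (b₁ :- a₁)
        := :det a₁ a₂ b₁ b₂ d₁ d₂ :* (c₁ :- a₁) :+ :- :det a₁ a₂ b₁ b₂ c₁ c₂ :* (d₁ :- a₁))
        refl a₁ a₂ b₁ b₂ c₁ c₂ d₁ d₂)
      (solve 8 (λ a₁ a₂ b₁ b₂ c₁ c₂ d₁ d₂ → :det c₁ c₂ d₁ d₂ a₁ a₂ :* (b₂ :- a₂)
        := :det a₁ a₂ b₁ b₂ d₁ d₂ :* (c₂ :- a₂) :+ :- :det a₁ a₂ b₁ b₂ c₁ c₂ :* (d₂ :- a₂))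
        refl a₁ a₂ b₁ b₂ c₁ c₂ d₁ d₂)

    gB-BA : det D C B • (B ⊖ A) ≡ det A B D • (B ⊖ C) ⊕ (- det A B C) • (B ⊖ D)
    gB-BA = cong₂ _,_
      (solve 8 (λ a₁ a₂ b₁ b₂ c₁ c₂ d₁ d₂ → :det d₁ d₂ c₁ c₂ b₁ b₂ :* (b₁ :- a₁)
        := :det a₁ a₂ b₁ b₂ d₁ d₂ :* (b₁ :- c₁) :+ :- :det a₁ a₂ b₁ b₂ c₁ c₂ :* (b₁ :- d₁))
        refl a₁ a₂ b₁ b₂ c₁ c₂ d₁ d₂)
      (solve 8 (λ a₁ a₂ b₁ b₂ c₁ c₂ d₁ d₂ → :det d₁ d₂ c₁ c₂ b₁ b₂ :* (b₂ :- a₂)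
        := :det a₁ a₂ b₁ b₂ d₁ d₂ :* (b₂ :- c₂) :+ :- :det a₁ a₂ b₁ b₂ c₁ c₂ :* (b₂ :- d₂))
        refl a₁ a₂ b₁ b₂ c₁ c₂ d₁ d₂)

  module _ {A B C D : Point} (disj : Disjoint A B C D) where

    -- With C below AB and B below CD, the identities put D above AB and A above CD, so each segment
    -- separates the ends of the other.
    overlap-neg : A ≺ₚ C → C ≺ₚ B → B ≺ₚ D → det A B C < 0ℚ → det C D B < 0ℚ → ⊥
    overlap-neg AC CB BD fC gB = crossing fC
      (opposite-pos (pos-diff CB) (pos-diff (≺ₚ-trans AC CB)) (pos-diff BD) (fD-BC A B C D) gB fC)
      (<⇒≤ gB)
      (<⇒≤ (opposite-pos (pos-diff CB) (pos-diff AC) (pos-diff (≺ₚ-trans CB BD)) (gA-BC A B C D) gB fC))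
      disj

    overlap-pos : A ≺ₚ C → C ≺ₚ B → B ≺ₚ D → 0ℚ < det A B C → 0ℚ < det C D B → ⊥
    overlap-pos AC CB BD fC gB = crossing
      (opposite-neg (pos-diff CB) (pos-diff (≺ₚ-trans AC CB)) (pos-diff BD) (fD-BC A B C D) gB fC)
      fC
      (subst (_≤ 0ℚ) (sym (det-flip C D B)) (subst (- det C D B ≤_) neg-0 (neg-mono-≤ (<⇒≤ gB))))
      (subst (0ℚ ≤_) (sym (det-flip C D A)) (<⇒≤ (neg-pos
        (opposite-neg (pos-diff CB) (pos-diff AC) (pos-diff (≺ₚ-trans CB BD)) (gA-BC A B C D) gB fC))))
      (Disjoint-flipʳ disj)

    -- That the line AB separates C and D does not suffice for a crossing. The line CD separates A
    -- and B as well, since both C and D lie between A and B.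
    inside : A ≺ₚ C → C ≺ₚ B → A ≺ₚ D → D ≺ₚ B → det A B C < 0ℚ → 0ℚ < det A B D → ⊥
    inside AC CB AD DB fC fD = crossing fC fD
      (subst (_≤ 0ℚ) (sym (det-flip D C B)) (subst (- det D C B ≤_) neg-0 (neg-mono-≤ (<⇒≤ gB))))
      (<⇒≤ gA) disj
      where
      gA : 0ℚ < det C D A
      gA = Pos-•⁻¹ (pos-diff (≺ₚ-trans AC CB)) (subst Pos (sym (gA-BA A B C D))
             (Pos-⊕ (Pos-• fD (pos-diff AC)) (Pos-• (neg-pos fC) (pos-diff AD))))
      gB : 0ℚ < det D C B
      gB = Pos-•⁻¹ (pos-diff (≺ₚ-trans AC CB)) (subst Pos (sym (gB-BA A B C D))
             (Pos-⊕ (Pos-• fD (pos-diff CB)) (Pos-• (neg-pos fC) (pos-diff DB))))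

  module _ {A B C D : Point} (disj : Disjoint A B C D) where

    even-apart : A ≺ₚ B → C ≺ₚ D → B ≺ₚ C → EvenSeg A B C D
    even-apart AB CD BC
      rewrite cross-right (≺ₚ-trans AB BC) BC
            | cross-right (≺ₚ-trans AB (≺ₚ-trans BC CD)) (≺ₚ-trans BC CD)
            | cross-left (≺ₚ-trans AB BC) (≺ₚ-trans AB (≺ₚ-trans BC CD))
            | cross-left BC (≺ₚ-trans BC CD)
            | less-true (≺ₚ-trans AB BC) | less-true (≺ₚ-trans AB (≺ₚ-trans BC CD))
            | less-true BC | less-true (≺ₚ-trans BC CD) = refl

    even-overlap : A ≺ₚ C → C ≺ₚ B → B ≺ₚ D → EvenSeg A B C D
    even-overlap AC CB BD
      rewrite cross-between AC CB
            | cross-right (≺ₚ-trans AC (≺ₚ-trans CB BD)) BD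
            | cross-left AC (≺ₚ-trans AC (≺ₚ-trans CB BD))
            | cross-between CB BD
            | less-true AC | less-true (≺ₚ-trans AC (≺ₚ-trans CB BD))
            | less-false CB | less-true BD
      = trans (cong (_xor below C D B) (xor-identityʳ (below A B C)))
          (opposite (sign (on-line disj AC CB)) (sign (on-line (Disjoint-flipʳ (Disjoint-swap disj)) CB BD)))
      where
      opposite : Sign (det A B C) → Sign (det C D B) → below A B C xor below C D B ≡ true
      opposite (neg f) (neg g) = ⊥-elim (overlap-neg disj AC CB BD f g)
      opposite (pos f) (pos g) = ⊥-elim (overlap-pos disj AC CB BD f g)
      opposite (neg f) (pos g) = cong₂ _xor_ (below-true f) (below-false g)
      opposite (pos f) (neg g) = cong₂ _xor_ (below-false f) (below-true g)

    even-inside : A ≺ₚ C → C ≺ₚ D → D ≺ₚ B → EvenSeg A B C D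
    even-inside AC CD DB
      rewrite cross-between AC (≺ₚ-trans CD DB)
            | cross-between (≺ₚ-trans AC CD) DB
            | cross-left AC (≺ₚ-trans AC CD)
            | cross-right (≺ₚ-trans CD DB) DB
            | less-true AC | less-true (≺ₚ-trans AC CD)
            | less-false (≺ₚ-trans CD DB) | less-false DB
      = trans (xor-identityʳ (below A B C xor below A B D))
          (same (sign (on-line disj AC (≺ₚ-trans CD DB))) (sign (on-line (Disjoint-flipʳ disj) (≺ₚ-trans AC CD) DB)))
      where
      same : Sign (det A B C) → Sign (det A B D) → below A B C xor below A B D ≡ false
      same (neg f) (neg g) = cong₂ _xor_ (below-true f) (below-true g)
      same (pos f) (pos g) = cong₂ _xor_ (below-false f) (below-false g)
      same (neg f) (pos g) = ⊥-elim (inside disj AC (≺ₚ-trans CD DB) (≺ₚ-trans AC CD) DB f g)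
      same (pos f) (neg g) = ⊥-elim (inside (Disjoint-flipʳ disj) (≺ₚ-trans AC CD) DB AC (≺ₚ-trans CD DB) g f)

    even-flipˡ : EvenSeg B A C D → EvenSeg A B C D
    even-flipˡ e
      rewrite cross-sym A B C | cross-sym A B D
            | xor-comm (cross C D A) (cross C D B)
            | xor-comm (less A C xor less A D) (less B C xor less B D) = e

    even-flipʳ : EvenSeg A B D C → EvenSeg A B C D
    even-flipʳ e
      rewrite cross-sym C D A | cross-sym C D B
            | xor-comm (cross A B C) (cross A B D)
            | xor-comm (less A C) (less A D) | xor-comm (less B C) (less B D) = e

    -- Exchanging the segments negates all four comparisons, an even number, and so preserves their
    -- sum.
    even-swap : EvenSeg C D A B → EvenSeg A B C D
    even-swap e
      rewrite less-not (AC-distinct disj)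
            | less-not (AC-distinct (Disjoint-flipʳ disj))
            | less-not (AC-distinct (Disjoint-flipˡ disj))
            | less-not (AC-distinct (Disjoint-flipˡ (Disjoint-flipʳ disj)))
            | xor-comm (cross A B C xor cross A B D) (cross C D A xor cross C D B)
            | e = not⁴ (less C A) (less C B) (less D A) (less D B)
      where
      not⁴ : ∀ p q r s → (p xor q) xor (r xor s) ≡ (not p xor not r) xor (not q xor not s)
      not⁴ p q r s = trans (interchange p q r s) (sym (cong₂ _xor_ (not-xor-not p r) (not-xor-not q s)))

  even-sorted : ∀ {A B C D} → Disjoint A B C D → A ≺ₚ B → C ≺ₚ D → A ≺ₚ C → EvenSeg A B C D
  even-sorted {A} {B} {C} {D} disj AB CD AC with compareₚ B C
  ... | lt BC = even-apart disj AB CD BC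
  ... | eq BC = ⊥-elim (AC-distinct (Disjoint-flipˡ disj) BC)
  ... | gt CB with compareₚ B D
  ...   | lt BD = even-overlap disj AC CB BD
  ...   | eq BD = ⊥-elim (AC-distinct (Disjoint-flipˡ (Disjoint-flipʳ disj)) BD)
  ...   | gt DB = even-inside disj AC CD DB

  even-directed : ∀ {A B C D} → Disjoint A B C D → A ≺ₚ B → C ≺ₚ D → EvenSeg A B C D
  even-directed {A} {B} {C} {D} disj AB CD with compareₚ A C
  ... | lt AC = even-sorted disj AB CD AC
  ... | eq AC = ⊥-elim (AC-distinct disj AC)
  ... | gt CA = even-swap disj (even-sorted (Disjoint-swap disj) CD AB CA)

  even-segments : ∀ {A B C D} → A ≢ B → C ≢ D → Disjoint A B C D → EvenSeg A B C D
  even-segments {A} {B} {C} {D} AB CD disj with compareₚ A B | compareₚ C D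
  ... | eq e | _    = ⊥-elim (AB e)
  ... | _    | eq e = ⊥-elim (CD e)
  ... | lt p | lt q = even-directed disj p q
  ... | lt p | gt q = even-flipʳ disj (even-directed (Disjoint-flipʳ disj) p q)
  ... | gt p | lt q = even-flipˡ disj (even-directed (Disjoint-flipˡ disj) p q)
  ... | gt p | gt q = even-flipˡ disj (even-flipʳ (Disjoint-flipˡ disj)
                        (even-directed (Disjoint-flipˡ (Disjoint-flipʳ disj)) p q))

-- Crossing parities in a plane drawing

module ArcParity where

  open import Defs
  open Segments
  open CrossingParity using (less; less-not; cross; Even; even-segments; interchange)
  open import Data.Bool using (Bool; false; _xor_; not)
  open import Data.Bool.Properties using (xor-same; xor-assoc)
  open import Data.List using (List; []; _∷_; _++_; [_])
  open import Data.Rational.Properties using (_≟_)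
  open import Data.Product using (_,_)
  open import Data.Product.Properties using (≡-dec)
  open import Data.Sum using (inj₁; inj₂)
  open import Relation.Binary.PropositionalEquality hiding ([_])
  open import Relation.Nullary using (¬_; Dec; yes; no)

  -- What remains of a plane drawing after forgetting the geometry. Let the rays
  -- upwards from all vertices be given; h compares their positions, and a e x is
  -- the number of crossings modulo 2 of the edge e with the ray from x.
  record Parity {V : Set} (E : V → V → Set) : Set where
    field
      h     : V → V → Bool
      h-not : ∀ {x y} → x ≢ y → h x y ≡ not (h y x)
      a     : ∀ {u v} → E u v → V → Bool
      even  : ∀ {u v x y} (e : E u v) (f : E x y) → u ≢ x → u ≢ y → v ≢ x → v ≢ y →
              (a e x xor a e y) xor (a f u xor a f v) ≡ (h u x xor h u y) xor (h v x xor h v y)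

  xor-join : ∀ p q r → (p xor q) xor (q xor r) ≡ p xor r
  xor-join p q r = trans (xor-assoc p q (q xor r)) (cong (p xor_)
    (trans (sym (xor-assoc q q r)) (cong (_xor r) (xor-same q))))

  -- For prolonging the second arc by a piece: the ray at the joint enters both equations and
  -- cancels. `glueˡ` does the same for the first arc.
  glueʳ : ∀ {p q r s s′ t t′ k l n k′ l′ n′} →
    (p xor q) xor (s xor s′) ≡ (k xor l) xor (k′ xor l′) →
    (q xor r) xor (t xor t′) ≡ (l xor n) xor (l′ xor n′) →
    (p xor r) xor ((s xor t) xor (s′ xor t′)) ≡ (k xor n) xor (k′ xor n′)
  glueʳ {p} {q} {r} {s} {s′} {t} {t′} {k} {l} {n} {k′} {l′} {n′} e f = begin
    (p xor r) xor ((s xor t) xor (s′ xor t′))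
      ≡⟨ cong₂ _xor_ (xor-join p q r) (interchange s s′ t t′) ⟨
    ((p xor q) xor (q xor r)) xor ((s xor s′) xor (t xor t′))
      ≡⟨ interchange (p xor q) (q xor r) (s xor s′) (t xor t′) ⟩
    ((p xor q) xor (s xor s′)) xor ((q xor r) xor (t xor t′))
      ≡⟨ cong₂ _xor_ e f ⟩
    ((k xor l) xor (k′ xor l′)) xor ((l xor n) xor (l′ xor n′))
      ≡⟨ interchange (k xor l) (k′ xor l′) (l xor n) (l′ xor n′) ⟩
    ((k xor l) xor (l xor n)) xor ((k′ xor l′) xor (l′ xor n′))
      ≡⟨ cong₂ _xor_ (xor-join k l n) (xor-join k′ l′ n′) ⟩
    (k xor n) xor (k′ xor n′) ∎
    where open ≡-Reasoning

  glueˡ : ∀ {p q p′ q′ r s t k l m} →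
    (p xor q) xor (r xor s) ≡ k xor l →
    (p′ xor q′) xor (s xor t) ≡ l xor m →
    ((p xor p′) xor (q xor q′)) xor (r xor t) ≡ k xor m
  glueˡ {p} {q} {p′} {q′} {r} {s} {t} {k} {l} {m} e f = begin
    ((p xor p′) xor (q xor q′)) xor (r xor t)
      ≡⟨ cong₂ _xor_ (interchange p q p′ q′) (xor-join r s t) ⟨
    ((p xor q) xor (p′ xor q′)) xor ((r xor s) xor (s xor t))
      ≡⟨ interchange (p xor q) (p′ xor q′) (r xor s) (s xor t) ⟩
    ((p xor q) xor (r xor s)) xor ((p′ xor q′) xor (s xor t))
      ≡⟨ cong₂ _xor_ e f ⟩
    (k xor l) xor (l xor m)
      ≡⟨ xor-join k l m ⟩
    k xor m ∎
    where open ≡-Reasoning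

  crossArc : List Point → Point → Bool
  crossArc (A ∷ B ∷ As) C = cross A B C xor crossArc (B ∷ As) C
  crossArc _ C = false

  lastOf : Point → List Point → Point
  lastOf A [] = A
  lastOf A (B ∷ As) = lastOf B As

  lastOf-++ : ∀ A As B → lastOf A (As ++ [ B ]) ≡ B
  lastOf-++ A [] B = refl
  lastOf-++ A (A′ ∷ As) B = lastOf-++ A′ As B

  record Apart (As Bs : List Point) : Set where
    constructor apart-by
    field noCommon : ∀ P → OnArc As P → ¬ OnArc Bs P

  apart-segments : ∀ {A A′ As B B′ Bs} → Apart (A ∷ A′ ∷ As) (B ∷ B′ ∷ Bs) → Disjoint A A′ B B′
  apart-segments (apart-by d) = disjoint λ P p q → d P (inj₁ p) (inj₁ q)

  apart-tailˡ : ∀ {A A′ As Bs} → Apart (A ∷ A′ ∷ As) Bs → Apart (A′ ∷ As) Bs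
  apart-tailˡ (apart-by d) = apart-by λ P p → d P (inj₂ p)

  apart-tailʳ : ∀ {As B B′ Bs} → Apart As (B ∷ B′ ∷ Bs) → Apart As (B′ ∷ Bs)
  apart-tailʳ (apart-by d) = apart-by λ P p q → d P p (inj₂ q)

  even-segment-arc : ∀ A A′ As B Bs → A ≢ A′ → SimpleArc (B ∷ Bs) → Apart (A ∷ A′ ∷ As) (B ∷ Bs) →
    Even A A′ B (lastOf B Bs) (cross A A′ B) (cross A A′ (lastOf B Bs)) (crossArc (B ∷ Bs) A) (crossArc (B ∷ Bs) A′)
  -- An arc of one point is crossed by no ray, and the rays at its two ends coincide.
  even-segment-arc A A′ As B [] ne sB d = trans (cong (_xor false) (xor-same (cross A A′ B)))
    (sym (cong₂ _xor_ (xor-same (less A B)) (xor-same (less A′ B))))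
  even-segment-arc A A′ As B (B′ ∷ Bs) ne (B≢B′ , _ , sB) d =
    glueʳ {cross A A′ B} {cross A A′ B′} {cross A A′ (lastOf B′ Bs)} {cross B B′ A} {cross B B′ A′}
          {crossArc (B′ ∷ Bs) A} {crossArc (B′ ∷ Bs) A′} {less A B} {less A B′} {less A (lastOf B′ Bs)}
          {less A′ B} {less A′ B′}
      (even-segments ne B≢B′ (apart-segments d)) (even-segment-arc A A′ As B′ Bs ne sB (apart-tailʳ d))

  even-arcs : ∀ A As B Bs → SimpleArc (A ∷ As) → SimpleArc (B ∷ Bs) → Apart (A ∷ As) (B ∷ Bs) →
    Even A (lastOf A As) B (lastOf B Bs) (crossArc (A ∷ As) B) (crossArc (A ∷ As) (lastOf B Bs))
      (crossArc (B ∷ Bs) A) (crossArc (B ∷ Bs) (lastOf A As))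
  even-arcs A [] B Bs sA sB d = trans (xor-same (crossArc (B ∷ Bs) A))
    (sym (xor-same (less A B xor less A (lastOf B Bs))))
  even-arcs A (A′ ∷ As) B Bs (A≢A′ , _ , sA) sB d =
    glueˡ {cross A A′ B} {cross A A′ (lastOf B Bs)} {crossArc (A′ ∷ As) B} {crossArc (A′ ∷ As) (lastOf B Bs)}
          {crossArc (B ∷ Bs) A} {crossArc (B ∷ Bs) A′}
          {k = less A B xor less A (lastOf B Bs)}
          {less A′ B xor less A′ (lastOf B Bs)}
      (even-segment-arc A A′ As B Bs A≢A′ sB d) (even-arcs A′ As B Bs sA sB (apart-tailˡ d))

  module _ {G : Graph} (D : PlaneDrawing G) where
    open Graph G
    open PlaneDrawing D

    private
      _≟ₚ_ : (P Q : Point) → Dec (P ≡ Q)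
      _≟ₚ_ = ≡-dec _≟_ _≟_

      off-vertex : ∀ {x y u P} → x ~ y → u ≢ x → u ≢ y → P ≡ pos u → ¬ OnArc (arc x y) P
      off-vertex e ux uy refl on = no-vertex e _ (on , (λ p → ux (pos-injective p)) , (λ p → uy (pos-injective p)))

      -- `no-crossing` speaks of the interior of the first arc only. The ends of that arc are
      -- vertices, which `no-vertex` keeps off the interior of the second one.
      independent : ∀ {u v x y} → u ~ v → x ~ y → u ≢ x → u ≢ y → v ≢ x → v ≢ y → Apart (arc u v) (arc x y)
      independent {u} {v} {x} {y} e f ux uy vx vy = apart-by λ P p → cases P p (P ≟ₚ pos u) (P ≟ₚ pos v)
        where
        different : ¬ SameEdge u v x y
        different (inj₁ (p , _)) = ux p
        different (inj₂ (p , _)) = uy p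
        cases : ∀ P → OnArc (arc u v) P → Dec (P ≡ pos u) → Dec (P ≡ pos v) → ¬ OnArc (arc x y) P
        cases P p (yes q) _ = off-vertex f ux uy q
        cases P p (no _) (yes q) = off-vertex f vx vy q
        cases P p (no q) (no r) = no-crossing e f different P (p , q , r)

    parity : Parity _~_
    parity = record
      { h = λ x y → less (pos x) (pos y)
      ; h-not = λ ne → less-not (λ p → ne (pos-injective p))
      ; a = λ {u} {v} _ x → crossArc (arc u v) (pos x)
      ; even = λ {u} {v} {x} {y} e f ux uy vx vy →
          subst₂ (λ V Y → Even (pos u) V (pos x) Y (crossArc (arc u v) (pos x)) (crossArc (arc u v) Y)
                               (crossArc (arc x y) (pos u)) (crossArc (arc x y) V))
            (lastOf-++ (pos u) (bends u v) (pos v)) (lastOf-++ (pos x) (bends x y) (pos y))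
            (even-arcs _ _ _ _ (arc-simple e) (arc-simple f) (independent e f ux uy vx vy))
      }

-- Non-planarity of K₅ and contraction of edges

module Contractions where

  open ArcParity
  open import Data.Bool using (Bool; true; false; _xor_; not)
  open import Data.Bool.Solver using (module xor-∧-Solver)
  open import Data.Empty using (⊥; ⊥-elim)
  open import Data.Product using (_×_; _,_)
  open import Data.Sum using (_⊎_; inj₁; inj₂)
  open import Relation.Binary.PropositionalEquality
  open xor-∧-Solver

  module _ {V : Set} {E : V → V → Set} (P : Parity E) where
    open Parity P

    -- The crossing parity of the ray from `v` with the closed curve through i, j and k.
    around : ∀ {i j k} → V → E i j → E i k → E j k → Bool
    around v e f g = (a e v xor a f v) xor a g v

    private
      rhs : ∀ p q r s t u →
        (((p xor q) xor (r xor s)) xor ((t xor q) xor (not r xor u))) xor ((t xor p) xor (not s xor not u)) ≡ true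
      rhs = solve 6 (λ p q r s t u →
        (((p :+ q) :+ (r :+ s)) :+ ((t :+ q) :+ ((con true :+ r) :+ u))) :+ ((t :+ p) :+ ((con true :+ s) :+ (con true :+ u)))
          := con true) refl

      lhs : ∀ a b c d e f g h i j k l →
        (((a xor b) xor (c xor d)) xor ((e xor f) xor (g xor h))) xor ((i xor j) xor (k xor l))
          ≡ (((k xor g) xor c) xor ((e xor i) xor d)) xor (((a xor j) xor h) xor ((b xor f) xor l))
      lhs = solve 12 (λ a b c d e f g h i j k l →
        (((a :+ b) :+ (c :+ d)) :+ ((e :+ f) :+ (g :+ h))) :+ ((i :+ j) :+ (k :+ l))
          := (((k :+ g) :+ c) :+ ((e :+ i) :+ d)) :+ (((a :+ j) :+ h) :+ ((b :+ f) :+ l))) refl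

      -- Among four vertices there are six edges, and each lies in two of the four triangles.
      row : ∀ p q r s t w →
        (((p xor q) xor s) xor ((p xor r) xor t)) xor (((q xor r) xor w) xor ((s xor t) xor w)) ≡ false
      row = solve 6 (λ p q r s t w →
        (((p :+ q) :+ s) :+ ((p :+ r) :+ t)) :+ (((q :+ r) :+ w) :+ ((s :+ t) :+ w)) := con false) refl

      transpose : ∀ a₁ a₂ a₃ a₄ b₁ b₂ b₃ b₄ c₁ c₂ c₃ c₄ d₁ d₂ d₃ d₄ e₁ e₂ e₃ e₄ →
        (((((a₁ xor b₁) xor (c₁ xor d₁)) xor ((a₂ xor b₂) xor (c₂ xor e₁))) xor
         (((a₃ xor b₃) xor (d₂ xor e₂)) xor ((a₄ xor c₃) xor (d₃ xor e₃)))) xor ((b₄ xor c₄) xor (d₄ xor e₄)))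
        ≡ ((((a₁ xor a₂) xor (a₃ xor a₄)) xor ((b₁ xor b₂) xor (b₃ xor b₄))) xor
           (((c₁ xor c₂) xor (c₃ xor c₄)) xor ((d₁ xor d₂) xor (d₃ xor d₄)))) xor ((e₁ xor e₂) xor (e₃ xor e₄))
      transpose = solve 20 (λ a₁ a₂ a₃ a₄ b₁ b₂ b₃ b₄ c₁ c₂ c₃ c₄ d₁ d₂ d₃ d₄ e₁ e₂ e₃ e₄ →
        (((((a₁ :+ b₁) :+ (c₁ :+ d₁)) :+ ((a₂ :+ b₂) :+ (c₂ :+ e₁))) :+
         (((a₃ :+ b₃) :+ (d₂ :+ e₂)) :+ ((a₄ :+ c₃) :+ (d₃ :+ e₃)))) :+ ((b₄ :+ c₄) :+ (d₄ :+ e₄)))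
        := ((((a₁ :+ a₂) :+ (a₃ :+ a₄)) :+ ((b₁ :+ b₂) :+ (b₃ :+ b₄))) :+
           (((c₁ :+ c₂) :+ (c₃ :+ c₄)) :+ ((d₁ :+ d₂) :+ (d₃ :+ d₄)))) :+ ((e₁ :+ e₂) :+ (e₃ :+ e₄))) refl

    -- Of the three ways to split four vertices into two pairs, an odd number
    -- has interleaving pairs.
    quadruple : ∀ {i j k l} → i ≢ j → i ≢ k → i ≢ l → j ≢ k → j ≢ l → k ≢ l →
      (ij : E i j) (ik : E i k) (il : E i l) (jk : E j k) (jl : E j l) (kl : E k l) →
      (around i jk jl kl xor around j ik il kl) xor (around k ij il jl xor around l ij ik jk) ≡ true
    quadruple {i} {j} {k} {l} i≢j i≢k i≢l j≢k j≢l k≢l ij ik il jk jl kl = begin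
      (around i jk jl kl xor around j ik il kl) xor (around k ij il jl xor around l ij ik jk)
        ≡⟨ lhs (a ij k) (a ij l) (a kl i) (a kl j) (a ik j) (a ik l) (a jl i) (a jl k) (a il j) (a il k) (a jk i) (a jk l) ⟨
      _ ≡⟨ cong₂ _xor_ (cong₂ _xor_ (even ij kl i≢k i≢l j≢k j≢l)
                                    (even ik jl i≢j i≢l (≢-sym j≢k) k≢l))
                       (even il jk i≢j i≢k (≢-sym j≢l) (≢-sym k≢l)) ⟩
      _ ≡⟨ cong₂ _xor_ (cong (((h i k xor h i l) xor (h j k xor h j l)) xor_)
                         (cong (λ z → (h i j xor h i l) xor (z xor h k l)) (h-not (≢-sym j≢k))))
                       (cong₂ (λ z w → (h i j xor h i k) xor (z xor w)) (h-not (≢-sym j≢l)) (h-not (≢-sym k≢l))) ⟩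
      _ ≡⟨ rhs (h i k) (h i l) (h j k) (h j l) (h i j) (h k l) ⟩
      true ∎
      where open ≡-Reasoning

    -- Each of the five quadruples contributes 1, an odd total. Collected by the vertex at which the
    -- ray starts, the same terms cancel by `row`.
    noK₅ : ∀ {i j k l m} → i ≢ j → i ≢ k → i ≢ l → i ≢ m → j ≢ k → j ≢ l → j ≢ m → k ≢ l → k ≢ m → l ≢ m →
      E i j → E i k → E i l → E i m → E j k → E j l → E j m → E k l → E k m → E l m → ⊥
    noK₅ {i} {j} {k} {l} {m} i≢j i≢k i≢l i≢m j≢k j≢l j≢m k≢l k≢m l≢m ij ik il im jk jl jm kl km lm = false≢true (begin
      false
        ≡⟨ cong₂ _xor_ (cong₂ _xor_
             (cong₂ _xor_ (row′ i jk jl jm kl km lm) (row′ j ik il im kl km lm))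
             (cong₂ _xor_ (row′ k ij il im jl jm lm) (row′ l ij ik im jk jm km)))
             (row′ m ij ik il jk jl kl) ⟨
      _ ≡⟨ transpose (around i jk jl kl) (around i jk jm km) (around i jl jm lm) (around i kl km lm)
                     (around j ik il kl) (around j ik im km) (around j il im lm) (around j kl km lm)
                     (around k ij il jl) (around k ij im jm) (around k il im lm) (around k jl jm lm)
                     (around l ij ik jk) (around l ij im jm) (around l ik im km) (around l jk jm km)
                     (around m ij ik jk) (around m ij il jl) (around m ik il kl) (around m jk jl kl) ⟨
      _ ≡⟨ cong₂ _xor_ (cong₂ _xor_
             (cong₂ _xor_ (quadruple i≢j i≢k i≢l j≢k j≢l k≢l ij ik il jk jl kl)
                          (quadruple i≢j i≢k i≢m j≢k j≢m k≢m ij ik im jk jm km))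
             (cong₂ _xor_ (quadruple i≢j i≢l i≢m j≢l j≢m l≢m ij il im jl jm lm)
                          (quadruple i≢k i≢l i≢m k≢l k≢m l≢m ik il im kl km lm)))
             (quadruple j≢k j≢l j≢m k≢l k≢m l≢m jk jl jm kl km lm) ⟩
      true ∎)
      where
      open ≡-Reasoning
      false≢true : false ≢ true
      false≢true ()
      row′ : ∀ v {i₁ j₁ i₂ j₂ i₃ j₃ i₄ j₄ i₅ j₅ i₆ j₆} (p : E i₁ j₁) (q : E i₂ j₂) (r : E i₃ j₃)
             (s : E i₄ j₄) (t : E i₅ j₅) (w : E i₆ j₆) → _ ≡ false
      row′ v p q r s t w = row (a p v) (a q v) (a r v) (a s v) (a t v) (a w v)

  module Contraction {V : Set} (E : V → V → Set) (u v : V) where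

    -- A pair can be adjacent in several ways, and a loop at `u` can arise. Since crossings are
    -- attached to the proof of adjacency, parallel edges keep their different courses.
    Contracted : V → V → Set
    Contracted x y = x ≢ v × y ≢ v × (E x y ⊎ (x ≡ u × E v y) ⊎ (y ≡ u × E x v))

    contract : E u v → E v u → u ≢ v → Parity E → Parity Contracted
    contract uv vu u≢v P = record { h = h ; h-not = h-not ; a = crossings ; even = even′ }
      where
      open Parity P

      -- An edge that ended in `v` is prolonged along the contracted edge to `u`.
      crossings : ∀ {x y} → Contracted x y → V → Bool
      crossings (_ , _ , inj₁ e) z = a e z
      crossings (_ , _ , inj₂ (inj₁ (_ , e))) z = a uv z xor a e z
      crossings (_ , _ , inj₂ (inj₂ (_ , e))) z = a e z xor a vu z

      pathˡ : ∀ {p q r x y} (e : E p q) (e′ : E q r) (f : E x y) →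
              p ≢ x → p ≢ y → q ≢ x → q ≢ y → r ≢ x → r ≢ y →
              ((a e x xor a e′ x) xor (a e y xor a e′ y)) xor (a f p xor a f r)
                ≡ (h p x xor h p y) xor (h r x xor h r y)
      pathˡ {p} {q} {r} {x} {y} e e′ f px py qx qy rx ry =
        glueˡ {a e x} {a e y} {a e′ x} {a e′ y} {a f p} {a f q} {a f r}
          {h p x xor h p y} {h q x xor h q y} {h r x xor h r y}
          (even e f px py qx qy) (even e′ f qx qy rx ry)

      pathʳ : ∀ {p q x y z} (f : E p q) (e : E x y) (e′ : E y z) →
              p ≢ x → p ≢ y → p ≢ z → q ≢ x → q ≢ y → q ≢ z →
              (a f x xor a f z) xor ((a e p xor a e′ p) xor (a e q xor a e′ q))
                ≡ (h p x xor h p z) xor (h q x xor h q z)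
      pathʳ {p} {q} {x} {y} {z} f e e′ px py pz qx qy qz =
        glueʳ {a f x} {a f y} {a f z} {a e p} {a e q} {a e′ p} {a e′ q}
          {h p x} {h p y} {h p z} {h q x} {h q y} {h q z}
          (even f e px py qx qy) (even f e′ py pz qy qz)

      even′ : ∀ {p q x y} (e : Contracted p q) (f : Contracted x y) → p ≢ x → p ≢ y → q ≢ x → q ≢ y →
        (crossings e x xor crossings e y) xor (crossings f p xor crossings f q) ≡ (h p x xor h p y) xor (h q x xor h q y)
      even′ (_ , _ , inj₁ e) (_ , _ , inj₁ f) px py qx qy = even e f px py qx qy
      even′ (pv , qv , inj₁ e) (_ , _ , inj₂ (inj₁ (refl , f))) px py qx qy = pathʳ e uv f px pv py qx qv qy
      even′ (pv , qv , inj₁ e) (_ , _ , inj₂ (inj₂ (refl , f))) px py qx qy = pathʳ e f vu px pv py qx qv qy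
      even′ (_ , _ , inj₂ (inj₁ (refl , e))) (xv , yv , inj₁ f) px py qx qy =
        pathˡ uv e f px py (≢-sym xv) (≢-sym yv) qx qy
      even′ (_ , _ , inj₂ (inj₂ (refl , e))) (xv , yv , inj₁ f) px py qx qy =
        pathˡ e vu f px py (≢-sym xv) (≢-sym yv) qx qy
      -- Two prolonged edges share the end `u`, so they are not independent.
      even′ (_ , _ , inj₂ (inj₁ (p , _))) (_ , _ , inj₂ (inj₁ (q , _))) px py qx qy = ⊥-elim (px (trans p (sym q)))
      even′ (_ , _ , inj₂ (inj₁ (p , _))) (_ , _ , inj₂ (inj₂ (q , _))) px py qx qy = ⊥-elim (py (trans p (sym q)))
      even′ (_ , _ , inj₂ (inj₂ (p , _))) (_ , _ , inj₂ (inj₁ (q , _))) px py qx qy = ⊥-elim (qx (trans p (sym q)))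
      even′ (_ , _ , inj₂ (inj₂ (p , _))) (_ , _ , inj₂ (inj₂ (q , _))) px py qx qy = ⊥-elim (qy (trans p (sym q)))

-- Counting in lists without repetitions

module ListCounting where

  open import Data.Empty using (⊥; ⊥-elim)
  open import Data.List using (List; []; _∷_; [_]; _++_; length; filter)
  open import Data.List.Membership.Propositional using (_∈_; _∉_)
  open import Data.List.Membership.Propositional.Properties using (∈-∃++; ∈-++⁺ˡ; ∈-++⁺ʳ; ∈-++⁻; ∈-filter⁻)
  open import Data.List.Properties using (length-++)
  open import Data.List.Relation.Unary.All as All using (All; []; _∷_)
  open import Data.List.Relation.Unary.Any using (here; there)
  open import Data.List.Relation.Unary.AllPairs using ([]; _∷_)
  open import Data.List.Relation.Unary.Unique.Propositional using (Unique)
  open import Data.List.Relation.Unary.Unique.Propositional.Properties using (++⁺; filter⁺)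
  open import Data.Nat using (suc; _+_; _≤_; z≤n; s≤s)
  open import Data.Nat.Properties using (≤-trans; ≤-reflexive; +-suc; m≤n⇒m≤1+n)
  open import Data.Product using (_×_; _,_; proj₁; proj₂)
  open import Data.Sum using (inj₁; inj₂; [_,_]′)
  open import Relation.Binary.PropositionalEquality hiding ([_])
  open import Relation.Nullary using (¬_; yes; no)
  open import Relation.Unary using (Pred; Decidable)
  open import Level using (0ℓ)

  module _ {A : Set} where

    length-⊆ : ∀ {xs ys : List A} → Unique xs → (∀ {z} → z ∈ xs → z ∈ ys) → length xs ≤ length ys
    length-⊆ [] sub = z≤n
    length-⊆ {x ∷ xs} (x∉xs ∷ uniq) sub with ∈-∃++ (sub (here refl))
    ... | as , bs , refl = ≤-trans (s≤s (length-⊆ {ys = as ++ bs} uniq sub′)) (≤-reflexive lengths)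
      where
      sub′ : ∀ {z} → z ∈ xs → z ∈ as ++ bs
      sub′ {z} z∈ with ∈-++⁻ as (sub (there z∈))
      ... | inj₁ p = ∈-++⁺ˡ p
      ... | inj₂ (here p) = ⊥-elim (All.lookup x∉xs z∈ (sym p))
      ... | inj₂ (there p) = ∈-++⁺ʳ as p
      lengths : suc (length (as ++ bs)) ≡ length (as ++ x ∷ bs)
      lengths = trans (cong suc (length-++ as)) (trans (sym (+-suc (length as) (length bs))) (sym (length-++ as)))

    module _ {P Q : Pred A 0ℓ} (P? : Decidable P) (Q? : Decidable Q) where

      length-filters : (∀ {x} → P x → ¬ Q x) → ∀ xs → length (filter P? xs) + length (filter Q? xs) ≤ length xs
      length-filters disj [] = z≤n
      length-filters disj (x ∷ xs) with P? x | Q? x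
      ... | yes p | yes q = ⊥-elim (disj p q)
      ... | yes p | no _ = s≤s (length-filters disj xs)
      ... | no _ | yes q = ≤-trans (≤-reflexive (+-suc _ _)) (s≤s (length-filters disj xs))
      ... | no _ | no _ = m≤n⇒m≤1+n (length-filters disj xs)

    length-filter-∉ : ∀ {P : Pred A 0ℓ} (P? : Decidable P) {xs ys} → Unique xs → Unique ys →
      (∀ {y} → y ∈ ys → y ∈ xs × ¬ P y) → length (filter P? xs) + length ys ≤ length xs
    length-filter-∉ P? {xs} {ys} uxs uys out = ≤-trans (≤-reflexive (sym (length-++ (filter P? xs))))
      (length-⊆ (++⁺ (filter⁺ P? uxs) uys λ (p , q) → proj₂ (out q) (proj₂ (∈-filter⁻ P? {xs = xs} p))) sub)
      where
      sub : ∀ {z} → z ∈ filter P? xs ++ ys → z ∈ xs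
      sub p = [ (λ q → proj₁ (∈-filter⁻ P? q)) , (λ q → proj₁ (out q)) ]′ (∈-++⁻ (filter P? xs) p)

-- Orientations with out-degree at most 3 and their lifting

module Orientations where

  open Contractions using (module Contraction)
  open ListCounting
  open import Data.Empty using (⊥; ⊥-elim)
  open import Data.List using (List; []; _∷_; length; filter; map)
  open import Data.List.Membership.Propositional using (_∈_)
  import Data.List.Membership.DecPropositional as DecMembership
  open import Data.List.Membership.Propositional.Properties
    using (∈-filter⁻; ∈-filter⁺; ∈-map⁺)
  open import Data.List.Properties using (length-map; length-filter)
  open import Data.List.Relation.Unary.Any using (here; there)
  open import Data.Nat using (suc; _+_; _≤_; s≤s)
  open import Data.Nat.Properties using (≤-trans; ≤-reflexive; m≤m+n; +-comm; +-monoˡ-≤; +-cancelˡ-≤; _≤?_; ≰⇒>)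
  open import Data.Product using (Σ; _×_; _,_; proj₁; proj₂)
  open import Data.Sum using (_⊎_; inj₁; inj₂; swap)
  open import Relation.Binary using (Decidable; DecidableEquality; Symmetric)
  open import Relation.Binary.PropositionalEquality
  open import Relation.Nullary using (¬_; Dec; yes; no)
  open import Relation.Nullary.Decidable using (¬?; _×-dec_)

  module _ {V : Set} (_≟_ : DecidableEquality V) where

    open DecMembership _≟_ using (_∈?_)

    -- `cover` asks for different ends because contraction leaves loops. The two places that the
    -- root saves pay for the edge that is put back in the count of degrees.
    record Orientation (E : V → V → Set) (vs : List V) : Set where
      field
        out   : V → List V
        out≤3 : ∀ v → length (out v) ≤ 3
        cover : ∀ {x y} → x ∈ vs → y ∈ vs → x ≢ y → E x y → y ∈ out x ⊎ x ∈ out y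
        root  : V
        root∈ : root ∈ vs
        root≤1 : length (out root) ≤ 1

    without : V → List V → List V
    without v = filter (λ w → ¬? (w ≟ v))

    without-∈ : ∀ {v w vs} → w ∈ vs → w ≢ v → w ∈ without v vs
    without-∈ {v} = ∈-filter⁺ (λ w → ¬? (w ≟ v))

    ∈-without : ∀ {v w} vs → w ∈ without v vs → w ∈ vs × w ≢ v
    ∈-without {v} vs = ∈-filter⁻ (λ w → ¬? (w ≟ v)) {xs = vs}

    -- How the edges at the vertex that arises from merging v into u are
    -- distributed among u and v, given its list L of out-neighbours and the list
    -- C of common neighbours of u and v.
    record Split (Eu Ev : V → Set) (u v : V) (C L : List V) : Set where
      field
        outᵘ outᵛ : List V
        keepᵘ  : ∀ {w} → w ∈ L → Eu w → (Ev w → w ∈ C) → w ∈ outᵘ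
        keepᵛ  : ∀ {w} → w ∈ L → Ev w → (Eu w → w ∈ C) → w ∈ outᵛ
        common : ∀ {w} → w ∈ C → w ∈ outᵘ ⊎ w ∈ outᵛ
        edge   : v ∈ outᵘ ⊎ u ∈ outᵛ
        lengthᵘ : length outᵘ ≤ 3
        lengthᵛ : length outᵛ ≤ 3

    module _ {Eu Ev : V → Set} (Eu? : ∀ w → Dec (Eu w)) (Ev? : ∀ w → Dec (Ev w)) {u v : V} {C L : List V}
             (C≤2 : length C ≤ 2) (L≤3 : length L ≤ 3) where

      private
        onlyᵛ : List V
        onlyᵛ = filter (λ w → ¬? (Eu? w) ×-dec Ev? w) L

        partition : length (filter Eu? L) + length onlyᵛ ≤ length L
        partition = length-filters Eu? (λ w → ¬? (Eu? w) ×-dec Ev? w) (λ p q → proj₁ q p) L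

        -- `u` keeps its share of `L`, and `v` gets the common neighbours, at most two, and its
        -- private element of `L`, at most one. If there is no private element, the third place at
        -- `v` takes the edge to `u`. If there is one, it frees a place at `u` for the edge to `v`.
        -- Either way the list of `u` is no longer than `L`, which preserves a root.
        split-aux : ∀ R → R ≡ onlyᵛ → length R ≤ 1 →
          Σ (Split Eu Ev u v C L) λ s → length L ≤ 1 → length (Split.outᵘ s) ≤ 1
        split-aux [] e _ = record
          { outᵘ = filter Eu? L
          ; outᵛ = u ∷ C
          ; keepᵘ = λ w∈L eu _ → ∈-filter⁺ Eu? w∈L eu
          ; keepᵛ = λ {w} w∈L ev c → there (keep w∈L ev c (Eu? w))
          ; common = λ w∈C → inj₂ (there w∈C)
          ; edge = inj₂ (here refl)
          ; lengthᵘ = ≤-trans lenᵘ L≤3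
          ; lengthᵛ = s≤s C≤2
          } , ≤-trans lenᵘ
          where
          lenᵘ : length (filter Eu? L) ≤ length L
          lenᵘ = ≤-trans (m≤m+n _ _) partition
          keep : ∀ {w} → w ∈ L → Ev w → (Eu w → w ∈ C) → Dec (Eu w) → w ∈ C
          keep w∈L ev c (yes eu) = c eu
          keep w∈L ev c (no ¬eu) with subst (_ ∈_) (sym e) (∈-filter⁺ (λ w → ¬? (Eu? w) ×-dec Ev? w) w∈L (¬eu , ev))
          ... | ()
        split-aux (r ∷ []) e _ = record
          { outᵘ = v ∷ filter Eu? L
          ; outᵛ = r ∷ C
          ; keepᵘ = λ w∈L eu _ → there (∈-filter⁺ Eu? w∈L eu)
          ; keepᵛ = λ {w} w∈L ev c → keep w∈L ev c (Eu? w)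
          ; common = λ w∈C → inj₂ (there w∈C)
          ; edge = inj₁ (here refl)
          ; lengthᵘ = ≤-trans lenᵘ L≤3
          ; lengthᵛ = s≤s C≤2
          } , ≤-trans lenᵘ
          where
          lenᵘ : suc (length (filter Eu? L)) ≤ length L
          lenᵘ = ≤-trans (≤-reflexive (trans (+-comm 1 _) (cong (λ R → length (filter Eu? L) + length R) e))) partition
          keep : ∀ {w} → w ∈ L → Ev w → (Eu w → w ∈ C) → Dec (Eu w) → w ∈ r ∷ C
          keep w∈L ev c (yes eu) = there (c eu)
          keep w∈L ev c (no ¬eu) with subst (_ ∈_) (sym e) (∈-filter⁺ (λ w → ¬? (Eu? w) ×-dec Ev? w) w∈L (¬eu , ev))
          ... | here p = here p
        split-aux (_ ∷ _ ∷ _) _ (s≤s ())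

      half-split : length onlyᵛ ≤ 1 → Σ (Split Eu Ev u v C L) λ s → length L ≤ 1 → length (Split.outᵘ s) ≤ 1
      half-split = split-aux onlyᵛ refl

    Split-swap : ∀ {Eu Ev u v C L} → Split Eu Ev u v C L → Split Ev Eu v u C L
    Split-swap s = record
      { outᵘ = outᵛ ; outᵛ = outᵘ
      ; keepᵘ = keepᵛ ; keepᵛ = keepᵘ
      ; common = λ w∈C → swap (common w∈C) ; edge = swap edge
      ; lengthᵘ = lengthᵛ ; lengthᵛ = lengthᵘ }
      where open Split s

    -- Of the at most three elements of `L`, at most one is private to `v` or at most one is private
    -- to `u`. The first case is preferred: it covers every `L` with at most one element and leaves
    -- the root at `u`.
    split : ∀ {Eu Ev : V → Set} (Eu? : ∀ w → Dec (Eu w)) (Ev? : ∀ w → Dec (Ev w)) {u v C L} →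
      length C ≤ 2 → length L ≤ 3 → Σ (Split Eu Ev u v C L) λ s → length L ≤ 1 → length (Split.outᵘ s) ≤ 1
    split {Eu} {Ev} Eu? Ev? {u} {v} {C} {L} C≤2 L≤3 with length (filter (λ w → ¬? (Eu? w) ×-dec Ev? w) L) ≤? 1
    ... | yes p = half-split Eu? Ev? C≤2 L≤3 p
    ... | no p = Split-swap (proj₁ (half-split Ev? Eu? C≤2 L≤3 few)) , λ L≤1 → ⊥-elim (p (≤-trans (length-filter _ L) L≤1))
      where
      both : length (filter (λ w → ¬? (Eu? w) ×-dec Ev? w) L) + length (filter (λ w → ¬? (Ev? w) ×-dec Eu? w) L) ≤ 3
      both = ≤-trans (length-filters (λ w → ¬? (Eu? w) ×-dec Ev? w) (λ w → ¬? (Ev? w) ×-dec Eu? w)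
                        (λ p q → proj₁ p (proj₂ q)) L) L≤3
      few : length (filter (λ w → ¬? (Ev? w) ×-dec Eu? w) L) ≤ 1
      few = +-cancelˡ-≤ 2 _ _ (≤-trans (+-monoˡ-≤ _ (≰⇒> p)) both)

    module _ {E : V → V → Set} (E? : Decidable E) (E-sym : Symmetric E) where

      neighbours-in : List V → V → List V
      neighbours-in vs v = filter (λ w → ¬? (v ≟ w) ×-dec E? v w) vs

      common-in : List V → V → V → List V
      common-in vs u v = filter (λ w → (¬? (u ≟ w) ×-dec ¬? (v ≟ w)) ×-dec (E? u w ×-dec E? v w)) vs

      -- All edges at `v` are directed away from it. No other list grows, so the root survives.
      remove-vertex : ∀ {v vs} → v ∈ vs → length (neighbours-in vs v) ≤ 3 →
                      Orientation E (without v vs) → Orientation E vs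
      remove-vertex {v} {vs} v∈ deg O = record
        { out = λ x → out′ x (x ≟ v)
        ; out≤3 = λ x → out′≤3 x (x ≟ v)
        ; cover = λ {x} {y} x∈ y∈ ne e → cover′ x∈ y∈ ne e (x ≟ v) (y ≟ v)
        ; root = root
        ; root∈ = proj₁ (∈-without vs root∈)
        ; root≤1 = root′≤1 (root ≟ v)
        }
        where
        open Orientation O
        out′ : ∀ x → Dec (x ≡ v) → List V
        out′ x (yes _) = neighbours-in vs v
        out′ x (no _) = out x
        out′≤3 : ∀ x d → length (out′ x d) ≤ 3
        out′≤3 x (yes _) = deg
        out′≤3 x (no _) = out≤3 x
        cover′ : ∀ {x y} → x ∈ vs → y ∈ vs → x ≢ y → E x y → ∀ d d′ → y ∈ out′ x d ⊎ x ∈ out′ y d′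
        cover′ x∈ y∈ ne e (yes refl) _ = inj₁ (∈-filter⁺ (λ w → ¬? (v ≟ w) ×-dec E? v w) y∈ (ne , e))
        cover′ x∈ y∈ ne e (no _) (yes refl) =
          inj₂ (∈-filter⁺ (λ w → ¬? (v ≟ w) ×-dec E? v w) x∈ (≢-sym ne , E-sym e))
        cover′ x∈ y∈ ne e (no p) (no q) = cover (without-∈ x∈ p) (without-∈ y∈ q) ne e
        root′≤1 : ∀ d → length (out′ root d) ≤ 1
        root′≤1 (yes p) = ⊥-elim (proj₂ (∈-without vs root∈) p)
        root′≤1 (no _) = root≤1

      module _ {u v : V} {vs : List V} (u∈ : u ∈ vs) (v∈ : v ∈ vs) (u≢v : u ≢ v) (uv : E u v)
               (few : length (common-in vs u v) ≤ 2)
               (O : Orientation (Contraction.Contracted E u v) (without v vs)) where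
        private
          open Orientation O
          C L : List V
          C = common-in vs u v
          L = out u

          s-root : Σ (Split (E u) (E v) u v C L) λ s → length L ≤ 1 → length (Split.outᵘ s) ≤ 1
          s-root = split (E? u) (E? v) few (out≤3 u)

          s : Split (E u) (E v) u v C L
          s = proj₁ s-root
          open Split s hiding (common)

          common : ∀ {w} → w ∈ vs → w ≢ u → w ≢ v → E u w → E v w → w ∈ C
          common w∈ wu wv eu ev = ∈-filter⁺ (λ w → (¬? (u ≟ w) ×-dec ¬? (v ≟ w)) ×-dec (E? u w ×-dec E? v w))
            w∈ ((≢-sym wu , ≢-sym wv) , (eu , ev))

          -- The one of u and v to which an edge from x to the merged vertex is
          -- directed. An edge that it stands for besides is directed to x.
          end-aux : ∀ x → Dec (E x u) → Dec (x ∈ outᵘ) → V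
          end-aux x (yes _) (no _) = u
          end-aux x _ _ = v

          end : V → V
          end x = end-aux x (E? x u) (x ∈? outᵘ)

          redirect-aux : ∀ x w → Dec (w ≡ u) → V
          redirect-aux x w (yes _) = end x
          redirect-aux x w (no _) = w

          redirect : V → V → V
          redirect x w = redirect-aux x w (w ≟ u)

          outs-aux : ∀ x → Dec (x ≡ u) → Dec (x ≡ v) → List V
          outs-aux x (yes _) _ = outᵘ
          outs-aux x (no _) (yes _) = outᵛ
          outs-aux x (no _) (no _) = map (redirect x) (out x)

          outs : V → List V
          outs x = outs-aux x (x ≟ u) (x ≟ v)

          outs-u : outs u ≡ outᵘ
          outs-u with u ≟ u
          ... | yes _ = refl
          ... | no p = ⊥-elim (p refl)

          outs-v : outs v ≡ outᵛ
          outs-v with v ≟ u | v ≟ v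
          ... | yes p | _ = ⊥-elim (u≢v (sym p))
          ... | no _ | yes _ = refl
          ... | no _ | no p = ⊥-elim (p refl)

          outs-other : ∀ {x} → x ≢ u → x ≢ v → outs x ≡ map (redirect x) (out x)
          outs-other {x} xu xv with x ≟ u | x ≟ v
          ... | yes p | _ = ⊥-elim (xu p)
          ... | no _ | yes p = ⊥-elim (xv p)
          ... | no _ | no _ = refl

          outs≤3 : ∀ x → length (outs x) ≤ 3
          outs≤3 x with x ≟ u | x ≟ v
          ... | yes _ | _ = lengthᵘ
          ... | no _ | yes _ = lengthᵛ
          ... | no _ | no _ = ≤-trans (≤-reflexive (length-map (redirect x) (out x))) (out≤3 x)

          redirect-u : ∀ x → redirect x u ≡ end x
          redirect-u x with u ≟ u
          ... | yes _ = refl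
          ... | no p = ⊥-elim (p refl)

          redirect-other : ∀ x {w} → w ≢ u → redirect x w ≡ w
          redirect-other x {w} wu with w ≟ u
          ... | yes p = ⊥-elim (wu p)
          ... | no _ = refl

          end∈ : ∀ {x} → x ≢ u → x ≢ v → u ∈ out x → end x ∈ outs x
          end∈ {x} xu xv u∈out = subst (end x ∈_) (sym (outs-other xu xv))
            (subst (_∈ map (redirect x) (out x)) (redirect-u x) (∈-map⁺ (redirect x) u∈out))

          kept : ∀ {x y} → x ≢ u → x ≢ v → y ≢ u → y ∈ out x → y ∈ outs x
          kept {x} {y} xu xv yu p = subst (y ∈_) (sym (outs-other xu xv))
            (subst (_∈ map (redirect x) (out x)) (redirect-other x yu) (∈-map⁺ (redirect x) p))

          covers : V → V → Set
          covers x y = y ∈ outs x ⊎ x ∈ outs y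

          inᵘ : ∀ {w} → w ∈ outᵘ → w ∈ outs u
          inᵘ = subst (_ ∈_) (sym outs-u)

          inᵛ : ∀ {w} → w ∈ outᵛ → w ∈ outs v
          inᵛ = subst (_ ∈_) (sym outs-v)

          cover-uv : covers u v
          cover-uv with edge
          ... | inj₁ p = inj₁ (inᵘ p)
          ... | inj₂ p = inj₂ (inᵛ p)

          cover-u : ∀ {w} → w ∈ vs → w ≢ u → w ≢ v → E u w → covers u w
          cover-u {w} w∈ wu wv e with cover (without-∈ u∈ u≢v) (without-∈ w∈ wv) (≢-sym wu) (u≢v , wv , inj₁ e)
          ... | inj₁ p = inj₁ (inᵘ (keepᵘ p e λ ev → common w∈ wu wv e ev))
          ... | inj₂ p = aux (E? w u) (w ∈? outᵘ) (end∈ wu wv p)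
            where
            aux : ∀ d d′ → end-aux w d d′ ∈ outs w → covers u w
            aux (yes _) (no _) q = inj₂ q
            aux _ (yes q) _ = inj₁ (inᵘ q)
            aux (no q) _ _ = ⊥-elim (q (E-sym e))

          cover-v : ∀ {w} → w ∈ vs → w ≢ u → w ≢ v → E v w → covers v w
          cover-v {w} w∈ wu wv e with cover (without-∈ u∈ u≢v) (without-∈ w∈ wv) (≢-sym wu) (u≢v , wv , inj₂ (inj₁ (refl , e)))
          ... | inj₁ p = inj₁ (inᵛ (keepᵛ p e λ eu → common w∈ wu wv eu e))
          ... | inj₂ p = aux (E? w u) (w ∈? outᵘ) (end∈ wu wv p)
            where
            aux : ∀ d d′ → end-aux w d d′ ∈ outs w → covers v w
            aux (yes _) (yes _) q = inj₂ q
            aux (no _) _ q = inj₂ q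
            -- Here `w` has spent its edge on `u`. Being a common neighbour outside `outᵘ`, it must
            -- be in `outᵛ`.
            aux (yes eu) (no q) _ with Split.common s (common w∈ wu wv (E-sym eu) e)
            ... | inj₁ r = ⊥-elim (q r)
            ... | inj₂ r = inj₁ (inᵛ r)

          cover-other : ∀ {x y} → x ∈ vs → y ∈ vs → x ≢ y → x ≢ u → x ≢ v → y ≢ u → y ≢ v → E x y → covers x y
          cover-other x∈ y∈ ne xu xv yu yv e with cover (without-∈ x∈ xv) (without-∈ y∈ yv) ne (xv , yv , inj₁ e)
          ... | inj₁ p = inj₁ (kept xu xv yu p)
          ... | inj₂ p = inj₂ (kept yu yv xu p)

          cover′ : ∀ {x y} → x ∈ vs → y ∈ vs → x ≢ y → E x y → Dec (x ≡ u) → Dec (x ≡ v) → Dec (y ≡ u) → Dec (y ≡ v) →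
                   covers x y
          cover′ x∈ y∈ ne e (yes refl) _ _ (yes refl) = cover-uv
          cover′ x∈ y∈ ne e _ (yes refl) (yes refl) _ = swap cover-uv
          cover′ x∈ y∈ ne e (yes refl) _ _ (no yv) = cover-u y∈ (≢-sym ne) yv e
          cover′ x∈ y∈ ne e (no xu) (yes refl) (no yu) _ = cover-v y∈ yu (≢-sym ne) e
          cover′ x∈ y∈ ne e (no xu) (no xv) (yes refl) _ = swap (cover-u x∈ xu xv (E-sym e))
          cover′ x∈ y∈ ne e (no xu) (no xv) (no yu) (yes refl) = swap (cover-v x∈ xu xv (E-sym e))
          cover′ x∈ y∈ ne e (no xu) (no xv) (no yu) (no yv) = cover-other x∈ y∈ ne xu xv yu yv e

          root′≤1 : Dec (root ≡ u) → length (outs root) ≤ 1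
          root′≤1 (yes refl) = subst (λ l → length l ≤ 1) (sym outs-u)
            (proj₂ s-root root≤1)
          root′≤1 (no p) = subst (λ l → length l ≤ 1) (sym (outs-other p (proj₂ (∈-without vs root∈))))
            (≤-trans (≤-reflexive (length-map (redirect root) (out root))) root≤1)

        uncontract : Orientation E vs
        uncontract = record
          { out = outs
          ; out≤3 = outs≤3
          ; cover = λ {x} {y} x∈ y∈ ne e → cover′ x∈ y∈ ne e (x ≟ u) (x ≟ v) (y ≟ u) (y ≟ v)
          ; root = root
          ; root∈ = proj₁ (∈-without vs root∈)
          ; root≤1 = root′≤1 (root ≟ u)
          }

-- Degree sums, and vertices of degree 4 or 5 in many triangles

module DenseVertices where

  open ArcParity using (Parity)
  open Contractions
  open ListCounting
  open Orientations
  open import Data.Empty using (⊥; ⊥-elim)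
  open import Data.List using (List; []; _∷_; [_]; length; filter; map)
  open import Data.List.Membership.Propositional using (_∈_; _∉_; find; lose)
  import Data.List.Membership.DecPropositional as DecMembership
  open import Data.List.Membership.Propositional.Properties using (∈-filter⁻; ∈-filter⁺)
  open import Data.List.Relation.Unary.All as All using (All; []; _∷_)
  open import Data.List.Relation.Unary.AllPairs using ([]; _∷_)
  open import Data.List.Relation.Unary.Any using (Any; here; there; any?)
  open import Data.List.Relation.Unary.Unique.Propositional using (Unique)
  open import Data.List.Relation.Unary.Unique.Propositional.Properties using (filter⁺)
  open import Data.Nat using (ℕ; suc; _+_; _*_; _≤_; _<_; z≤n; s≤s)
  open import Data.Nat.ListAction using (sum)
  open import Data.Nat.Properties hiding (_≟_)
  open import Data.Product using (_×_; _,_; proj₁; proj₂)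
  open import Data.Sum using (_⊎_; inj₁; inj₂; [_,_]′)
  open import Function using (_∘_)
  open import Level using (0ℓ)
  open import Relation.Binary using (Decidable; DecidableEquality; Symmetric)
  open import Relation.Binary.PropositionalEquality hiding ([_])
  open import Relation.Nullary using (¬_; Dec; yes; no)
  open import Relation.Nullary.Decidable using (¬?; _×-dec_; decidable-stable)
  import Relation.Unary as U

  module _ {A : Set} where

    Σ[_] : List A → (A → ℕ) → ℕ
    Σ[ xs ] f = sum (map f xs)

    Σ-mono : ∀ {f g : A → ℕ} xs → (∀ {x} → x ∈ xs → f x ≤ g x) → Σ[ xs ] f ≤ Σ[ xs ] g
    Σ-mono [] le = z≤n
    Σ-mono (x ∷ xs) le = +-mono-≤ (le (here refl)) (Σ-mono xs (le ∘ there))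

    Σ-+ : ∀ (f g : A → ℕ) xs → Σ[ xs ] (λ x → f x + g x) ≡ Σ[ xs ] f + Σ[ xs ] g
    Σ-+ f g [] = refl
    Σ-+ f g (x ∷ xs) = trans (cong ((f x + g x) +_) (Σ-+ f g xs)) (+-interchange (f x) (g x) _ _)
      where open import Algebra.Properties.CommutativeSemigroup +-commutativeSemigroup renaming (interchange to +-interchange)

    Σ-const : ∀ k xs → Σ[ xs ] (λ _ → k) ≡ length xs * k
    Σ-const k [] = refl
    Σ-const k (x ∷ xs) = cong (k +_) (Σ-const k xs)

    Σ-bump : ∀ {f g : A → ℕ} (_≟_ : DecidableEquality A) p {xs} → Unique xs →
      (∀ {x} → x ≢ p → f x ≤ g x) → f p ≤ suc (g p) → Σ[ xs ] f ≤ suc (Σ[ xs ] g)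
    Σ-bump _≟_ p [] le lep = z≤n
    Σ-bump {f} {g} _≟_ p {x ∷ xs} (x∉ ∷ u) le lep with x ≟ p
    ... | yes refl = +-mono-≤ lep (Σ-mono xs λ y∈ → le (≢-sym (All.lookup x∉ y∈)))
    ... | no ne = ≤-trans (+-mono-≤ (le ne) (Σ-bump _≟_ p u le lep)) (≤-reflexive (+-suc (g x) _))

    Σ-slack : ∀ {f : A → ℕ} {r xs} → r ∈ xs → (∀ x → f x ≤ 3) → f r ≤ 1 → 2 + Σ[ xs ] f ≤ length xs * 3
    Σ-slack {f} {xs = x ∷ xs} (here refl) le le1 = +-mono-≤ {2 + f x} {3} (s≤s (s≤s le1))
      (≤-trans (Σ-mono xs (λ {y} _ → le y)) (≤-reflexive (Σ-const 3 xs)))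
    Σ-slack {f} {xs = x ∷ xs} (there r∈) le le1 = ≤-trans
      (≤-reflexive (trans (sym (+-assoc 2 (f x) _)) (trans (cong (_+ Σ[ xs ] f) (+-comm 2 (f x))) (+-assoc (f x) 2 _))))
      (+-mono-≤ (le x) (Σ-slack r∈ le le1))

    count : {P : U.Pred A 0ℓ} → U.Decidable P → List A → ℕ
    count P? xs = length (filter P? xs)

    count-⊎ : ∀ {P Q R : U.Pred A 0ℓ} (P? : U.Decidable P) (Q? : U.Decidable Q) (R? : U.Decidable R) xs →
      (∀ {x} → x ∈ xs → P x → Q x ⊎ R x) → count P? xs ≤ count Q? xs + count R? xs
    count-⊎ P? Q? R? [] f = z≤n
    count-⊎ P? Q? R? (x ∷ xs) f with count-⊎ P? Q? R? xs (f ∘ there) | P? x | Q? x | R? x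
    ... | le | no _  | no _  | no _ = le
    ... | le | no _  | no _  | yes _ = ≤-trans le (+-monoʳ-≤ _ (n≤1+n _))
    ... | le | no _  | yes _ | no _ = m≤n⇒m≤1+n le
    ... | le | no _  | yes _ | yes _ = m≤n⇒m≤1+n (≤-trans le (+-monoʳ-≤ _ (n≤1+n _)))
    ... | le | yes p | no q  | no r = ⊥-elim ([ q , r ]′ (f (here refl) p))
    ... | le | yes _ | no _  | yes _ = ≤-trans (s≤s le) (≤-reflexive (sym (+-suc _ _)))
    ... | le | yes _ | yes _ | no _ = s≤s le
    ... | le | yes _ | yes _ | yes _ = s≤s (≤-trans le (+-monoʳ-≤ _ (n≤1+n _)))

    count-< : ∀ {P Q : U.Pred A 0ℓ} (P? : U.Decidable P) (Q? : U.Decidable Q) {xs z} →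
      (∀ {x} → P x → Q x) → z ∈ xs → Q z → ¬ P z → count P? xs < count Q? xs
    count-< P? Q? {x ∷ xs} sub (here refl) q ¬p with P? x | Q? x
    ... | yes p | _ = ⊥-elim (¬p p)
    ... | no _ | no ¬q = ⊥-elim (¬q q)
    ... | no _ | yes _ = s≤s (count-≤ xs)
      where
      count-≤ : ∀ ys → count P? ys ≤ count Q? ys
      count-≤ [] = z≤n
      count-≤ (y ∷ ys) with P? y | Q? y
      ... | yes p | no ¬q = ⊥-elim (¬q (sub p))
      ... | yes _ | yes _ = s≤s (count-≤ ys)
      ... | no _ | yes _ = m≤n⇒m≤1+n (count-≤ ys)
      ... | no _ | no _ = count-≤ ys
    count-< P? Q? {x ∷ xs} sub (there z∈) q ¬p with P? x | Q? x
    ... | yes p | no ¬q = ⊥-elim (¬q (sub p))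
    ... | yes _ | yes _ = s≤s (count-< P? Q? sub z∈ q ¬p)
    ... | no _ | yes _ = m≤n⇒m≤1+n (count-< P? Q? sub z∈ q ¬p)
    ... | no _ | no _ = count-< P? Q? sub z∈ q ¬p

    Σ-count-swap : ∀ {R : A → A → Set} (R? : Decidable R) xs ys →
      Σ[ xs ] (λ x → count (R? x) ys) ≡ Σ[ ys ] (λ y → count (λ x → R? x y) xs)
    Σ-count-swap R? [] ys = sym (trans (Σ-const 0 ys) (*-zeroʳ (length ys)))
    Σ-count-swap R? (x ∷ xs) ys = trans (cong (count (R? x) ys +_) (Σ-count-swap R? xs ys)) (step ys)
      where
      swap-+ : ∀ a b c → a + (b + c) ≡ b + (a + c)
      swap-+ a b c = trans (sym (+-assoc a b c)) (trans (cong (_+ c) (+-comm a b)) (+-assoc b a c))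
      step : ∀ ys → count (R? x) ys + Σ[ ys ] (λ y → count (λ x → R? x y) xs) ≡ Σ[ ys ] (λ y → count (λ x → R? x y) (x ∷ xs))
      step [] = refl
      step (y ∷ ys) with R? x y
      ... | yes _ = cong suc (trans (swap-+ (count (R? x) ys) (count (λ x → R? x y) xs) _) (cong (count (λ x → R? x y) xs +_) (step ys)))
      ... | no _ = trans (swap-+ (count (R? x) ys) (count (λ x → R? x y) xs) _) (cong (count (λ x → R? x y) xs +_) (step ys))

  module _ {V : Set} (_≟_ : DecidableEquality V) {E : V → V → Set} (E? : Decidable E) where

    open DecMembership _≟_ using (_∈?_)

    -- Every neighbour is an out-neighbour or an in-neighbour, and exchanging the order of summation
    -- shows that both kinds have the same total.
    degree-sum : ∀ {vs} → Unique vs → (out : V → List V) →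
      (∀ {x y} → x ∈ vs → y ∈ vs → x ≢ y → E x y → y ∈ out x ⊎ x ∈ out y) → (E-sym : Symmetric E) →
      Σ[ vs ] (λ v → length (neighbours-in _≟_ E? E-sym vs v)) ≤ Σ[ vs ] (length ∘ out) + Σ[ vs ] (length ∘ out)
    degree-sum {vs} u out cover E-sym = begin
      Σ[ vs ] (λ v → count (λ w → ¬? (v ≟ w) ×-dec E? v w) vs)
        ≤⟨ Σ-mono vs (λ {v} v∈ → count-⊎ (λ w → ¬? (v ≟ w) ×-dec E? v w) (_∈? out v) (λ w → v ∈? out w) vs
             (λ w∈ (ne , e) → cover v∈ w∈ ne e)) ⟩
      Σ[ vs ] (λ v → count (_∈? out v) vs + count (λ w → v ∈? out w) vs)
        ≡⟨ Σ-+ _ _ vs ⟩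
      Σ[ vs ] (λ v → count (_∈? out v) vs) + Σ[ vs ] (λ v → count (λ w → v ∈? out w) vs)
        ≡⟨ cong (Σ[ vs ] (λ v → count (_∈? out v) vs) +_) (Σ-count-swap (λ v w → v ∈? out w) vs vs) ⟩
      Σ[ vs ] (λ v → count (_∈? out v) vs) + Σ[ vs ] (λ v → count (_∈? out v) vs)
        ≤⟨ +-mono-≤ bound bound ⟩
      Σ[ vs ] (length ∘ out) + Σ[ vs ] (length ∘ out) ∎
      where
      open ≤-Reasoning
      bound : Σ[ vs ] (λ v → count (_∈? out v) vs) ≤ Σ[ vs ] (length ∘ out)
      bound = Σ-mono vs λ {v} _ → length-⊆ (filter⁺ (_∈? out v) u) (λ p → proj₂ (∈-filter⁻ (_∈? out v) {xs = vs} p))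

    module _ (E-sym : Symmetric E) where
      private
        nbrs : List V → V → List V
        nbrs = neighbours-in _≟_ E? E-sym

      -- A vertex of degree 4 or 5 with every incident edge in three triangles
      -- gives a K₅, after at most one contraction: among its neighbours each
      -- one is non-adjacent to at most one other.
      module _ (P : Parity E) {vs : List V} (u : Unique vs) {v : V} (v∈ : v ∈ vs)
               (triangles : ∀ {w} → w ∈ vs → v ≢ w → E v w → 3 ≤ length (common-in _≟_ E? E-sym vs v w)) where
        private
          N : List V
          N = nbrs vs v

          N! : Unique N
          N! = filter⁺ (λ w → ¬? (v ≟ w) ×-dec E? v w) u

          N-elim : ∀ {w} → w ∈ N → w ∈ vs × v ≢ w × E v w
          N-elim = ∈-filter⁻ (λ w → ¬? (v ≟ w) ×-dec E? v w) {xs = vs}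

          3≤ : ∀ {w} → w ∈ N → 3 ≤ count (λ x → ¬? (w ≟ x) ×-dec E? w x) N
          3≤ {w} w∈ = ≤-trans (triangles (proj₁ wN) (proj₁ (proj₂ wN)) (proj₂ (proj₂ wN)))
            (length-⊆ (filter⁺ C? u) λ p → let (x∈ , (vx , wx) , (evx , ewx)) = ∈-filter⁻ C? {xs = vs} p in
              ∈-filter⁺ (λ x → ¬? (w ≟ x) ×-dec E? w x) (∈-filter⁺ (λ w → ¬? (v ≟ w) ×-dec E? v w) x∈ (vx , evx)) (wx , ewx))
            where
            wN = N-elim w∈
            C? : U.Decidable (λ x → (v ≢ x × w ≢ x) × (E v x × E w x))
            C? x = (¬? (v ≟ x) ×-dec ¬? (w ≟ x)) ×-dec (E? v x ×-dec E? w x)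

          -- `w` itself, three neighbours of `w` in `N` and the non-neighbours `ys` are all
          -- different.
          missing : ∀ {w} ys → w ∈ N → Unique (w ∷ ys) → (∀ {y} → y ∈ ys → y ∈ N × ¬ E w y) → 4 + length ys ≤ length N
          missing {w} ys w∈ w∷ys! out = ≤-trans (≤-reflexive (sym (+-suc 3 (length ys))))
            (≤-trans (+-monoˡ-≤ (suc (length ys)) (3≤ w∈))
              (length-filter-∉ (λ x → ¬? (w ≟ x) ×-dec E? w x) N! w∷ys!
                λ { (here refl) → w∈ , (λ p → proj₁ p refl) ; (there y∈) → proj₁ (out y∈) , (λ p → proj₂ (out y∈) (proj₂ p)) }))

          module Found {a b c d : V} (a∈ : a ∈ N) (b∈ : b ∈ N) (c∈ : c ∈ N) (d∈ : d ∈ N)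
                       (ab : a ≢ b) (ac : a ≢ c) (ad : a ≢ d) (bc : b ≢ c) (bd : b ≢ d) (cd : c ≢ d) where
            va = N-elim a∈
            vb = N-elim b∈
            vc = N-elim c∈
            vd = N-elim d∈

            adjacent : E a b → E a c → E a d → E b c → E b d → E c d → ⊥
            adjacent = noK₅ P (proj₁ (proj₂ va)) (proj₁ (proj₂ vb)) (proj₁ (proj₂ vc)) (proj₁ (proj₂ vd)) ab ac ad bc bd cd
              (proj₂ (proj₂ va)) (proj₂ (proj₂ vb)) (proj₂ (proj₂ vc)) (proj₂ (proj₂ vd))

            -- The same after merging e into a.
            adjacent-via : ∀ {e} → e ∈ N → e ≢ a → e ≢ b → e ≢ c → e ≢ d → E a e → E e b →
                           E a c → E a d → E b c → E b d → E c d → ⊥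
            adjacent-via {e} e∈ ea eb ec ed ae e-b a-c a-d b-c b-d c-d =
              noK₅ (Contraction.contract E a e ae (E-sym ae) (≢-sym ea) P)
                (proj₁ (proj₂ va)) (proj₁ (proj₂ vb)) (proj₁ (proj₂ vc)) (proj₁ (proj₂ vd)) ab ac ad bc bd cd
                (ve , ≢-sym ea , inj₁ (proj₂ (proj₂ va))) (ve , ≢-sym eb , inj₁ (proj₂ (proj₂ vb)))
                (ve , ≢-sym ec , inj₁ (proj₂ (proj₂ vc))) (ve , ≢-sym ed , inj₁ (proj₂ (proj₂ vd)))
                (≢-sym ea , ≢-sym eb , inj₂ (inj₁ (refl , e-b))) (≢-sym ea , ≢-sym ec , inj₁ a-c)
                (≢-sym ea , ≢-sym ed , inj₁ a-d) (≢-sym eb , ≢-sym ec , inj₁ b-c)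
                (≢-sym eb , ≢-sym ed , inj₁ b-d) (≢-sym ec , ≢-sym ed , inj₁ c-d)
              where
              ve = proj₁ (proj₂ (N-elim e∈))

        module _ (4≤N : 4 ≤ length N) (N≤5 : length N ≤ 5) where
          private
            -- A second non-neighbour of `w` would require six elements of `N`.
            one-missing : ∀ {w y z} → w ∈ N → y ∈ N → z ∈ N → w ≢ y → w ≢ z → y ≢ z → ¬ E w y → E w z
            one-missing {w} {y} {z} w∈ y∈ z∈ wy wz yz ¬e = decidable-stable (E? w z) λ ¬f →
              <⇒≱ (s≤s N≤5) (missing (y ∷ z ∷ []) w∈ ((wy ∷ wz ∷ []) ∷ (yz ∷ []) ∷ [] ∷ [])
                λ { (here refl) → y∈ , ¬e ; (there (here refl)) → z∈ , ¬f })

            bad? : ∀ w → Dec (Any (λ y → w ≢ y × ¬ E w y) N)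
            bad? w = any? (λ y → ¬? (w ≟ y) ×-dec ¬? (E? w y)) N

            complete : ¬ Any (λ w → Any (λ y → w ≢ y × ¬ E w y) N) N → ∀ xs → 4 ≤ length xs → Unique xs →
                       (∀ {x} → x ∈ xs → x ∈ N) → ⊥
            complete none (a ∷ b ∷ c ∷ d ∷ xs) _
              ((ab ∷ ac ∷ ad ∷ _) ∷ (bc ∷ bd ∷ _) ∷ (cd ∷ _) ∷ _) sub =
              Found.adjacent a∈ b∈ c∈ d∈ ab ac ad bc bd cd
                (E! a∈ b∈ ab) (E! a∈ c∈ ac) (E! a∈ d∈ ad) (E! b∈ c∈ bc) (E! b∈ d∈ bd) (E! c∈ d∈ cd)
              where
              a∈ = sub (here refl)
              b∈ = sub (there (here refl))
              c∈ = sub (there (there (here refl)))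
              d∈ = sub (there (there (there (here refl))))
              E! : ∀ {x y} → x ∈ N → y ∈ N → x ≢ y → E x y
              E! {x} {y} x∈ y∈ ne = decidable-stable (E? x y) λ ¬e → none (lose x∈ (lose y∈ (ne , ¬e)))
            complete none (_ ∷ _ ∷ _ ∷ []) (s≤s (s≤s (s≤s ()))) _ _
            complete none (_ ∷ _ ∷ []) (s≤s (s≤s ())) _ _
            complete none (_ ∷ []) (s≤s ()) _ _

            module Pair {p q : V} (p∈ : p ∈ N) (q∈ : q ∈ N) (pq : p ≢ q) (¬pq : ¬ E p q) where

              5≤N : 5 ≤ length N
              5≤N = missing (q ∷ []) p∈ ((pq ∷ []) ∷ [] ∷ []) λ { (here refl) → q∈ , ¬pq }

              rest : List V
              rest = filter (λ w → ¬? (p ≟ w) ×-dec ¬? (q ≟ w)) N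

              rest-elim : ∀ {w} → w ∈ rest → w ∈ N × p ≢ w × q ≢ w
              rest-elim = ∈-filter⁻ (λ w → ¬? (p ≟ w) ×-dec ¬? (q ≟ w)) {xs = N}

              3≤rest : 3 ≤ length rest
              3≤rest = +-cancelˡ-≤ 2 _ _ (≤-trans 5≤N (length-⊆ {ys = p ∷ q ∷ rest} N! sub))
                where
                sub : ∀ {w} → w ∈ N → w ∈ p ∷ q ∷ rest
                sub {w} w∈ with p ≟ w | q ≟ w
                ... | yes refl | _ = here refl
                ... | no _ | yes refl = there (here refl)
                ... | no pw | no qw = there (there (∈-filter⁺ (λ w → ¬? (p ≟ w) ×-dec ¬? (q ≟ w)) w∈ (pw , qw)))

              p~ : ∀ {w} → w ∈ rest → E p w
              p~ w∈ = let (wN , pw , qw) = rest-elim w∈ in one-missing p∈ q∈ wN pq pw qw ¬pq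

              q~ : ∀ {w} → w ∈ rest → E q w
              q~ w∈ = let (wN , pw , qw) = rest-elim w∈ in
                one-missing q∈ p∈ wN (≢-sym pq) qw pw (λ e → ¬pq (E-sym e))

              -- Merging `r` into `p` joins `p` to `q`, as `r` is adjacent to both. The pair that
              -- lacks the edge `r s` loses `r`, and p, q, s, e together with `v` form a K₅.
              two-pairs : ∀ {r s e} → r ∈ rest → s ∈ rest → e ∈ rest → r ≢ s → r ≢ e → s ≢ e → ¬ E r s → ⊥
              two-pairs r∈ s∈ e∈ rs re se ¬rs =
                let (rN , pr , qr) = rest-elim r∈ ; (sN , ps , qs) = rest-elim s∈ ; (eN , pe , qe) = rest-elim e∈ in
                Found.adjacent-via p∈ q∈ sN eN pq ps pe qs qe se
                  rN (≢-sym pr) (≢-sym qr) rs re (p~ r∈) (E-sym (q~ r∈))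
                  (p~ s∈) (p~ e∈) (q~ s∈) (q~ e∈)
                  (one-missing sN rN eN (≢-sym rs) se re (λ e → ¬rs (E-sym e)))

              three : ∀ {r s e} → r ∈ rest → s ∈ rest → e ∈ rest → r ≢ s → r ≢ e → s ≢ e →
                      Dec (E r s) → Dec (E r e) → Dec (E s e) → ⊥
              three r∈ s∈ e∈ rs re se (no ¬f) _ _ = two-pairs r∈ s∈ e∈ rs re se ¬f
              three r∈ s∈ e∈ rs re se _ (no ¬f) _ = two-pairs r∈ e∈ s∈ re rs (≢-sym se) ¬f
              three r∈ s∈ e∈ rs re se _ _ (no ¬f) = two-pairs s∈ e∈ r∈ se (≢-sym rs) (≢-sym re) ¬f
              three r∈ s∈ e∈ rs re se (yes f) (yes g) (yes h) =
                let (rN , pr , _) = rest-elim r∈ ; (sN , ps , _) = rest-elim s∈ ; (eN , pe , _) = rest-elim e∈ in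
                Found.adjacent p∈ rN sN eN pr ps pe rs re se (p~ r∈) (p~ s∈) (p~ e∈) f g h

              search : ∀ xs → 3 ≤ length xs → Unique xs → (∀ {x} → x ∈ xs → x ∈ rest) → ⊥
              search (r ∷ s ∷ e ∷ xs) _ ((rs ∷ re ∷ _) ∷ (se ∷ _) ∷ _) sub =
                three (sub (here refl)) (sub (there (here refl))) (sub (there (there (here refl)))) rs re se
                  (E? r s) (E? r e) (E? s e)
              search (_ ∷ _ ∷ []) (s≤s (s≤s ())) _ _
              search (_ ∷ []) (s≤s ()) _ _

              absurd : ⊥
              absurd = search rest 3≤rest (filter⁺ (λ w → ¬? (p ≟ w) ×-dec ¬? (q ≟ w)) N!) (λ x∈ → x∈)

          no-dense-vertex : ⊥
          no-dense-vertex with any? bad? N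
          ... | no none = complete none N 4≤N N! (λ x∈ → x∈)
          ... | yes some with find some
          ...   | p , p∈ , some′ with find some′
          ...     | q , q∈ , pq , ¬e = Pair.absurd p∈ q∈ pq ¬e

-- Existence of orientations

module OrientationTheorem where

  open ArcParity using (Parity)
  open Contractions
  open ListCounting
  open Orientations
  open DenseVertices
  open import Data.Empty using (⊥; ⊥-elim)
  open import Data.List using (List; []; _∷_; length; cartesianProduct)
  open import Data.List.Membership.Propositional using (_∈_; find; lose)
  open import Data.List.Membership.Propositional.Properties using (∈-filter⁻; ∈-cartesianProduct⁺)
  open import Data.List.Properties using (filter-notAll)
  open import Data.List.Relation.Unary.All as All using ([]; _∷_)
  open import Data.List.Relation.Unary.Any as Any using (Any; here; there; any?)
  open import Data.List.Relation.Unary.Unique.Propositional using (Unique)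
  open import Data.List.Relation.Unary.Unique.Propositional.Properties using (filter⁺)
  open import Data.Nat using (ℕ; zero; suc; _+_; _*_; _≤_; _<_; z≤n; s≤s; s≤s⁻¹)
  open import Data.Nat.Properties hiding (_≟_)
  open import Data.Product using (_×_; _,_; proj₁; proj₂)
  open import Data.Sum using (_⊎_; inj₁; inj₂)
  open import Function using (_∘_)
  open import Relation.Binary using (Decidable; DecidableEquality; Symmetric)
  open import Relation.Binary.PropositionalEquality
  open import Relation.Nullary using (¬_; Dec; yes; no)
  open import Relation.Nullary.Decidable using (¬?; _×-dec_; _⊎-dec_)

  module _ {V : Set} (_≟_ : DecidableEquality V) where

    module Deletion {E : V → V → Set} (E? : Decidable E) (E-sym : Symmetric E) (p q : V) where

      Deleted : V → V → Set
      Deleted x y = E x y × ¬ ((x ≡ p × y ≡ q) ⊎ (x ≡ q × y ≡ p))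

      same? : ∀ x y → Dec ((x ≡ p × y ≡ q) ⊎ (x ≡ q × y ≡ p))
      same? x y = ((x ≟ p) ×-dec (y ≟ q)) ⊎-dec ((x ≟ q) ×-dec (y ≟ p))

      deleted? : Decidable Deleted
      deleted? x y = E? x y ×-dec ¬? (same? x y)

      deleted-sym : Symmetric Deleted
      deleted-sym (e , ne) = E-sym e , λ { (inj₁ (a , b)) → ne (inj₂ (b , a)) ; (inj₂ (a , b)) → ne (inj₁ (b , a)) }

      deleted-parity : Parity E → Parity Deleted
      deleted-parity P = record
        { h = h ; h-not = h-not ; a = λ e → a (proj₁ e) ; even = λ e f → even (proj₁ e) (proj₁ f) }
        where open Parity P

      module _ {vs : List V} (vs! : Unique vs) (O : Orientation _≟_ Deleted vs) where
        open Orientation O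

        private
          -- The deleted edge returns at `p`, whose out-degree may become 4. These lists serve for
          -- counting only.
          outs-aux : ∀ x → Dec (x ≡ p) → List V
          outs-aux x (yes _) = q ∷ out x
          outs-aux x (no _) = out x

          outs : V → List V
          outs x = outs-aux x (x ≟ p)

          q∈outs : ∀ d → q ∈ outs-aux p d
          q∈outs (yes _) = here refl
          q∈outs (no ne) = ⊥-elim (ne refl)

          out⊆ : ∀ {x y} d → y ∈ out x → y ∈ outs-aux x d
          out⊆ (yes _) = there
          out⊆ (no _) y∈ = y∈

          covers : ∀ {x y} → x ∈ vs → y ∈ vs → x ≢ y → E x y → Dec ((x ≡ p × y ≡ q) ⊎ (x ≡ q × y ≡ p)) →
                   y ∈ outs x ⊎ x ∈ outs y
          covers x∈ y∈ ne e (yes (inj₁ (refl , refl))) = inj₁ (q∈outs (p ≟ p))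
          covers x∈ y∈ ne e (yes (inj₂ (refl , refl))) = inj₂ (q∈outs (p ≟ p))
          covers {x} {y} x∈ y∈ ne e (no d) with cover x∈ y∈ ne (e , d)
          ... | inj₁ i = inj₁ (out⊆ (x ≟ p) i)
          ... | inj₂ i = inj₂ (out⊆ (y ≟ p) i)

          degree : V → ℕ
          degree v = length (neighbours-in _≟_ E? E-sym vs v)

          S : ℕ
          S = Σ[ vs ] (length ∘ out)

          outs-sum : Σ[ vs ] (length ∘ outs) ≤ suc S
          outs-sum = Σ-bump _≟_ p vs! (λ {x} ne → other ne (x ≟ p)) (at-p (p ≟ p))
            where
            other : ∀ {x} → x ≢ p → ∀ d → length (outs-aux x d) ≤ length (out x)
            other ne (yes e) = ⊥-elim (ne e)
            other ne (no _) = ≤-refl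
            at-p : ∀ d → length (outs-aux p d) ≤ suc (length (out p))
            at-p (yes _) = ≤-refl
            at-p (no _) = n≤1+n _

        -- If all degrees were at least 6, then 2S + 4 ≤ 6n by the root and 6n ≤ 2S + 2 by the count
        -- of edges.
        low-degree : Any (λ v → degree v ≤ 5) vs
        low-degree with any? (λ v → degree v ≤? 5) vs
        ... | yes found = found
        ... | no none = ⊥-elim (1+n≰n (begin
          suc (3 + (S + S))
            ≡⟨ cong (2 +_) (trans (sym (+-assoc 2 S S)) (trans (cong (_+ S) (+-comm 2 S)) (+-assoc S 2 S))) ⟩
          (2 + S) + (2 + S)
            ≤⟨ +-mono-≤ slack slack ⟩
          length vs * 3 + length vs * 3
            ≡⟨ *-distribˡ-+ (length vs) 3 3 ⟨
          length vs * 6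
            ≡⟨ Σ-const 6 vs ⟨
          Σ[ vs ] (λ _ → 6)
            ≤⟨ Σ-mono vs (λ v∈ → ≰⇒> (λ le → none (lose v∈ le))) ⟩
          Σ[ vs ] degree
            ≤⟨ degree-sum _≟_ E? vs! outs (λ {x} {y} x∈ y∈ ne e → covers x∈ y∈ ne e (same? x y)) E-sym ⟩
          Σ[ vs ] (length ∘ outs) + Σ[ vs ] (length ∘ outs)
            ≤⟨ +-mono-≤ outs-sum outs-sum ⟩
          suc S + suc S
            ≡⟨ cong suc (+-suc S S) ⟩
          2 + (S + S)
            ≤⟨ n≤1+n _ ⟩
          3 + (S + S) ∎))
          where
          open ≤-Reasoning
          slack : 2 + S ≤ length vs * 3
          slack = Σ-slack root∈ out≤3 root≤1

    open Deletion

    edges : ∀ {E : V → V → Set} → Decidable E → List V → ℕ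
    edges E? vs = count (λ xy → E? (proj₁ xy) (proj₂ xy)) (cartesianProduct vs vs)

    without-< : ∀ {v vs} → v ∈ vs → length (without _≟_ v vs) < length vs
    without-< {v} {vs} v∈ = filter-notAll (λ w → ¬? (w ≟ v)) vs (Any.map (λ { refl ne → ne refl }) v∈)

    contracted? : ∀ {E : V → V → Set} → Decidable E → ∀ u v → Decidable (Contraction.Contracted E u v)
    contracted? E? u v x y =
      ¬? (x ≟ v) ×-dec (¬? (y ≟ v) ×-dec (E? x y ⊎-dec (((x ≟ u) ×-dec E? v y) ⊎-dec ((y ≟ u) ×-dec E? x v))))

    contracted-sym : ∀ {E : V → V → Set} → Symmetric E → ∀ u v → Symmetric (Contraction.Contracted E u v)
    contracted-sym E-sym u v (xv , yv , inj₁ e) = yv , xv , inj₁ (E-sym e)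
    contracted-sym E-sym u v (xv , yv , inj₂ (inj₁ (xu , e))) = yv , xv , inj₂ (inj₂ (xu , E-sym e))
    contracted-sym E-sym u v (xv , yv , inj₂ (inj₂ (yu , e))) = yv , xv , inj₂ (inj₁ (yu , E-sym e))

    -- Vertex sets are lists in one fixed type, so that contraction shortens the list and leaves the
    -- type alone. A member is demanded because the empty list has no root.
    Orientable : ℕ → Set₁
    Orientable n = ∀ {E} (E? : Decidable E) → Symmetric E → Parity E → ∀ {vs} → Unique vs → length vs ≤ n →
                   ∀ {r} → r ∈ vs → Orientation _≟_ E vs

    module Step {n : ℕ} (smaller : Orientable n) {E : V → V → Set} (E? : Decidable E) (E-sym : Symmetric E)
                (P : Parity E) {vs : List V} (vs! : Unique vs) (len : length vs ≤ suc n)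
                (sparser : ∀ {E′} (E′? : Decidable E′) → Symmetric E′ → Parity E′ → edges E′? vs < edges E? vs →
                           Orientation _≟_ E′ vs) where

      degree : V → ℕ
      degree v = length (neighbours-in _≟_ E? E-sym vs v)

      few-common? : ∀ u v → Dec (u ≢ v × E u v × length (common-in _≟_ E? E-sym vs u v) ≤ 2)
      few-common? u v = ¬? (u ≟ v) ×-dec (E? u v ×-dec (length (common-in _≟_ E? E-sym vs u v) ≤? 2))

      without≤ : ∀ {v} → v ∈ vs → length (without _≟_ v vs) ≤ n
      without≤ v∈ = s≤s⁻¹ (≤-trans (without-< v∈) len)

      without! : ∀ {v} → Unique (without _≟_ v vs)
      without! {v} = filter⁺ (λ w → ¬? (w ≟ v)) vs!

      -- The remaining vertices enter as a list with an equation, to single out the case in which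
      -- there are none: then the induction hypothesis offers no root, and `v` becomes the root.
      low : ∀ {v} → v ∈ vs → degree v ≤ 3 → ∀ ws → ws ≡ without _≟_ v vs → Orientation _≟_ E vs
      low {v} v∈ deg [] e = record
        { out = λ _ → [] ; out≤3 = λ _ → z≤n
        ; cover = λ x∈ y∈ ne _ → ⊥-elim (ne (trans (only x∈) (sym (only y∈))))
        ; root = v ; root∈ = v∈ ; root≤1 = z≤n }
        where
        only : ∀ {x} → x ∈ vs → x ≡ v
        only {x} x∈ with x ≟ v
        ... | yes e = e
        ... | no ne with subst (x ∈_) (sym e) (without-∈ _≟_ x∈ ne)
        ...   | ()
      low {v} v∈ deg (w ∷ ws) e = remove-vertex _≟_ E? E-sym v∈ deg
        (smaller E? E-sym P without! (without≤ v∈) (subst (w ∈_) e (here refl)))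

      contractible : ∀ {u v} → u ∈ vs → v ∈ vs → u ≢ v × E u v × length (common-in _≟_ E? E-sym vs u v) ≤ 2 →
                     Orientation _≟_ E vs
      contractible {u} {v} u∈ v∈ (u≢v , uv , few) = uncontract _≟_ E? E-sym u∈ v∈ u≢v uv few
        (smaller (contracted? E? u v) (λ {x} {y} → contracted-sym {E} E-sym u v {x} {y})
          (Contraction.contract E u v uv (E-sym uv) u≢v P) without! (without≤ v∈) (without-∈ _≟_ u∈ u≢v))

      module Dense (high : ¬ Any (λ v → degree v ≤ 3) vs) (triangles : ¬ Any (λ u → Any (λ v →
                     u ≢ v × E u v × length (common-in _≟_ E? E-sym vs u v) ≤ 2) vs) vs) where

        4≤ : ∀ {v} → v ∈ vs → 4 ≤ degree v
        4≤ v∈ = ≰⇒> (λ le → high (lose v∈ le))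

        dense : ¬ Any (λ v → degree v ≤ 5) vs
        dense found = let (v , v∈ , deg) = find found in no-dense-vertex _≟_ E? E-sym P vs! v∈
          (λ w∈ ne e → ≰⇒> (λ le → triangles (lose v∈ (lose w∈ (ne , e , le))))) (4≤ v∈) deg

        -- The graph without the edge contributes only a bound on degrees; `dense` is about the
        -- graph that still has it.
        delete-edge : ∀ {p q} → p ∈ vs → q ∈ vs → E p q → ⊥
        delete-edge {p} {q} p∈ q∈ pq = dense (low-degree E? E-sym p q vs!
          (sparser (deleted? E? E-sym p q) (deleted-sym E? E-sym p q) (deleted-parity E? E-sym p q P)
            (count-< (λ xy → deleted? E? E-sym p q (proj₁ xy) (proj₂ xy)) (λ xy → E? (proj₁ xy) (proj₂ xy))
              proj₁ (∈-cartesianProduct⁺ p∈ q∈) pq (λ d → proj₂ d (inj₁ (refl , refl))))))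

        absurd : ∀ {r} → r ∈ vs → ⊥
        absurd {r} r∈ = some-edge (neighbours-in _≟_ E? E-sym vs r) (λ x∈ → x∈) (4≤ r∈)
          where
          some-edge : ∀ ws → (∀ {w} → w ∈ ws → w ∈ neighbours-in _≟_ E? E-sym vs r) → 4 ≤ length ws → ⊥
          some-edge (w ∷ _) sub _ =
            let (w∈ , _ , rw) = ∈-filter⁻ (λ w → ¬? (r ≟ w) ×-dec E? r w) {xs = vs} (sub (here refl)) in delete-edge r∈ w∈ rw

      step : ∀ {r} → r ∈ vs → Orientation _≟_ E vs
      step r∈ with any? (λ v → degree v ≤? 3) vs
      ... | yes some = let (v , v∈ , deg) = find some in low v∈ deg _ refl
      ... | no high with any? (λ u → any? (few-common? u) vs) vs
      ...   | yes some = let (u , u∈ , some′) = find some ; (v , v∈ , c) = find some′ in contractible u∈ v∈ c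
      ...   | no triangles = ⊥-elim (Dense.absurd high triangles r∈)

    -- The induction is lexicographic. Removal and contraction lower the number of vertices, and
    -- deletion lowers the number of edges on the same vertices.
    orient-edges : ∀ {n} → Orientable n → ∀ m {E} (E? : Decidable E) → Symmetric E → Parity E → ∀ {vs} → Unique vs →
                   length vs ≤ suc n → edges E? vs < m → ∀ {r} → r ∈ vs → Orientation _≟_ E vs
    orient-edges smaller (suc m) E? E-sym P vs! len (s≤s few) r∈ = Step.step smaller E? E-sym P vs! len
      (λ E′? E′-sym P′ lt → orient-edges smaller m E′? E′-sym P′ vs! len (<-≤-trans lt few) r∈) r∈

    orient : ∀ n → Orientable n
    orient zero E? E-sym P {[]} vs! _ ()
    orient (suc n) E? E-sym P vs! len r∈ = orient-edges (orient n) _ E? E-sym P vs! len ≤-refl r∈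

-- Star layouts and the upper bound

module StarLayouts where

  open import Defs
  open ArcParity using (parity)
  open ListCounting using (length-⊆)
  open Orientations using (Orientation)
  open OrientationTheorem using (orient)
  open import Data.Empty using (⊥; ⊥-elim)
  open import Data.Fin using (Fin; zero; suc; toℕ; _<_)
  open import Data.Fin.Properties using (_≟_; toℕ-injective; <-isStrictTotalOrder; <-cmp)
  open import Data.List using (List; _∷_; length; map; allFin)
  open import Data.List.Membership.Propositional using (_∈_)
  import Data.List.Membership.DecPropositional as DecMembership
  open import Data.List.Membership.Propositional.Properties using (∈-deduplicate⁻; ∈-map⁻; ∈-map⁺; ∈-filter⁻; ∈-allFin)
  open import Data.List.Properties using (length-map; length-tabulate)
  open import Data.List.Relation.Unary.Any using (here; there)
  open import Data.List.Relation.Unary.Unique.DecPropositional.Properties using (deduplicate-!)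
  open import Data.List.Relation.Unary.Unique.Propositional.Properties using (allFin⁺)
  open import Data.Nat using (ℕ; _≤_; s≤s)
  import Data.Nat.Properties as ℕ
  open import Data.Product using (_×_; _,_; proj₂)
  open import Data.Sum using (_⊎_; inj₁; inj₂)
  open import Relation.Binary using (Tri; tri<; tri≈; tri>; IsStrictTotalOrder)
  open import Relation.Binary.PropositionalEquality
  open import Relation.Nullary using (¬_; Dec; yes; no)

  module _ {G : Graph} where
    open Graph G hiding (sym)

    isLocal : ∀ {ℓ} (L : QueueLayout G) (labels : V → List ℕ) →
      (∀ {v w} → v ~ w → QueueLayout.queue L v w ∈ labels v) → (∀ v → length (labels v) ≤ ℓ) → IsLocal G ℓ L
    isLocal L labels sound short v = ℕ.≤-trans (length-⊆ (deduplicate-! ℕ._≟_ _) sub) (short v)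
      where
      open QueueLayout L
      sub : ∀ {q} → q ∈ queuesAt v → q ∈ labels v
      sub q∈ with ∈-map⁻ (queue v) (∈-deduplicate⁻ ℕ._≟_ _ q∈)
      ... | w , w∈ , refl = sound (proj₂ (∈-filter⁻ (v ~?_) {xs = allFin order} w∈))

    module _ {_≺_ : V → V → Set} (≺-isOrder : IsStrictTotalOrder _≡_ _≺_) where
      private module ≺ = IsStrictTotalOrder ≺-isOrder

      nest-disjoint : ∀ {u v x y} → Nest G _≺_ u v x y → (u ≢ x × u ≢ y) × (v ≢ x × v ≢ y)
      nest-disjoint (inj₁ (ux , xy , yv)) =
        ((λ e → ≺.irrefl e ux) , (λ e → ≺.irrefl e (≺.trans ux xy))) ,
        ((λ e → ≺.irrefl (sym e) (≺.trans xy yv)) , (λ e → ≺.irrefl (sym e) yv))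
      nest-disjoint (inj₂ (xu , uv , vy)) =
        ((λ e → ≺.irrefl (sym e) xu) , (λ e → ≺.irrefl e (≺.trans uv vy))) ,
        ((λ e → ≺.irrefl (sym e) (≺.trans xu uv)) , (λ e → ≺.irrefl e vy))

      -- Nested edges have four different ends, whereas any two edges here share `c`.
      star-isQueue : ∀ {E : V → V → Set} c → (∀ {u v} → E u v → c ≡ u ⊎ c ≡ v) → IsQueue G _≺_ E
      star-isQueue c at e f n with at e | at f | nest-disjoint n
      ... | inj₁ refl | inj₁ refl | (ux , _) , _ = ux refl
      ... | inj₁ refl | inj₂ refl | (_ , uy) , _ = uy refl
      ... | inj₂ refl | inj₁ refl | _ , (vx , _) = vx refl
      ... | inj₂ refl | inj₂ refl | _ , (_ , vy) = vy refl

    -- Each edge is put into the star at its head. A vertex then meets its own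
    -- star and those of its out-neighbours.
    module StarLayout (out : V → List V) (cover : ∀ {x y} → x ~ y → y ∈ out x ⊎ x ∈ out y) where
      open DecMembership (_≟_ {order}) using (_∈?_)

      head-aux : ∀ u v → Dec (v ∈ out u) → V
      head-aux u v (yes _) = v
      head-aux u v (no _) = u

      -- An edge may occur in the out-lists of both ends. The order of the ends fixes which list is
      -- consulted, so that the head does not depend on how the edge is named.
      headOf-aux : ∀ u v → Dec (v ∈ out u) → Dec (u ∈ out v) → Tri (u < v) (u ≡ v) (v < u) → V
      headOf-aux u v d d′ (tri< _ _ _) = head-aux u v d
      headOf-aux u v d d′ (tri≈ _ _ _) = u
      headOf-aux u v d d′ (tri> _ _ _) = head-aux v u d′

      headOf : V → V → V
      headOf u v = headOf-aux u v (v ∈? out u) (u ∈? out v) (<-cmp u v)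

      headOf-sym : ∀ u v → headOf u v ≡ headOf v u
      headOf-sym u v with <-cmp u v | <-cmp v u
      ... | tri< _ _ _ | tri> _ _ _ = refl
      ... | tri> _ _ _ | tri< _ _ _ = refl
      ... | tri≈ _ e _ | tri≈ _ _ _ = e
      ... | tri< a _ _ | tri< _ _ ¬b = ⊥-elim (¬b a)
      ... | tri< a _ _ | tri≈ _ _ ¬b = ⊥-elim (¬b a)
      ... | tri> _ _ a | tri> ¬b _ _ = ⊥-elim (¬b a)
      ... | tri> _ _ a | tri≈ ¬b _ _ = ⊥-elim (¬b a)
      ... | tri≈ _ a _ | tri< _ ¬b _ = ⊥-elim (¬b (sym a))
      ... | tri≈ _ a _ | tri> _ ¬b _ = ⊥-elim (¬b (sym a))

      headOf-own : ∀ {u v} → u ~ v → headOf u v ∈ u ∷ out u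
      headOf-own {u} {v} e = aux (v ∈? out u) (u ∈? out v) (<-cmp u v)
        where
        aux : ∀ d d′ t → headOf-aux u v d d′ t ∈ u ∷ out u
        aux (yes p) _ (tri< _ _ _) = there p
        aux (no _) _ (tri< _ _ _) = here refl
        aux _ _ (tri≈ _ _ _) = here refl
        aux _ (yes _) (tri> _ _ _) = here refl
        aux (yes p) (no _) (tri> _ _ _) = there p
        aux (no p) (no q) (tri> _ _ _) with cover e
        ... | inj₁ r = ⊥-elim (p r)
        ... | inj₂ r = ⊥-elim (q r)

      headOf-end : ∀ u v → headOf u v ≡ u ⊎ headOf u v ≡ v
      headOf-end u v = aux (v ∈? out u) (u ∈? out v) (<-cmp u v)
        where
        aux : ∀ d d′ t → headOf-aux u v d d′ t ≡ u ⊎ headOf-aux u v d d′ t ≡ v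
        aux (yes _) _ (tri< _ _ _) = inj₂ refl
        aux (no _) _ (tri< _ _ _) = inj₁ refl
        aux _ _ (tri≈ _ _ _) = inj₁ refl
        aux _ (yes _) (tri> _ _ _) = inj₁ refl
        aux _ (no _) (tri> _ _ _) = inj₂ refl

      layout : QueueLayout G
      layout = record
        { _≺_ = _<_
        ; ≺-isOrder = <-isStrictTotalOrder
        ; queue = λ u v → toℕ (headOf u v)
        ; queue-sym = λ {u} {v} _ → cong toℕ (headOf-sym u v)
        ; isQueue = λ q {u} {v} (e , p) (f , r) n → star-isQueue <-isStrictTotalOrder {λ x y → headOf x y ≡ headOf u v} (headOf u v)
            (λ {x} {y} eq → ends eq (headOf-end x y)) refl (toℕ-injective (trans r (sym p))) n
        }
        where
        ends : ∀ {c x y} → headOf x y ≡ c → headOf x y ≡ x ⊎ headOf x y ≡ y → c ≡ x ⊎ c ≡ y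
        ends refl s = s

      local : ∀ {k} → (∀ v → length (out v) ≤ k) → IsLocal G (ℕ.suc k) layout
      local short = isLocal layout (λ v → map toℕ (v ∷ out v)) (λ e → ∈-map⁺ toℕ (headOf-own e))
        λ v → ℕ.≤-trans (ℕ.≤-reflexive (length-map toℕ (v ∷ out v))) (s≤s (short v))

  planar⇒4-local : (G : Graph) → Planar G → HasLocalQueueLayout G 4
  -- Without vertices there is no root, hence no orientation.
  planar⇒4-local record { order = 0 } D = StarLayout.layout (λ ()) (λ {x} → ⊥-elim (none x)) , λ ()
    where
    none : Fin 0 → ⊥
    none ()
  planar⇒4-local G@record { order = ℕ.suc n } D = layout , local out≤3
    where
    open Graph G renaming (sym to ~-sym)
    open Orientation (orient _≟_ (ℕ.suc n) _~?_ ~-sym (parity D) (allFin⁺ _)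
      (ℕ.≤-reflexive (length-tabulate (λ x → x))) (∈-allFin {ℕ.suc n} zero))
    cover′ : ∀ {x y} → x ~ y → y ∈ out x ⊎ x ∈ out y
    cover′ {x} {y} e = cover (∈-allFin x) (∈-allFin y) (λ p → irrefl p e) e
    open StarLayout {G} out cover′

-- Pigeonhole principles with explicit witnesses

module Pigeonhole where

  open import Data.Empty using (⊥; ⊥-elim)
  open import Data.List using (List; []; _∷_; length)
  open import Data.List.Relation.Unary.All as All using (All; []; _∷_)
  open import Data.List.Relation.Unary.AllPairs using ([]; _∷_)
  open import Data.List.Relation.Unary.Unique.Propositional using (Unique)
  open import Data.Nat using (ℕ; zero; suc; _+_; _≤_; z≤n; s≤s; s≤s⁻¹; _≤?_)
  open import Data.Nat.Properties using (≤-trans; ≤-refl; ≤-reflexive; +-suc; +-mono-≤; ≰⇒>; 1+n≰n; _≟_)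
  open import Data.Product using (Σ; _×_; _,_; proj₁; proj₂; ∃-syntax)
  open import Data.Sum as Sum using (_⊎_; inj₁; inj₂)
  open import Level using (0ℓ)
  open import Relation.Binary using (Rel; IsStrictTotalOrder; tri<; tri≈; tri>)
  import Relation.Binary.Construct.Flip.EqAndOrd as Flip
  open import Relation.Binary.PropositionalEquality
  open import Relation.Nullary using (¬_; Dec; yes; no)

  module _ {I : Set} where

    -- A lower bound on a cardinality. In the course of an argument `Φ` collects facts while `k`
    -- shrinks.
    Big : ℕ → (I → Set) → Set
    Big k Φ = ∃[ js ] Unique js × k ≤ length js × All Φ js

    Big-map : ∀ {k} {Φ Ψ : I → Set} → (∀ {j} → Φ j → Ψ j) → Big k Φ → Big k Ψ
    Big-map f (js , js! , len , all) = js , js! , len , All.map f all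

    Big-≤ : ∀ {k l} {Φ : I → Set} → l ≤ k → Big k Φ → Big l Φ
    Big-≤ le (js , js! , len , all) = js , js! , ≤-trans le len , all

    Big-pick : ∀ {k} {Φ : I → Set} → Big (suc k) Φ → ∃[ j ] Φ j
    Big-pick (j ∷ _ , _ , _ , p ∷ _) = j , p

    Big-pick₂ : ∀ {k} {Φ : I → Set} → Big (2 + k) Φ → ∃[ i ] ∃[ j ] i ≢ j × Φ i × Φ j
    Big-pick₂ (i ∷ j ∷ _ , (ne ∷ _) ∷ _ , _ , p ∷ q ∷ _) = i , j , ne , p , q
    Big-pick₂ (_ ∷ [] , _ , s≤s () , _)

    big-split : ∀ {k} {Φ P Q : I → Set} → Big (k + k) Φ → (∀ {j} → Φ j → P j ⊎ Q j) →
                Big k (λ j → Φ j × P j) ⊎ Big k (λ j → Φ j × Q j)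
    big-split {k} {Φ} {P} {Q} (js , js! , len , all) either with go js js! all
      where
      go : ∀ js → Unique js → All Φ js → Σ (List I × List I) λ (ps , qs) →
           (Unique ps × Unique qs) × (length ps + length qs ≡ length js) × (All (λ j → Φ j × P j) ps × All (λ j → Φ j × Q j) qs) ×
           -- With `R` taken as being different from a new index, this keeps the sublists free of
           -- repetitions.
           (∀ {R : I → Set} → All R js → All R ps × All R qs)
      go [] _ _ = ([] , []) , ([] , []) , refl , ([] , []) , λ _ → [] , []
      go (j ∷ js) (j∉ ∷ js!) (p ∷ all) with go js js! all | either p
      ... | (ps , qs) , (ps! , qs!) , len , (allp , allq) , sub | inj₁ a =
        (j ∷ ps , qs) , (proj₁ (sub j∉) ∷ ps! , qs!) , cong suc len , ((p , a) ∷ allp , allq) ,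
        λ { (r ∷ rs) → r ∷ proj₁ (sub rs) , proj₂ (sub rs) }
      ... | (ps , qs) , (ps! , qs!) , len , (allp , allq) , sub | inj₂ b =
        (ps , j ∷ qs) , (ps! , proj₂ (sub j∉) ∷ qs!) , trans (+-suc _ _) (cong suc len) , (allp , (p , b) ∷ allq) ,
        λ { (r ∷ rs) → proj₁ (sub rs) , r ∷ proj₂ (sub rs) }
    ... | (ps , qs) , (ps! , qs!) , sum , (allp , allq) , _ with k ≤? length ps | k ≤? length qs
    ...   | yes le | _ = inj₁ (ps , ps! , le , allp)
    ...   | no _ | yes le = inj₂ (qs , qs! , le , allq)
    ...   | no ps< | no qs< = ⊥-elim (1+n≰n (≤-trans (s≤s len) (≤-trans (≤-reflexive (cong suc (sym sum)))
            (≤-trans (s≤s (+-mono-≤ {length ps} ≤-refl (≤-trans (n≤suc _) (≰⇒> qs<)))) (+-mono-≤ (≰⇒> ps<) ≤-refl)))))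
      where
      n≤suc : ∀ n → n ≤ suc n
      n≤suc zero = z≤n
      n≤suc (suc n) = s≤s (n≤suc n)

    -- Half of the indices share the label of the first one, or half differ from it. In the second
    -- case they agree with each other, as of any three labels two are equal.
    big-label : ∀ {k} {Φ : I → Set} (f : I → ℕ) → Big (k + k) Φ →
      (∀ {i j l} → Φ i → Φ j → Φ l → f i ≡ f j ⊎ f i ≡ f l ⊎ f j ≡ f l) → ∃[ c ] Big k (λ j → Φ j × f j ≡ c)
    big-label {zero} f _ _ = 0 , [] , [] , z≤n , []
    big-label {suc k} {Φ} f B@(h ∷ _ , _ , _ , ph ∷ _) two with big-split {P = λ j → f j ≡ f h} {λ j → f j ≢ f h} B (λ {j} _ → dec (f j ≟ f h))
      where
      dec : ∀ {A : Set} → Dec A → A ⊎ ¬ A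
      dec (yes a) = inj₁ a
      dec (no a) = inj₂ a
    ... | inj₁ B′ = f h , B′
    ... | inj₂ B′ with Big-pick B′
    ...   | h′ , ph′ , ne′ = f h′ , Big-map same B′
      where
      same : ∀ {j} → Φ j × f j ≢ f h → Φ j × f j ≡ f h′
      same (pj , ne) with two ph pj ph′
      ... | inj₁ e = ⊥-elim (ne (sym e))
      ... | inj₂ (inj₁ e) = ⊥-elim (ne′ (sym e))
      ... | inj₂ (inj₂ e) = pj , e

    module _ {V : Set} {_≺_ : Rel V 0ℓ} (sto : IsStrictTotalOrder _≡_ _≺_) {g : I → V} (g-inj : ∀ {i j} → i ≢ j → g i ≢ g j) where
      open IsStrictTotalOrder sto using (compare) renaming (trans to ≺-trans)

      big-least : ∀ {k} {Φ : I → Set} → Big (suc k) Φ → ∃[ lo ] Φ lo × Big k (λ j → Φ j × g lo ≺ g j)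
      big-least {k} {Φ} (h ∷ js , h∉ ∷ js! , len , p ∷ all) with go h js h∉ js! p all
        where
        go : ∀ h js → All (h ≢_) js → Unique js → Φ h → All Φ js →
          Σ (I × List I) λ (lo , rest) → Φ lo × (Unique (lo ∷ rest) × length rest ≡ length js) × All (λ j → Φ j × g lo ≺ g j) rest ×
            (∀ {R : I → Set} → R h → All R js → R lo × All R rest)
        go h [] _ _ p _ = (h , []) , p , ([] ∷ [] , refl) , [] , λ r _ → r , []
        go h (h′ ∷ js) (ne ∷ h∉) (h′∉ ∷ js!) p (p′ ∷ all) with go h′ js h′∉ js! p′ all
        ... | (lo , rest) , pl , (lo∉ ∷ rest! , len) , least , sub with compare (g h) (g lo)
        ...   | tri< lt _ _ = (h , lo ∷ rest) , p , ((proj₁ (sub ne h∉) ∷ proj₂ (sub ne h∉)) ∷ lo∉ ∷ rest! , cong suc len) ,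
                  (pl , lt) ∷ All.map (λ (a , b) → a , ≺-trans lt b) least ,
                  λ { r (r′ ∷ rs) → r , proj₁ (sub r′ rs) ∷ proj₂ (sub r′ rs) }
        ...   | tri≈ _ e _ = ⊥-elim (g-inj (proj₁ (sub {h ≢_} ne h∉)) e)
        ...   | tri> _ _ gt = (lo , h ∷ rest) , pl ,
                  ((≢-sym (proj₁ (sub ne h∉)) ∷ lo∉) ∷ proj₂ (sub ne h∉) ∷ rest! , cong suc len) ,
                  (p , gt) ∷ least , λ { r (r′ ∷ rs) → proj₁ (sub r′ rs) , r ∷ proj₂ (sub r′ rs) }
      ... | (lo , rest) , pl , (_ ∷ rest! , len′) , least , _ =
        lo , pl , rest , rest! , ≤-trans (s≤s⁻¹ len) (≤-reflexive (sym len′)) , least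

    module _ {V : Set} {_≺_ : Rel V 0ℓ} (sto : IsStrictTotalOrder _≡_ _≺_) {g : I → V} (g-inj : ∀ {i j} → i ≢ j → g i ≢ g j) where

      -- Provides the position that `star-right` and `star-left` need: two extremes of a star and
      -- the others strictly between them.
      big-between : ∀ {k} {Φ : I → Set} → Big (2 + k) Φ →
        ∃[ lo ] ∃[ hi ] Φ lo × Φ hi × Big k (λ j → Φ j × g lo ≺ g j × g j ≺ g hi)
      big-between B =
        let (lo , pl , B₁) = big-least sto g-inj B
            (hi , ph , B₂) = big-least (Flip.isStrictTotalOrder sto) g-inj B₁
        in lo , hi , pl , proj₁ ph , Big-map (λ ((p , a) , b) → p , a , b) B₂

      big-triple : ∀ {k} {Φ : I → Set} → Big (3 + k) Φ →
        ∃[ i ] ∃[ j ] ∃[ l ] (Φ i × Φ j × Φ l) × g i ≺ g j × g j ≺ g l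
      big-triple B =
        let (lo , hi , pl , ph , B₁) = big-between B
            (j , pj , a , b) = Big-pick B₁
        in lo , j , hi , (pl , pj , ph) , a , b

-- Layouts with at most two queues at each vertex

module TwoLocalLayouts where

  open Pigeonhole
  open import Data.Empty using (⊥; ⊥-elim)
  open import Data.Nat using (ℕ; _+_)
  open import Data.Product using (_×_; _,_; proj₁; proj₂; swap)
  open import Data.Sum as Sum using (_⊎_; inj₁; inj₂)
  open import Level using (0ℓ)
  open import Relation.Binary using (Rel; IsStrictTotalOrder; Symmetric; tri<; tri≈; tri>)
  import Relation.Binary.Construct.Flip.EqAndOrd as Flip
  open import Relation.Binary.PropositionalEquality
  open import Relation.Nullary using (¬_)

  -- `two` expresses 2-locality without counting labels. The whole structure is preserved by
  -- reversal of the order, which halves the case distinctions.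
  record Layout₂ (V : Set) : Set₁ where
    field
      _≺_    : Rel V 0ℓ
      sto    : IsStrictTotalOrder _≡_ _≺_
      _~_    : Rel V 0ℓ
      ~-sym  : Symmetric _~_
      ~-irrefl : ∀ {x} → ¬ x ~ x
      queue  : V → V → ℕ
      queue-sym : ∀ {u v} → u ~ v → queue u v ≡ queue v u

    Edge : ℕ → V → V → Set
    Edge q u v = u ~ v × queue u v ≡ q

    field
      noNest : ∀ {q a b c d} → Edge q a b → Edge q c d → a ≺ c → c ≺ d → d ≺ b → ⊥
      two    : ∀ {v x y z} → v ~ x → v ~ y → v ~ z →
               queue v x ≡ queue v y ⊎ queue v x ≡ queue v z ⊎ queue v y ≡ queue v z

    open IsStrictTotalOrder sto public using (compare) renaming (trans to ≺-trans; irrefl to ≺-irrefl)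

    Edge-sym : ∀ {q u v} → Edge q u v → Edge q v u
    Edge-sym (e , p) = ~-sym e , trans (sym (queue-sym e)) p

    two-queues : ∀ {p q r v x y z} → Edge p v x → Edge q v y → Edge r v z → p ≢ q → r ≡ p ⊎ r ≡ q
    two-queues (e , refl) (f , refl) (g , refl) ne with two e f g
    ... | inj₁ p = ⊥-elim (ne p)
    ... | inj₂ (inj₁ p) = inj₁ (sym p)
    ... | inj₂ (inj₂ p) = inj₂ (sym p)

    ≺-⊀ : ∀ {x y z} → x ≺ y → ¬ z ≺ y → x ≺ z
    ≺-⊀ {x} {y} {z} xy zy with compare x z
    ... | tri< p _ _ = p
    ... | tri≈ _ refl _ = ⊥-elim (zy xy)
    ... | tri> _ _ zx = ⊥-elim (zy (≺-trans zx xy))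

    ⊀-≺ : ∀ {x y z} → ¬ y ≺ x → y ≺ z → x ≺ z
    ⊀-≺ {x} {y} {z} yx yz with compare x z
    ... | tri< p _ _ = p
    ... | tri≈ _ refl _ = ⊥-elim (yx yz)
    ... | tri> _ _ zx = ⊥-elim (yx (≺-trans yz zx))

    sides : ∀ {x y} → x ≢ y → x ≺ y ⊎ y ≺ x
    sides {x} {y} ne with compare x y
    ... | tri< p _ _ = inj₁ p
    ... | tri≈ _ e _ = ⊥-elim (ne e)
    ... | tri> _ _ p = inj₂ p

  mirror : ∀ {V} → Layout₂ V → Layout₂ V
  mirror L = record
    { _≺_ = λ x y → y ≺ x ; sto = Flip.isStrictTotalOrder sto ; _~_ = _~_ ; ~-sym = ~-sym ; ~-irrefl = ~-irrefl
    ; queue = queue ; queue-sym = queue-sym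
    ; noNest = λ e f ac cd db → noNest (Edge-sym e) (Edge-sym f) db cd ac
    ; two = two }
    where open Layout₂ L

  module _ {V : Set} (L : Layout₂ V) where
    open Layout₂ L

    -- Apart from u, the p-neighbours of x₂ lie at or beyond x₃: the edges ux₁
    -- and ux₃ leave no other place.
    star-right : ∀ {p u x₁ x₂ x₃ y} → u ≺ x₁ → x₁ ≺ x₂ → x₂ ≺ x₃ → Edge p u x₁ → Edge p u x₃ → Edge p x₂ y → y ≢ u →
                 ¬ y ≺ x₃
    star-right {u = u} {x₂ = x₂} {y = y} u1 l₁₂ l₂₃ e₁ e₃ e y≢u y3 with compare y u
    ... | tri< yu _ _ = noNest (Edge-sym e) e₁ yu u1 l₁₂
    ... | tri≈ _ p _ = y≢u p
    ... | tri> _ _ uy with compare y x₂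
    ...   | tri< y2 _ _ = noNest e₃ (Edge-sym e) uy y2 l₂₃
    ...   | tri≈ _ refl _ = ~-irrefl (proj₁ e)
    ...   | tri> _ _ 2y = noNest e₃ e (≺-trans u1 l₁₂) 2y y3

  module _ {V : Set} (L : Layout₂ V) where
    open Layout₂ L

    star-left : ∀ {p u x₁ x₂ x₃ y} → x₁ ≺ x₂ → x₂ ≺ x₃ → x₃ ≺ u → Edge p u x₁ → Edge p u x₃ → Edge p x₂ y → y ≢ u →
                ¬ x₁ ≺ y
    star-left l₁₂ l₂₃ l₃u e₁ e₃ e = star-right (mirror L) l₃u l₂₃ l₁₂ e₃ e₁ e

    -- The triangle whose far end comes first has its side opposite to `u` nested under the long
    -- side of the other.
    triangles-sorted : ∀ {e u a a′ b b′} → u ≺ a → a ≺ a′ → u ≺ b → b ≺ b′ → a′ ≢ b′ →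
      Edge e u a′ → Edge e u b′ → Edge e a a′ → Edge e b b′ → ⊥
    triangles-sorted ua aa′ ub bb′ ne ea′ eb′ e f with sides ne
    ... | inj₁ lt = noNest eb′ e ua aa′ lt
    ... | inj₂ gt = noNest ea′ f ub bb′ gt

    triangles-right : ∀ {e u a a′ b b′} → u ≺ a → u ≺ a′ → u ≺ b → u ≺ b′ → a ≢ b → a ≢ b′ → a′ ≢ b → a′ ≢ b′ →
      Edge e u a → Edge e u a′ → Edge e u b → Edge e u b′ → Edge e a a′ → Edge e b b′ → ⊥
    triangles-right {a = a} {a′} {b} {b′} ua ua′ ub ub′ ab ab′ a′b a′b′ ea ea′ eb eb′ e f with compare a a′ | compare b b′
    ... | tri≈ _ refl _ | _ = ~-irrefl (proj₁ e)
    ... | tri< _ _ _ | tri≈ _ refl _ = ~-irrefl (proj₁ f)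
    ... | tri> _ _ _ | tri≈ _ refl _ = ~-irrefl (proj₁ f)
    ... | tri< p _ _ | tri< q _ _ = triangles-sorted ua p ub q a′b′ ea′ eb′ e f
    ... | tri< p _ _ | tri> _ _ q = triangles-sorted ua p ub′ q a′b ea′ eb e (Edge-sym f)
    ... | tri> _ _ p | tri< q _ _ = triangles-sorted ua′ p ub q ab′ ea eb′ (Edge-sym e) f
    ... | tri> _ _ p | tri> _ _ q = triangles-sorted ua′ p ub′ q ab ea eb (Edge-sym e) (Edge-sym f)

    triangles-astride : ∀ {e u a a′ b b′} → a ≺ u → u ≺ a′ → b ≺ u → u ≺ b′ → a ≢ b →
      Edge e u a → Edge e u b → Edge e a a′ → Edge e b b′ → ⊥
    triangles-astride au ua′ bu ub′ ne ea eb e f with sides ne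
    ... | inj₁ lt = noNest e (Edge-sym eb) lt bu ua′
    ... | inj₂ gt = noNest f (Edge-sym ea) gt au ub′

  module _ {V : Set} (L : Layout₂ V) where
    open Layout₂ L

    module _ {I : Set} {x x′ : I → V} (x-inj : ∀ {i j} → i ≢ j → x i ≢ x j) (x′-inj : ∀ {i j} → i ≢ j → x′ i ≢ x′ j)
             (x≢x′ : ∀ {i j} → x i ≢ x′ j) where

      -- Among eight triangles at u in one queue two lie alike with respect to u.
      triangles : ∀ {e u} {Φ : I → Set} → (∀ {j} → Φ j → Edge e u (x j) × Edge e u (x′ j) × Edge e (x j) (x′ j)) →
                  ¬ Big 8 Φ
      triangles {e} {u} {Φ} edges B
        with big-split {k = 4} B (λ {j} p → sides {u} {x j} (λ { refl → ~-irrefl (proj₁ (proj₁ (edges p))) }))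
      ... | inj₁ B₁ with big-split {k = 2} B₁ (λ {j} p → sides {u} {x′ j} (λ { refl → ~-irrefl (proj₁ (proj₁ (proj₂ (edges (proj₁ p))))) }))
      ...   | inj₁ B₂ = let (i , j , ne , ((pi , a) , a′) , ((pj , b) , b′)) = Big-pick₂ {k = 0} B₂
                            (ei , ei′ , f) = edges pi ; (ej , ej′ , g) = edges pj in
                triangles-right L a a′ b b′ (x-inj ne) x≢x′ (≢-sym x≢x′) (x′-inj ne) ei ei′ ej ej′ f g
      ...   | inj₂ B₂ = let (i , j , ne , ((pi , a) , a′) , ((pj , b) , b′)) = Big-pick₂ {k = 0} B₂
                            (ei , ei′ , f) = edges pi ; (ej , ej′ , g) = edges pj in
                triangles-astride L a′ a b′ b (x′-inj ne) ei′ ej′ (Edge-sym f) (Edge-sym g)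
      triangles {e} {u} {Φ} edges B | inj₂ B₁
        with big-split {k = 2} B₁ (λ {j} p → sides {u} {x′ j} (λ { refl → ~-irrefl (proj₁ (proj₁ (proj₂ (edges (proj₁ p))))) }))
      ...   | inj₁ B₂ = let (i , j , ne , ((pi , a) , a′) , ((pj , b) , b′)) = Big-pick₂ {k = 0} B₂
                            (ei , ei′ , f) = edges pi ; (ej , ej′ , g) = edges pj in
                triangles-astride L a a′ b b′ (x-inj ne) ei ej f g
      ...   | inj₂ B₂ = let (i , j , ne , ((pi , a) , a′) , ((pj , b) , b′)) = Big-pick₂ {k = 0} B₂
                            (ei , ei′ , f) = edges pi ; (ej , ej′ , g) = edges pj in
                triangles-right (mirror L) a a′ b b′ (x-inj ne) x≢x′ (≢-sym x≢x′) (x′-inj ne) ei ei′ ej ej′ f g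

    -- Of the four edges between two separated pairs the outermost nests the innermost.
    same-side : ∀ {q u v x y} → u ≢ v → x ≢ y → u ≺ x → u ≺ y → v ≺ x → v ≺ y →
      Edge q u x → Edge q u y → Edge q v x → Edge q v y → ⊥
    same-side u≢v x≢y ux uy vx vy e f g h with sides u≢v | sides x≢y
    ... | inj₁ uv | inj₁ xy = noNest f g uv vx xy
    ... | inj₁ uv | inj₂ yx = noNest e h uv vy yx
    ... | inj₂ vu | inj₁ xy = noNest h e vu ux xy
    ... | inj₂ vu | inj₂ yx = noNest g f vu uy yx

    Isolated : ℕ → V → V → V → Set
    Isolated q u v x = ∀ y → Edge q x y → y ≢ u → y ≢ v → ⊥

  module _ {V : Set} (L : Layout₂ V) where
    open Layout₂ L

    module _ {I : Set} {x : I → V} (x-inj : ∀ {i j} → i ≢ j → x i ≢ x j) {q : ℕ} where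

      private
        -- For an inner `x`, the star at `u` sends any further neighbour in the queue to `hi` or
        -- beyond, and the star at `v` sends it to `lo` or before.
        isolated : ∀ {u v k} {Φ : I → Set} → (∀ {j} → Φ j → Edge q u (x j) × Edge q v (x j)) →
                   (∀ {j} → Φ j → u ≺ x j × x j ≺ v) → Big (2 + k) Φ → Big k (λ j → Φ j × Isolated L q u v (x j))
        isolated edges order B =
          let (lo , hi , pl , ph , B′) = big-between sto x-inj B
              (ul , lv) = order pl ; (uh , hv) = order ph
              (eul , evl) = edges pl ; (euh , evh) = edges ph
          in Big-map (λ {j} (p , lj , jh) → p , λ y e y≢u y≢v →
               star-left L lj jh hv evl evh e y≢v
                 (≺-⊀ (≺-trans lj jh) (star-right L ul lj jh eul euh e y≢u))) B′

      -- A quarter of the `x` lie alike with respect to `u` and `v`. By `same-side` they lie between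
      -- these two, and then all but the two extremes are isolated.
      big-isolated : ∀ {u v k} {Φ : I → Set} → u ≢ v → (∀ {j} → Φ j → Edge q u (x j) × Edge q v (x j)) →
        Big (((2 + k) + (2 + k)) + ((2 + k) + (2 + k))) Φ →
        Big k (λ j → Φ j × (u ≺ x j × x j ≺ v) × Isolated L q u v (x j)) ⊎
        Big k (λ j → Φ j × (v ≺ x j × x j ≺ u) × Isolated L q u v (x j))
      big-isolated {u} {v} {k} u≢v edges B with big-split {k = (2 + k) + (2 + k)} B (λ {j} p → sides {u} {x j} (λ { refl → ~-irrefl (proj₁ (proj₁ (edges p))) }))
      ... | inj₁ B₁ with big-split {k = 2 + k} B₁ (λ {j} p → sides {v} {x j} (λ { refl → ~-irrefl (proj₁ (proj₂ (edges (proj₁ p)))) }))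
      ...   | inj₁ B₂ = let (i , j , ne , ((pi , a) , a′) , ((pj , b) , b′)) = Big-pick₂ {k = k} B₂ in
              ⊥-elim (same-side L u≢v (x-inj ne) a b a′ b′ (proj₁ (edges pi)) (proj₁ (edges pj)) (proj₂ (edges pi)) (proj₂ (edges pj)))
      ...   | inj₂ B₂ = inj₁ (Big-map (λ (((p , a) , b) , iso) → p , (a , b) , iso)
              (isolated (λ p → edges (proj₁ (proj₁ p))) (λ ((p , a) , b) → a , b) B₂))
      big-isolated {u} {v} {k} u≢v edges B | inj₂ B₁
        with big-split {k = 2 + k} B₁ (λ {j} p → sides {v} {x j} (λ { refl → ~-irrefl (proj₁ (proj₂ (edges (proj₁ p)))) }))
      ...   | inj₁ B₂ = inj₂ (Big-map (λ (((p , a) , b) , iso) → p , (b , a) , λ y e y≢u y≢v → iso y e y≢v y≢u)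
              (isolated (λ p → swap (edges (proj₁ (proj₁ p)))) (λ ((p , a) , b) → b , a) B₂))
      ...   | inj₂ B₂ = let (i , j , ne , ((pi , a) , a′) , ((pj , b) , b′)) = Big-pick₂ {k = k} B₂ in
              ⊥-elim (same-side (mirror L) u≢v (x-inj ne) a b a′ b′ (proj₁ (edges pi)) (proj₁ (edges pj)) (proj₂ (edges pi)) (proj₂ (edges pj)))

-- Cases in which x or x′ has different queues towards u and v

module Configurations where

  open Pigeonhole
  open TwoLocalLayouts
  open import Data.Empty using (⊥; ⊥-elim)
  open import Data.Nat using (ℕ)
  open import Data.Nat.Properties using (≤ᵇ⇒≤)
  open import Data.Product using (_×_; _,_; proj₁; proj₂; swap)
  open import Data.Sum as Sum using (inj₁; inj₂)
  open import Relation.Binary.PropositionalEquality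
  open import Relation.Nullary using (¬_)

  -- The part of the gadget that these cases use, with `y j` as one common neighbour of `x j` and
  -- `x′ j`. It is symmetric in `u` and `v`, in `x` and `x′`, and under reversal.
  record Configuration (V I : Set) : Set₁ where
    field
      L : Layout₂ V
    open Layout₂ L public
    field
      u v : V
      x x′ y : I → V
      ux  : ∀ j → u ~ x j
      vx  : ∀ j → v ~ x j
      ux′ : ∀ j → u ~ x′ j
      vx′ : ∀ j → v ~ x′ j
      xx′ : ∀ j → x j ~ x′ j
      xy  : ∀ j → x j ~ y j
      x′y : ∀ j → x′ j ~ y j
      u≢v : u ≢ v
      x-inj  : ∀ {i j} → i ≢ j → x i ≢ x j
      x′-inj : ∀ {i j} → i ≢ j → x′ i ≢ x′ j
      x≢x′ : ∀ {i j} → x i ≢ x′ j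
      y≢u : ∀ {j} → y j ≢ u
      y≢v : ∀ {j} → y j ≢ v
      y≢x : ∀ {i j} → y i ≢ x j
      y≢x′ : ∀ {i j} → y i ≢ x′ j

    u≢x : ∀ {j} → u ≢ x j
    u≢x {j} e = ~-irrefl (subst (_~ x j) e (ux j))
    v≢x : ∀ {j} → v ≢ x j
    v≢x {j} e = ~-irrefl (subst (_~ x j) e (vx j))
    u≢x′ : ∀ {j} → u ≢ x′ j
    u≢x′ {j} e = ~-irrefl (subst (_~ x′ j) e (ux′ j))
    v≢x′ : ∀ {j} → v ≢ x′ j
    v≢x′ {j} e = ~-irrefl (subst (_~ x′ j) e (vx′ j))

  module _ {V I : Set} (C : Configuration V I) where
    open Configuration C

    swap-uv : Configuration V I
    swap-uv = record
      { L = L ; u = v ; v = u ; x = x ; x′ = x′ ; y = y ; ux = vx ; vx = ux ; ux′ = vx′ ; vx′ = ux′ ; xx′ = xx′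
      ; xy = xy ; x′y = x′y ; u≢v = ≢-sym u≢v ; x-inj = x-inj ; x′-inj = x′-inj ; x≢x′ = x≢x′
      ; y≢u = y≢v ; y≢v = y≢u ; y≢x = y≢x ; y≢x′ = y≢x′ }

    swap-xx′ : Configuration V I
    swap-xx′ = record
      { L = L ; u = u ; v = v ; x = x′ ; x′ = x ; y = y ; ux = ux′ ; vx = vx′ ; ux′ = ux ; vx′ = vx ; xx′ = λ j → ~-sym (xx′ j)
      ; xy = x′y ; x′y = xy ; u≢v = u≢v ; x-inj = x′-inj ; x′-inj = x-inj ; x≢x′ = ≢-sym x≢x′
      ; y≢u = y≢u ; y≢v = y≢v ; y≢x = y≢x′ ; y≢x′ = y≢x }

    mirrored : Configuration V I
    mirrored = record
      { L = mirror L ; u = u ; v = v ; x = x ; x′ = x′ ; y = y ; ux = ux ; vx = vx ; ux′ = ux′ ; vx′ = vx′ ; xx′ = xx′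
      ; xy = xy ; x′y = x′y ; u≢v = u≢v ; x-inj = x-inj ; x′-inj = x′-inj ; x≢x′ = x≢x′
      ; y≢u = y≢u ; y≢v = y≢v ; y≢x = y≢x ; y≢x′ = y≢x′ }

  module _ {V I : Set} (C : Configuration V I) {e d c′ : ℕ} where
    open Configuration C

    -- One queue `e` holds the whole path u, x, x′, v; the other queues at `x` and `x′` are `d` and
    -- `c′`.
    Path : I → Set
    Path j = Edge e u (x j) × Edge d v (x j) × Edge c′ u (x′ j) × Edge e v (x′ j) × Edge e (x j) (x′ j)

  module _ {V I : Set} (C : Configuration V I) {e d c′ : ℕ} where
    open Configuration C

    private
      Φ : I → Set
      Φ = Path C {e} {d} {c′}

      module Extremes {lo hi lo′ hi′ : I} (pl : Φ lo) (ph : Φ hi) (pl′ : Φ lo′) (ph′ : Φ hi′) (ul : u ≺ x lo) where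

        Inner : I → Set
        Inner j = Φ j × (x lo ≺ x j × x j ≺ x hi)

        x′⊀hi : ∀ {j} → Inner j → ¬ x′ j ≺ x hi
        x′⊀hi (p , lj , jh) = star-right L ul lj jh (proj₁ pl) (proj₁ ph) (proj₂ (proj₂ (proj₂ (proj₂ p)))) (≢-sym u≢x′)

        x≺x′ : ∀ {i j} → Inner i → Inner j → x i ≺ x′ j
        x≺x′ (_ , _ , ih) q = ≺-⊀ ih (x′⊀hi q)

    -- With v left of the x′ the same argument puts every x right of every x′.
    path-right : Big 7 (λ j → Φ j × u ≺ x j × v ≺ x′ j) → ⊥
    path-right B =
      let (lo , hi , (pl , ul , _) , (ph , _) , B₁) = big-between sto x-inj B
          (lo′ , hi′ , ((pl′ , _ , vl′) , _) , ((ph′ , _) , _) , B₂) = big-between sto x′-inj B₁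
          (j , ((p , uj , vj) , lj , jh) , lj′ , jh′) = Big-pick B₂
          (_ , _ , _ , el′ , _) = pl′ ; (_ , _ , _ , eh′ , _) = ph′ ; (_ , _ , _ , _ , ej) = p
          module X = Extremes pl ph pl′ ph′ ul
          x⊀hi′ = star-right L vl′ lj′ jh′ el′ eh′ (Edge-sym ej) (≢-sym v≢x)
      in x⊀hi′ (≺-trans (X.x≺x′ (p , lj , jh) (p , lj , jh)) jh′)

    private
      -- The edges from `y j` to `x j` and `x′ j` have two possible queues each. In three of the
      -- four combinations the stars at `u` and `v` place `y j` such that one of its edges nests
      -- with the edge x x′ of index i or l; in the last one they send it to both sides at once.
      module Zigzag (e≢d : e ≢ d) (e≢c′ : e ≢ c′) {lo hi lo′ hi′ i j l : I}
        (pl : Φ lo) (ph : Φ hi) (pl′ : Φ lo′) (ph′ : Φ hi′) (ul : u ≺ x lo) (hv′ : x′ hi′ ≺ v)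
        (nl′ : x lo ≺ x lo′ × x lo′ ≺ x hi)
        (pi : Φ i) (pj : Φ j) (pk : Φ l)
        (ni : x lo ≺ x i × x i ≺ x hi) (nj : x lo ≺ x j × x j ≺ x hi) (nk : x lo ≺ x l × x l ≺ x hi)
        (ni′ : x′ lo′ ≺ x′ i × x′ i ≺ x′ hi′) (nj′ : x′ lo′ ≺ x′ j × x′ j ≺ x′ hi′) (nk′ : x′ lo′ ≺ x′ l × x′ l ≺ x′ hi′)
        (ij : x i ≺ x j) (jk : x j ≺ x l) where

        open Extremes pl ph pl′ ph′ ul

        xx : ∀ {j} → Φ j → Edge e (x j) (x′ j)
        xx (_ , _ , _ , _ , p) = p

        ij′ : x′ i ≺ x′ j
        ij′ with sides (x′-inj (λ { refl → ≺-irrefl refl ij }))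
        ... | inj₁ p = p
        ... | inj₂ p = ⊥-elim (noNest (xx pi) (xx pj) ij (x≺x′ (pj , nj) (pj , nj)) p)

        case-ee : Edge e (x j) (y j) → Edge e (x′ j) (y j) → ⊥
        case-ee a b = noNest (xx pi) a ij
          (≺-⊀ (proj₂ nj) (star-right L ul (proj₁ nj) (proj₂ nj) (proj₁ pl) (proj₁ ph) a y≢u))
          (⊀-≺ (star-left L (proj₁ nj′) (proj₂ nj′) hv′ (ev pl′) (ev ph′) b y≢v) (proj₁ ni′))
          where
          ev : ∀ {j} → Φ j → Edge e v (x′ j)
          ev (_ , _ , _ , p , _) = p

        y⊀hi′ : Edge c′ (x′ j) (y j) → ¬ y j ≺ x′ hi′
        y⊀hi′ b = star-right L u≺lo′ (proj₁ nj′) (proj₂ nj′) (cu pl′) (cu ph′) b y≢u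
          where
          cu : ∀ {j} → Φ j → Edge c′ u (x′ j)
          cu (_ , _ , p , _ , _) = p
          u≺lo′ : u ≺ x′ lo′
          u≺lo′ = ≺-trans ul (≺-trans (proj₁ nj) (x≺x′ (pj , nj) (pl′ , nl′)))

        case-ec : Edge e (x j) (y j) → Edge c′ (x′ j) (y j) → ⊥
        case-ec a b = noNest a (xx pk) jk (x≺x′ (pk , nk) (pk , nk)) (≺-⊀ (proj₂ nk′) (y⊀hi′ b))

        lo⊀y : Edge d (x j) (y j) → ¬ x lo ≺ y j
        lo⊀y a = star-left L (proj₁ nj) (proj₂ nj) hi≺v (dv pl) (dv ph) a y≢v
          where
          dv : ∀ {j} → Φ j → Edge d v (x j)
          dv (_ , p , _) = p
          hi≺v : x hi ≺ v
          hi≺v = ⊀-≺ (x′⊀hi (pj , nj)) (≺-trans (proj₂ nj′) hv′)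

        case-de : Edge d (x j) (y j) → Edge e (x′ j) (y j) → ⊥
        case-de a b = noNest (Edge-sym b) (xx pi) (⊀-≺ (lo⊀y a) (proj₁ ni)) (x≺x′ (pi , ni) (pi , ni)) ij′

        case-dc : Edge d (x j) (y j) → Edge c′ (x′ j) (y j) → ⊥
        case-dc a b = y⊀hi′ b (⊀-≺ (lo⊀y a) (≺-trans (proj₁ nj) (≺-trans (x≺x′ (pj , nj) (pj , nj)) (proj₂ nj′))))

        absurd : ⊥
        absurd
          with two-queues (Edge-sym (proj₁ pj)) (Edge-sym (proj₁ (proj₂ pj))) (xy j , refl) e≢d
             | two-queues (Edge-sym (proj₁ (proj₂ (proj₂ (proj₂ pj))))) (Edge-sym (proj₁ (proj₂ (proj₂ pj)))) (x′y j , refl) e≢c′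
        ... | inj₁ a | inj₁ b = case-ee (xy j , a) (x′y j , b)
        ... | inj₁ a | inj₂ b = case-ec (xy j , a) (x′y j , b)
        ... | inj₂ a | inj₁ b = case-de (xy j , a) (x′y j , b)
        ... | inj₂ a | inj₂ b = case-dc (xy j , a) (x′y j , b)

    -- Here u ≺ x ≺ x′ ≺ v, and the edges from y leave no room.
    path-between : e ≢ d → e ≢ c′ → Big 7 (λ j → Φ j × u ≺ x j × x′ j ≺ v) → ⊥
    path-between e≢d e≢c′ B =
      let (lo , hi , (pl , ul , _) , (ph , _) , B₁) = big-between sto x-inj B
          (lo′ , hi′ , ((pl′ , _) , nl′) , ((ph′ , _ , hv′) , _) , B₂) = big-between sto x′-inj B₁
          (i , j , l , ((((pi , _) , ni) , ni′) , (((pj , _) , nj) , nj′) , (((pk , _) , nk) , nk′)) , ij , jk) =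
            big-triple sto x-inj B₂
      in Zigzag.absurd e≢d e≢c′ pl ph pl′ ph′ ul hv′ nl′ pi pj pk ni nj nk ni′ nj′ nk′ ij jk

  module _ {V I : Set} (C : Configuration V I) {e d c′ : ℕ} (e≢d : e ≢ d) (e≢c′ : e ≢ c′) where
    open Configuration C

    -- Here 28 = 4 · 7, for the sides of `u` and `v` on which `x` and `x′` lie, and 7 = 2 + 2 + 3
    -- pays for the extremes of the `x`, those of the `x′`, and three indices more.
    path : Big 28 (Path C {e} {d} {c′}) → ⊥
    path B with big-split {k = 14} B (λ {j} _ → sides (u≢x {j}))
    ... | inj₁ B₁ with big-split {k = 7} B₁ (λ {j} _ → sides (v≢x′ {j}))
    ...   | inj₁ B₂ = path-right C (Big-map (λ ((p , a) , b) → p , a , b) B₂)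
    ...   | inj₂ B₂ = path-between C e≢d e≢c′ (Big-map (λ ((p , a) , b) → p , a , b) B₂)
    path B | inj₂ B₁ with big-split {k = 7} B₁ (λ {j} _ → sides (v≢x′ {j}))
    ...   | inj₁ B₂ = path-between (mirrored C) e≢d e≢c′ (Big-map (λ ((p , a) , b) → p , a , b) B₂)
    ...   | inj₂ B₂ = path-right (mirrored C) (Big-map (λ ((p , a) , b) → p , a , b) B₂)

  module _ {V I : Set} (C : Configuration V I) {q e d : ℕ} where
    open Configuration C

    -- Now `x` has one queue `q` towards `u` and `v`, while `x′` has two. Since `q` is exhausted at
    -- `x`, the edge from `x` to `y` is forced into the queue of x x′.
    Fan : I → Set
    Fan j = (Edge q u (x j) × Isolated L q u v (x j)) × (u ≺ x j × x j ≺ v) ×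
            Edge e u (x′ j) × Edge d v (x′ j) × Edge e (x j) (x′ j)

  module _ {V I : Set} (C : Configuration V I) {q e d : ℕ} (q≢e : q ≢ e) (e≢d : e ≢ d) where
    open Configuration C

    private
      Φ : I → Set
      Φ = Fan C {q} {e} {d}

    -- The star at `u` leaves an inner `x′` no neighbour in `e` to the right of `lo` except `u`, but
    -- `x` is to the right of `u`.
    fan-left : Big 5 (λ j → Φ j × x′ j ≺ u) → ⊥
    fan-left B =
      let (lo , hi , ((_ , _ , el , _) , lu) , ((_ , _ , eh , _) , hu) , B₁) = big-between sto x′-inj B
          (j , ((_ , (uj , _) , _ , _ , ej) , _) , lj , jh) = Big-pick B₁
      in star-left L lj jh hu el eh (Edge-sym ej) (≢-sym u≢x) (≺-trans lu uj)

    private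
      -- All inner `x′` precede the corresponding `x`, and both come in the same order. Wherever
      -- `y j` lies, one of its edges then nests with the edge x x′ of index i or l.
      module Right {lo hi i j l : I} (pl : Φ lo) (ph : Φ hi) (pi : Φ i) (pj : Φ j) (pk : Φ l)
                   (ul : u ≺ x′ lo) (ni : x′ lo ≺ x′ i × x′ i ≺ x′ hi) (nj : x′ lo ≺ x′ j × x′ j ≺ x′ hi)
                   (nk : x′ lo ≺ x′ l × x′ l ≺ x′ hi) (ij : x i ≺ x j) (jk : x j ≺ x l) where

        eu : ∀ {j} → Φ j → Edge e u (x′ j)
        eu (_ , _ , p , _) = p
        dv : ∀ {j} → Φ j → Edge d v (x′ j)
        dv (_ , _ , _ , p , _) = p
        xx : ∀ {j} → Φ j → Edge e (x′ j) (x j)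
        xx (_ , _ , _ , _ , p) = Edge-sym p

        x⊀hi : ∀ {j} → Φ j → x′ lo ≺ x′ j × x′ j ≺ x′ hi → ¬ x j ≺ x′ hi
        x⊀hi p (a , b) = star-right L ul a b (eu pl) (eu ph) (xx p) (≢-sym u≢x)

        x′≺x : ∀ {a b} → Φ b → x′ lo ≺ x′ b × x′ b ≺ x′ hi → x′ a ≺ x′ hi → x′ a ≺ x b
        x′≺x p n ah = ≺-⊀ ah (x⊀hi p n)

        increasing : ∀ {a b} → Φ a → Φ b → x′ lo ≺ x′ a × x′ a ≺ x′ hi → x a ≺ x b → x′ a ≺ x′ b
        increasing pa pb na ab with sides (x′-inj (λ { refl → ≺-irrefl refl ab }))
        ... | inj₁ p = p
        ... | inj₂ p = ⊥-elim (noNest (xx pb) (xx pa) p (x′≺x pa na (proj₂ na)) ab)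

        case-e : Edge e (x j) (y j) → Edge e (x′ j) (y j) → ⊥
        case-e a b with sides (y≢x {j} {j})
        ... | inj₁ y≺x = noNest (xx pk) (Edge-sym a)
                (≺-⊀ (proj₂ nk) (star-right L ul (proj₁ nj) (proj₂ nj) (eu pl) (eu ph) b y≢u)) y≺x jk
        ... | inj₂ x≺y with sides (y≢x {j} {l})
        ...   | inj₁ y≺xₖ = noNest (xx pk) a (x′≺x pj nj (proj₂ nk)) x≺y y≺xₖ
        ...   | inj₂ xₖ≺y = noNest b (xx pk) (increasing pj pk nj jk) (x′≺x pk nk (proj₂ nk)) xₖ≺y

        case-d : Edge e (x j) (y j) → Edge d (x′ j) (y j) → ⊥
        case-d a b = noNest (Edge-sym a) (xx pi) (⊀-≺ lo⊀y (proj₁ ni)) (x′≺x pi ni (proj₂ ni)) ij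
          where
          hi≺v : x′ hi ≺ v
          hi≺v = ⊀-≺ (x⊀hi pj nj) (proj₂ (proj₁ (proj₂ pj)))
          lo⊀y : ¬ x′ lo ≺ y j
          lo⊀y = star-left L (proj₁ nj) (proj₂ nj) hi≺v (dv pl) (dv ph) b y≢v

        absurd : ⊥
        absurd with two-queues (Edge-sym (proj₁ (proj₁ pj))) (Edge-sym (xx pj)) (xy j , refl) q≢e
                  | two-queues (Edge-sym (eu pj)) (Edge-sym (dv pj)) (x′y j , refl) e≢d
        ... | inj₁ a | _ = proj₂ (proj₁ pj) (y j) (xy j , a) y≢u y≢v
        ... | inj₂ a | inj₁ b = case-e (xy j , a) (x′y j , b)
        ... | inj₂ a | inj₂ b = case-d (xy j , a) (x′y j , b)

    fan-right : Big 5 (λ j → Φ j × u ≺ x′ j) → ⊥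
    fan-right B =
      let (lo , hi , (pl , ul) , (ph , _) , B₁) = big-between sto x′-inj B
          (i , j , l , (((pi , _) , ni) , ((pj , _) , nj) , ((pk , _) , nk)) , ij , jk) = big-triple sto x-inj B₁
      in Right.absurd pl ph pi pj pk ul ni nj nk ij jk

    fan : Big 10 Φ → ⊥
    fan B with big-split {k = 5} B (λ {j} _ → sides (u≢x′ {j}))
    ... | inj₁ B₁ = fan-right B₁
    ... | inj₂ B₁ = fan-left B₁

  module _ {V I : Set} (C : Configuration V I) {q c d : ℕ} (c≢d : c ≢ d) where
    open Configuration C

    private
      Mixed : I → Set
      Mixed j = (Edge q u (x j) × Edge q v (x j)) × (Edge c u (x′ j) × Edge d v (x′ j))

    -- The edge x x′ is in one of the two queues of `x′`. Reversal together with the exchange of `u`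
    -- and `v` reduces the second queue to the first, and each needs the 10 indices of `fan`.
    oriented-mixed : Big 20 (λ j → Mixed j × (u ≺ x j × x j ≺ v) × Isolated L q u v (x j)) → ⊥
    oriented-mixed B with big-split {k = 10} B (λ {j} (((_ , _) , e , f) , _) →
                          two-queues (Edge-sym e) (Edge-sym f) (Edge-sym (xx′ j , refl)) c≢d)
    ... | inj₁ B₁ = fan C q≢c c≢d (Big-map (λ {j} ((((eu , ev) , fu , fv) , order , iso) , p) →
            (eu , iso) , order , fu , fv , (xx′ j , p)) B₁)
      where
      q≢c : q ≢ c
      q≢c refl = let (j , (_ , _ , iso) , p) = Big-pick B₁ in iso _ (xx′ j , p) (≢-sym u≢x′) (≢-sym v≢x′)
    ... | inj₂ B₁ = fan (mirrored (swap-uv C)) q≢d (≢-sym c≢d) (Big-map (λ {j} ((((eu , ev) , fu , fv) , order , iso) , p) →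
            (ev , λ y e y≢v y≢u → iso y e y≢u y≢v) , swap order , fv , fu , (xx′ j , p)) B₁)
      where
      q≢d : q ≢ d
      q≢d refl = let (j , (_ , _ , iso) , p) = Big-pick B₁ in iso _ (xx′ j , p) (≢-sym u≢x′) (≢-sym v≢x′)

  module _ {V I : Set} (C : Configuration V I) {q c d : ℕ} (c≢d : c ≢ d) where
    open Configuration C

    -- The number is 4 · (2 + 20), as required by `big-isolated`.
    mixed : Big 88 (λ j → (Edge q u (x j) × Edge q v (x j)) × (Edge c u (x′ j) × Edge d v (x′ j))) → ⊥
    mixed B with big-isolated L x-inj {k = 20} u≢v proj₁ B
    ... | inj₁ B₁ = oriented-mixed C c≢d B₁
    ... | inj₂ B₁ = oriented-mixed (swap-uv C) (≢-sym c≢d) (Big-map (λ ((e , f) , order , iso) →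
            (swap e , swap f) , order , λ y e y≢v y≢u → iso y e y≢u y≢v) B₁)

  module _ {V I : Set} (C : Configuration V I) {c d c′ d′ : ℕ} (c≢d : c ≢ d) (c′≢d′ : c′ ≢ d′) where
    open Configuration C

    -- The queue of x x′ is one of c, d and one of c′, d′. If both belong to the same one of `u` and
    -- `v`, there are triangles in one queue there; otherwise there is a path. Four cases with 28
    -- indices each make 112.
    unmixed : Big 112 (λ j → (Edge c u (x j) × Edge d v (x j)) × (Edge c′ u (x′ j) × Edge d′ v (x′ j))) → ⊥
    unmixed B with big-split {k = 56} B (λ {j} ((e , f) , _) → two-queues (Edge-sym e) (Edge-sym f) (xx′ j , refl) c≢d)
    ... | inj₁ B₁ with big-split {k = 28} B₁ (λ {j} ((_ , e , f) , _) →
                          two-queues (Edge-sym e) (Edge-sym f) (Edge-sym (xx′ j , refl)) c′≢d′)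
    ...   | inj₁ B₂ = triangles L x-inj x′-inj x≢x′
              (λ {j} ((((eu , _) , (eu′ , _)) , p) , p′) → eu , subst (λ q → Edge q u (x′ j)) (trans (sym p′) p) eu′ , (xx′ j , p))
              (Big-≤ {k = 28} {8} (≤ᵇ⇒≤ 8 28 _) B₂)
    ...   | inj₂ B₂ = path C c≢d (λ e → c′≢d′ (trans (sym e) c≡d′)) (Big-map (λ {j} ((((eu , ev) , (eu′ , ev′)) , p) , p′) →
              eu , ev , eu′ , subst (λ q → Edge q v (x′ j)) (trans (sym p′) p) ev′ , (xx′ j , p)) B₂)
      where
      c≡d′ : c ≡ d′
      c≡d′ = let (j , (_ , p) , p′) = Big-pick B₂ in trans (sym p) p′
    unmixed B | inj₂ B₁ with big-split {k = 28} B₁ (λ {j} ((_ , e , f) , _) →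
                          two-queues (Edge-sym e) (Edge-sym f) (Edge-sym (xx′ j , refl)) c′≢d′)
    ...   | inj₁ B₂ = path (swap-uv C) (≢-sym c≢d) (λ e → c′≢d′ (trans (sym d≡c′) e)) (Big-map (λ {j} ((((eu , ev) , (eu′ , ev′)) , p) , p′) →
              ev , eu , ev′ , subst (λ q → Edge q u (x′ j)) (trans (sym p′) p) eu′ , (xx′ j , p)) B₂)
      where
      d≡c′ : d ≡ c′
      d≡c′ = let (j , (_ , p) , p′) = Big-pick B₂ in trans (sym p) p′
    ...   | inj₂ B₂ = triangles L x-inj x′-inj x≢x′
              (λ {j} ((((_ , ev) , (_ , ev′)) , p) , p′) → ev , subst (λ q → Edge q v (x′ j)) (trans (sym p′) p) ev′ , (xx′ j , p))
              (Big-≤ {k = 28} {8} (≤ᵇ⇒≤ 8 28 _) B₂)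

-- No 2-local layout of the gadget

module LowerBound where

  open Pigeonhole
  open TwoLocalLayouts
  open Configurations
  open import Data.Empty using (⊥; ⊥-elim)
  open import Data.Fin using (Fin; zero)
  open import Data.List using (allFin)
  open import Data.List.Properties using (length-tabulate)
  open import Data.List.Relation.Unary.All as All using (All)
  open import Data.List.Relation.Unary.Unique.Propositional.Properties using (allFin⁺)
  open import Data.Nat using (ℕ; _+_; _≟_)
  open import Data.Nat.Properties using (≤ᵇ⇒≤; ≤-reflexive)
  open import Data.Product using (_×_; _,_; proj₁; proj₂; swap)
  open import Data.Sum as Sum using (inj₁; inj₂)
  open import Data.Unit using (⊤; tt)
  open import Level using (0ℓ)
  open import Relation.Binary using (Rel)
  open import Relation.Binary.PropositionalEquality
  open import Relation.Nullary using (Dec; yes; no)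

  -- The numbers of vertices that the pigeonhole arguments need. They are opaque
  -- so that no graph of this size is ever evaluated.
  opaque
    #x #t #s : ℕ
    #x = 1792
    #t = 12
    #s = 16

    t₀ : Fin #t
    t₀ = zero

    s₀ : Fin #s
    s₀ = zero

    all-big : ∀ n → Big {Fin n} n (λ _ → ⊤)
    all-big n = allFin n , allFin⁺ n , ≤-reflexive (sym (length-tabulate (λ j → j))) , All.universal (λ _ → tt) _

    many-x : Big {Fin #x} 1792 (λ _ → ⊤)
    many-x = all-big 1792

    many-t : Big {Fin #t} 12 (λ _ → ⊤)
    many-t = all-big 12

    many-s : Big {Fin #s} 16 (λ _ → ⊤)
    many-s = all-big 16

  record Gadget {V : Set} (_~_ : Rel V 0ℓ) : Set where
    field
      u v : V
      x x′ : Fin #x → V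
      t    : Fin #x → Fin #t → V
      s s′ : Fin #x → Fin #t → Fin #s → V
      ux  : ∀ j → u ~ x j
      vx  : ∀ j → v ~ x j
      ux′ : ∀ j → u ~ x′ j
      vx′ : ∀ j → v ~ x′ j
      xx′ : ∀ j → x j ~ x′ j
      xt  : ∀ j i → x j ~ t j i
      x′t : ∀ j i → x′ j ~ t j i
      xs  : ∀ j i k → x j ~ s j i k
      xs′ : ∀ j i k → x j ~ s′ j i k
      ts  : ∀ j i k → t j i ~ s j i k
      ts′ : ∀ j i k → t j i ~ s′ j i k
      ss′ : ∀ j i k → s j i k ~ s′ j i k
      u≢v : u ≢ v
      x-inj  : ∀ {i j} → i ≢ j → x i ≢ x j
      x′-inj : ∀ {i j} → i ≢ j → x′ i ≢ x′ j
      x≢x′ : ∀ {i j} → x i ≢ x′ j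
      t≢u : ∀ {j i} → t j i ≢ u
      t≢v : ∀ {j i} → t j i ≢ v
      t≢x : ∀ {j i k} → t j i ≢ x k
      t≢x′ : ∀ {j i k} → t j i ≢ x′ k
      t-inj : ∀ {j i k} → i ≢ k → t j i ≢ t j k
      s≢u : ∀ {j i k} → s j i k ≢ u
      s≢v : ∀ {j i k} → s j i k ≢ v
      s≢x : ∀ {j i k} → s j i k ≢ x j
      s≢x′ : ∀ {j i k} → s j i k ≢ x′ j
      s′≢u : ∀ {j i k} → s′ j i k ≢ u
      s′≢v : ∀ {j i k} → s′ j i k ≢ v
      s′≢x : ∀ {j i k} → s′ j i k ≢ x j
      s′≢x′ : ∀ {j i k} → s′ j i k ≢ x′ j
      s-inj  : ∀ {j i k l} → k ≢ l → s j i k ≢ s j i l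
      s′-inj : ∀ {j i k l} → k ≢ l → s′ j i k ≢ s′ j i l
      s≢s′ : ∀ {j i k l} → s j i k ≢ s′ j i l

  module _ {V : Set} (L : Layout₂ V) (G : Gadget (Layout₂._~_ L)) where
    open Layout₂ L
    open Gadget G

    private
      C : Configuration V (Fin #x)
      C = record
        { L = L ; u = u ; v = v ; x = x ; x′ = x′ ; y = λ j → t j t₀ ; ux = ux ; vx = vx ; ux′ = ux′ ; vx′ = vx′ ; xx′ = xx′
        ; xy = λ j → xt j t₀ ; x′y = λ j → x′t j t₀ ; u≢v = u≢v ; x-inj = x-inj ; x′-inj = x′-inj ; x≢x′ = x≢x′
        ; y≢u = t≢u ; y≢v = t≢v ; y≢x = t≢x ; y≢x′ = t≢x′ }

      -- All edges at x and x′ that avoid u and v are in the queue of x x′. Among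
      -- the t joined to both, one has no further edge in this queue.
      module Both (j : Fin #x) {q q′ : ℕ} (uq : Edge q u (x j)) (iso : Isolated L q u v (x j))
                  (uq′ : Edge q′ u (x′ j)) (iso′ : Isolated L q′ u v (x′ j)) where

        e : ℕ
        e = queue (x j) (x′ j)

        ≢x : ∀ {w y} → w ~ y → y ≢ w
        ≢x e refl = ~-irrefl e

        q≢e : q ≢ e
        q≢e p = iso (x′ j) (xx′ j , sym p) (≢x (ux′ j)) (≢x (vx′ j))

        q′≢e : q′ ≢ e
        q′≢e p = iso′ (x j) (Edge-sym (xx′ j , sym p)) (≢x (ux j)) (≢x (vx j))

        at-x : ∀ {y} → x j ~ y → y ≢ u → y ≢ v → Edge e (x j) y
        at-x f y≢u y≢v with two-queues (Edge-sym uq) (xx′ j , refl) (f , refl) q≢e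
        ... | inj₁ p = ⊥-elim (iso _ (f , p) y≢u y≢v)
        ... | inj₂ p = f , p

        at-x′ : ∀ {y} → x′ j ~ y → y ≢ u → y ≢ v → Edge e (x′ j) y
        at-x′ f y≢u y≢v with two-queues (Edge-sym uq′) (Edge-sym (xx′ j , refl)) (f , refl) q′≢e
        ... | inj₁ p = ⊥-elim (iso′ _ (f , p) y≢u y≢v)
        ... | inj₂ p = f , p

        -- Both queues at `t` are known: `e` has only its edges to `x` and `x′`, and `f` has all
        -- others. So the `s` and `s′` are joined to `x` in `e` and to `t` in `f`, and each edge s
        -- s′ closes a triangle in `e` at `x` or in `f` at `t`. This needs 16 = 2 · 8 pairs.
        module At (i : Fin #t) (iso-t : Isolated L e (x j) (x′ j) (t j i)) where

          f : ℕ
          f = queue (t j i) (s j i s₀)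

          f≢e : f ≢ e
          f≢e p = iso-t _ (ts j i s₀ , p) s≢x s≢x′

          at-t : ∀ {y} → t j i ~ y → y ≢ x j → y ≢ x′ j → Edge f (t j i) y
          at-t g y≢x y≢x′ with two-queues (Edge-sym (at-x (xt j i) t≢u t≢v)) (ts j i s₀ , refl) (g , refl) (≢-sym f≢e)
          ... | inj₁ p = ⊥-elim (iso-t _ (g , p) y≢x y≢x′)
          ... | inj₂ p = g , p

          xs-e : ∀ k → Edge e (x j) (s j i k)
          xs-e k = at-x (xs j i k) s≢u s≢v

          ts-f : ∀ k → Edge f (t j i) (s j i k)
          ts-f k = at-t (ts j i k) s≢x s≢x′

          absurd : ⊥
          absurd with big-split {k = 8} many-s (λ {k} _ →
            two-queues (Edge-sym (xs-e k)) (Edge-sym (ts-f k)) (ss′ j i k , refl) (≢-sym f≢e))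
          ... | inj₁ B = triangles L s-inj s′-inj s≢s′
                (λ {k} (_ , p) → xs-e k , at-x (xs′ j i k) s′≢u s′≢v , (ss′ j i k , p)) B
          ... | inj₂ B = triangles L s-inj s′-inj s≢s′
                (λ {k} (_ , p) → ts-f k , at-t (ts′ j i k) s′≢x s′≢x′ , (ss′ j i k , p)) B

        absurd : ⊥
        -- A single isolated `t` suffices, and 12 = 4 · (2 + 1).
        absurd with big-isolated L t-inj {k = 1} x≢x′
          (λ {i} _ → at-x (xt j i) t≢u t≢v , at-x′ (x′t j i) t≢u t≢v) many-t
        ... | inj₁ B = let (i , _ , _ , iso-t) = Big-pick B in At.absurd i iso-t
        ... | inj₂ B = let (i , _ , _ , iso-t) = Big-pick B in At.absurd i iso-t

      isolated-both : ∀ {k} {x : Fin #x → V} (x-inj : ∀ {i j} → i ≢ j → x i ≢ x j) {q} {Φ : Fin #x → Set} →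
        (∀ {j} → Φ j → Edge q u (x j) × Edge q v (x j)) →
        Big (((2 + k) + (2 + k)) + ((2 + k) + (2 + k))) Φ → Big k (λ j → Φ j × Isolated L q u v (x j))
      isolated-both x-inj edges B with big-isolated L x-inj u≢v edges B
      ... | inj₁ B₁ = Big-map (λ (p , _ , iso) → p , iso) B₁
      ... | inj₂ B₁ = Big-map (λ (p , _ , iso) → p , iso) B₁

      -- Isolation is arranged first for `x` and then for `x′` among the remaining indices: 4 · (2 +
      -- 1) = 12 are needed for the second, hence 4 · (2 + 12) = 56 for the first.
      not-both : ∀ {q q′} →
        Big 112 (λ j → (Edge q u (x j) × Edge q v (x j)) × (Edge q′ u (x′ j) × Edge q′ v (x′ j))) → ⊥
      not-both B =
        let B₁ = isolated-both {12} x-inj proj₁ (Big-≤ (≤ᵇ⇒≤ 56 112 _) B)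
            B₂ = isolated-both {1} x′-inj (λ p → proj₂ (proj₁ p)) B₁
            (j , (((e , _) , (e′ , _)) , iso) , iso′) = Big-pick B₂
        in Both.absurd j e iso e′ iso′

      by-queues : ∀ {c d c′ d′} →
        Big 112 (λ j → (Edge c u (x j) × Edge d v (x j)) × (Edge c′ u (x′ j) × Edge d′ v (x′ j))) →
        Dec (c ≡ d) → Dec (c′ ≡ d′) → ⊥
      by-queues B (yes refl) (yes refl) = not-both B
      by-queues B (yes refl) (no c′≢d′) = mixed C c′≢d′ (Big-≤ (≤ᵇ⇒≤ 88 112 _) B)
      by-queues B (no c≢d) (yes refl) = mixed (swap-xx′ C) c≢d (Big-map swap (Big-≤ (≤ᵇ⇒≤ 88 112 _) B))
      by-queues B (no c≢d) (no c′≢d′) = unmixed C c≢d c′≢d′ B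

    -- Fixing the queues of the four edges from `u` and `v` to a pair halves the number of pairs
    -- four times, from 1792 to 112. This is the demand of `unmixed`, the largest of the cases.
    no-2-local-layout : ⊥
    no-2-local-layout =
      let (c , B₁) = big-label {k = 896} (λ j → queue u (x j)) many-x (λ {i} {j} {l} _ _ _ → two (ux i) (ux j) (ux l))
          (d , B₂) = big-label {k = 448} (λ j → queue v (x j)) B₁ (λ {i} {j} {l} _ _ _ → two (vx i) (vx j) (vx l))
          (c′ , B₃) = big-label {k = 224} (λ j → queue u (x′ j)) B₂ (λ {i} {j} {l} _ _ _ → two (ux′ i) (ux′ j) (ux′ l))
          (d′ , B₄) = big-label {k = 112} (λ j → queue v (x′ j)) B₃ (λ {i} {j} {l} _ _ _ → two (vx′ i) (vx′ j) (vx′ l))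
      in by-queues (Big-map (λ {j} ((((_ , p) , q) , p′) , q′) → ((ux j , p) , (vx j , q)) , ((ux′ j , p′) , (vx′ j , q′))) B₄)
           (c ≟ d) (c′ ≟ d′)

-- Tents over intervals of a line

module Tents where

  open import Defs
  open Rationals
  open Segments using (minus-plus; neg-pos; +-incʳ-≤; diff-pos)
  open import Data.Bool using (Bool; true; false)
  open import Data.Empty using (⊥; ⊥-elim)
  open import Data.Integer as ℤ using () renaming (+_ to pos)
  import Data.Integer.Properties as ℤ
  open import Data.List using ([_])
  open import Data.Nat as ℕ using (ℕ)
  import Data.Nat.Properties as ℕ
  open import Data.Rational as ℚ using (ℚ; 0ℚ; 1ℚ; _<_; _≤_)
  open import Data.Rational.Properties using (<-irrefl; <-cmp; <⇒≤; ≤-reflexive; ≤-refl; ≤-trans; ≤-antisym; <-≤-trans; ≮⇒≥)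
  open import Data.Product using (_×_; _,_; proj₁; proj₂; ∃-syntax)
  open import Data.Sum using (_⊎_; inj₁; inj₂; swap)
  open import Relation.Binary using (tri<; tri≈; tri>)
  open import Relation.Binary.PropositionalEquality hiding ([_])

  fromℕ : ℕ → ℚ
  fromℕ n = fromℤ (pos n)

  fromℕ-mono : ∀ {m n} → m ℕ.< n → fromℕ m < fromℕ n
  fromℕ-mono {m} {n} lt = ℚ.*<* (subst₂ ℤ._<_ (sym (ℤ.*-identityʳ (pos m))) (sym (ℤ.*-identityʳ (pos n))) (ℤ.+<+ lt))

  signed : Bool → ℚ → ℚ
  signed true y = y
  signed false y = - y

  neg-neg : ∀ x → - (- x) ≡ x
  neg-neg = solve 1 (λ x → :- (:- x) := x) refl

  signed-involutive : ∀ b y → signed b (signed b y) ≡ y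
  signed-involutive true y = refl
  signed-involutive false y = neg-neg y

  -- P lies on the tent with feet at 2a and 2b on the axis and with its peak at
  -- (a + b , ± (b - a)²), so that wider tents are steeper.
  record Tent (up : Bool) (a b : ℚ) (P : Point) : Set where
    field
      level   : ℚ
      level≥0 : 0ℚ ≤ level
      level≤1 : level ≤ 1ℚ
      height  : signed up (proj₂ P) ≡ level * ((b - a) * (b - a))
      width   : proj₁ P ≡ (a + a) + level * (b - a) ⊎ proj₁ P ≡ (b + b) + level * (a - b)

  Tent-swap : ∀ {up a b P} → Tent up a b P → Tent up b a P
  Tent-swap {a = a} {b} T = record
    { level = level ; level≥0 = level≥0 ; level≤1 = level≤1
    ; height = trans height (solve 3 (λ s a b → s :* ((b :- a) :* (b :- a)) := s :* ((a :- b) :* (a :- b))) refl level a b)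
    ; width = swap width }
    where open Tent T

  peak : Bool → ℚ → ℚ → Point
  peak up a b = a + b , signed up ((b - a) * (b - a))

  -- Doubling makes a + b the midpoint of two feet without a division.
  base : ℚ → Point
  base a = a + a , 0ℚ

  signed-0 : ∀ b → signed b 0ℚ ≡ 0ℚ
  signed-0 true = refl
  signed-0 false = solve 0 (:- con (pos 0) := con (pos 0)) refl

  slope-tent : ∀ up {a b P} → OnSegment (base a) (peak up a b) P →
    ∃[ s ] 0ℚ ≤ s × s ≤ 1ℚ × signed up (proj₂ P) ≡ s * ((b - a) * (b - a)) × proj₁ P ≡ (a + a) + s * (b - a)
  slope-tent up {a} {b} {P} (t , 0≤t , t≤1 , e) = t , 0≤t , t≤1 , height up e′ , width
    where
    e′ : P ≡ ((1ℚ - t) * (a + a) + t * (a + b) , (1ℚ - t) * 0ℚ + t * signed up ((b - a) * (b - a)))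
    e′ = trans e (along-def t _ _ _ _)
    width : proj₁ P ≡ (a + a) + t * (b - a)
    width = trans (cong proj₁ e′) (solve 3 (λ t a b → (con (pos 1) :- t) :* (a :+ a) :+ t :* (a :+ b) := (a :+ a) :+ t :* (b :- a)) refl t a b)
    height : ∀ up → P ≡ ((1ℚ - t) * (a + a) + t * (a + b) , (1ℚ - t) * 0ℚ + t * signed up ((b - a) * (b - a))) →
             signed up (proj₂ P) ≡ t * ((b - a) * (b - a))
    height true e = trans (cong proj₂ e) (solve 3 (λ t a b → (con (pos 1) :- t) :* con (pos 0) :+ t :* ((b :- a) :* (b :- a))
      := t :* ((b :- a) :* (b :- a))) refl t a b)
    height false e = trans (cong (λ P → - proj₂ P) e) (solve 3 (λ t a b → :- ((con (pos 1) :- t) :* con (pos 0) :+ t :* :- ((b :- a) :* (b :- a)))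
      := t :* ((b :- a) :* (b :- a))) refl t a b)

  slope-Tent : ∀ up {a b P} → OnSegment (base a) (peak up a b) P → Tent up a b P
  slope-Tent up on = let (s , 0≤s , s≤1 , h , w) = slope-tent up on in
    record { level = s ; level≥0 = 0≤s ; level≤1 = s≤1 ; height = h ; width = inj₁ w }

  peak-sym : ∀ up a b → peak up a b ≡ peak up b a
  peak-sym up a b = cong₂ _,_ (+-comm a b)
    (cong (signed up) (solve 2 (λ a b → (b :- a) :* (b :- a) := (a :- b) :* (a :- b)) refl a b))

  *-cancel-0 : ∀ {x k} → 0ℚ < k → x * k ≡ 0ℚ → x ≡ 0ℚ
  *-cancel-0 {x} {k} k>0 e = let (i , _ , ki) = inverse k>0 in begin
    x             ≡⟨ *-identityʳ x ⟨
    x * 1ℚ        ≡⟨ cong (x *_) ki ⟨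
    x * (k * i)   ≡⟨ *-assoc x k i ⟨
    x * k * i     ≡⟨ cong (_* i) e ⟩
    0ℚ * i        ≡⟨ zeroˡ i ⟩
    0ℚ            ∎
    where open ≡-Reasoning

  square-pos : ∀ {a b} → a ≢ b → 0ℚ < (b - a) * (b - a)
  square-pos {a} {b} ne with <-cmp a b
  ... | tri< lt _ _ = *-pos (diff-pos lt) (diff-pos lt)
  ... | tri≈ _ e _ = ⊥-elim (ne e)
  ... | tri> _ _ gt = subst (0ℚ <_) (solve 2 (λ a b → (a :- b) :* (a :- b) := (b :- a) :* (b :- a)) refl a b)
                        (*-pos (diff-pos gt) (diff-pos gt))

  IsEnd : ℚ → ℚ → Point → Set
  IsEnd a b P = P ≡ base a ⊎ P ≡ base b

  signed-≡0 : ∀ up {y} → signed up y ≡ 0ℚ → y ≡ 0ℚ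
  signed-≡0 up {y} e = trans (sym (signed-involutive up y)) (trans (cong (signed up) e) (signed-0 up))

  ground : ∀ {up a b P} → a ≢ b → Tent up a b P → proj₂ P ≡ 0ℚ → IsEnd a b P
  ground {up} {a} {b} {P} a≢b T y≡0 = ends width
    where
    open Tent T
    s≡0 : level ≡ 0ℚ
    s≡0 = *-cancel-0 (square-pos a≢b) (trans (sym height) (trans (cong (signed up) y≡0) (signed-0 up)))
    at : ∀ {c d} → proj₁ P ≡ (c + c) + level * d → proj₁ P ≡ c + c
    at {c} {d} e = trans e (trans (cong (λ s → (c + c) + s * d) s≡0)
      (solve 2 (λ c d → (c :+ c) :+ con (pos 0) :* d := c :+ c) refl c d))
    ends : proj₁ P ≡ (a + a) + level * (b - a) ⊎ proj₁ P ≡ (b + b) + level * (a - b) → IsEnd a b P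
    ends (inj₁ e) = inj₁ (cong₂ _,_ (at e) y≡0)
    ends (inj₂ e) = inj₂ (cong₂ _,_ (at e) y≡0)

  *-nonNeg : ∀ {p q} → 0ℚ ≤ p → 0ℚ ≤ q → 0ℚ ≤ p * q
  *-nonNeg {p} {q} 0≤p 0≤q = subst (_≤ p * q) (zeroˡ q) (*-mono-≤ 0≤q 0≤p)

  diff-nonNeg : ∀ {x y} → x ≤ y → 0ℚ ≤ y - x
  diff-nonNeg {x} {y} x≤y = subst (_≤ y - x) (+-inverseʳ x) (+-mono-≤ x≤y (≤-refl { - x}))

  diff-nonNeg⁻¹ : ∀ {x y} → 0ℚ ≤ y - x → x ≤ y
  diff-nonNeg⁻¹ {x} {y} p = subst (x ≤_) (trans (+-comm x (y - x)) (sym (minus-plus y x))) (+-incʳ-≤ x p)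

  -- On a tent the height is the minimum of two linear functions of slopes D and -D: both
  -- inequalities hold, and one of them is an equality.
  module Bounds {up : Bool} {a b : ℚ} {P : Point} (a<b : a < b) (T : Tent up a b P) where
    open Tent T
    D X Y : ℚ
    D = b - a
    X = proj₁ P
    Y = signed up (proj₂ P)

    D>0 : 0ℚ < D
    D>0 = diff-pos a<b

    Y≥0 : 0ℚ ≤ Y
    Y≥0 = subst (0ℚ ≤_) (sym height) (*-nonNeg level≥0 (<⇒≤ (*-pos D>0 D>0)))

    private
      rest≥0 : 0ℚ ≤ ((1ℚ - level) + (1ℚ - level)) * (D * D)
      rest≥0 = *-nonNeg (subst (_≤ (1ℚ - level) + (1ℚ - level)) (+-identityˡ 0ℚ) (+-mono-≤ s≥0 s≥0)) (<⇒≤ (*-pos D>0 D>0))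
        where s≥0 = diff-nonNeg level≤1

    on : Y ≡ D * (X - (a + a)) ⊎ Y ≡ D * ((b + b) - X)
    on = go width
      where
      go : X ≡ (a + a) + level * (b - a) ⊎ X ≡ (b + b) + level * (a - b) → Y ≡ D * (X - (a + a)) ⊎ Y ≡ D * ((b + b) - X)
      go (inj₁ e) = inj₁ (trans height (trans (solve 3 (λ s a b → s :* ((b :- a) :* (b :- a))
        := (b :- a) :* (((a :+ a) :+ s :* (b :- a)) :- (a :+ a))) refl level a b) (cong (λ X → D * (X - (a + a))) (sym e))))
      go (inj₂ e) = inj₂ (trans height (trans (solve 3 (λ s a b → s :* ((b :- a) :* (b :- a))
        := (b :- a) :* ((b :+ b) :- ((b :+ b) :+ s :* (a :- b)))) refl level a b) (cong (λ X → D * ((b + b) - X)) (sym e))))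

    private
      other : ∀ {Z} → Z ≡ level * (D * D) + ((1ℚ - level) + (1ℚ - level)) * (D * D) → Y ≤ Z
      other e = subst₂ _≤_ (sym height) (sym e) (+-incʳ-≤ _ rest≥0)

    left : Y ≤ D * (X - (a + a))
    left = go width
      where
      go : X ≡ (a + a) + level * (b - a) ⊎ X ≡ (b + b) + level * (a - b) → Y ≤ D * (X - (a + a))
      go (inj₁ e) = ≤-reflexive (trans height (trans (solve 3 (λ s a b → s :* ((b :- a) :* (b :- a))
        := (b :- a) :* (((a :+ a) :+ s :* (b :- a)) :- (a :+ a))) refl level a b) (cong (λ X → D * (X - (a + a))) (sym e))))
      go (inj₂ e) = other (trans (cong (λ X → D * (X - (a + a))) e) (solve 3 (λ s a b →
        (b :- a) :* (((b :+ b) :+ s :* (a :- b)) :- (a :+ a))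
        := s :* ((b :- a) :* (b :- a)) :+ ((con (pos 1) :- s) :+ (con (pos 1) :- s)) :* ((b :- a) :* (b :- a))) refl level a b))

    right : Y ≤ D * ((b + b) - X)
    right = go width
      where
      go : X ≡ (a + a) + level * (b - a) ⊎ X ≡ (b + b) + level * (a - b) → Y ≤ D * ((b + b) - X)
      go (inj₁ e) = other (trans (cong (λ X → D * ((b + b) - X)) e) (solve 3 (λ s a b →
        (b :- a) :* ((b :+ b) :- ((a :+ a) :+ s :* (b :- a)))
        := s :* ((b :- a) :* (b :- a)) :+ ((con (pos 1) :- s) :+ (con (pos 1) :- s)) :* ((b :- a) :* (b :- a))) refl level a b))
      go (inj₂ e) = ≤-reflexive (trans height (trans (solve 3 (λ s a b → s :* ((b :- a) :* (b :- a))
        := (b :- a) :* ((b :+ b) :- ((b :+ b) :+ s :* (a :- b)))) refl level a b) (cong (λ X → D * ((b + b) - X)) (sym e))))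

  *-pos-≤0 : ∀ {k x} → 0ℚ < k → k * x ≤ 0ℚ → x ≤ 0ℚ
  *-pos-≤0 {k} {x} k>0 le = ≮⇒≥ λ x>0 → <-irrefl refl (<-≤-trans (*-pos k>0 x>0) le)

  *-pos-≥0 : ∀ {k x} → 0ℚ < k → 0ℚ ≤ k * x → 0ℚ ≤ x
  *-pos-≥0 {k} {x} k>0 ge = ≮⇒≥ λ x<0 → <-irrefl refl (<-≤-trans (<-≤-trans (*-pos k>0 (neg-pos x<0))
    (≤-reflexive (solve 2 (λ k x → k :* (:- x) := :- (k :* x)) refl k x))) (subst (- (k * x) ≤_) (signed-0 false) (neg-mono-≤ ge)))

  module _ {up a b c d P} (a<b : a < b) (c<d : c < d) (S : Tent up a b P) (T : Tent up c d P) where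
    private
      module S = Bounds a<b S
      module T = Bounds c<d T
      X Y : ℚ
      X = proj₁ P
      Y = signed up (proj₂ P)

      a≢b : a ≢ b
      a≢b e = <-irrefl e a<b

      grounded : Y ≡ 0ℚ → IsEnd a b P
      grounded e = ground a≢b S (signed-≡0 up e)

    -- A common point is not left of the foot 2c, where the descending line of the first tent has
    -- already reached the ground.
    tents-apart : b ≤ c → IsEnd a b P
    tents-apart b≤c = grounded (≤-antisym (≤-trans S.right D[2b-X]≤0) S.Y≥0)
      where
      2c≤X : 0ℚ ≤ X - (c + c)
      2c≤X = *-pos-≥0 T.D>0 (≤-trans T.Y≥0 T.left)
      D[2b-X]≤0 : S.D * ((b + b) - X) ≤ 0ℚ
      D[2b-X]≤0 = subst₂ _≤_ (solve 3 (λ D b X → :- (D :* (X :- (b :+ b))) := D :* ((b :+ b) :- X)) refl S.D b X) (signed-0 false)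
        (neg-mono-≤ (*-nonNeg (<⇒≤ S.D>0) (diff-nonNeg (≤-trans (+-mono-≤ b≤c b≤c) (diff-nonNeg⁻¹ 2c≤X)))))

    -- The outer tent is steeper.
    tents-nested : a ≤ c → d ≤ b → T.D < S.D → IsEnd a b P
    tents-nested a≤c d≤b D′<D = go S.on
      where
      k>0 : 0ℚ < S.D - T.D
      k>0 = diff-pos D′<D
      -- Here `z` is the horizontal distance to the foot of the outer tent on the side of P. The
      -- inner tent bounds the height by its smaller slope times `z`, which forces `z` to vanish.
      flat : ∀ {z w} → Y ≡ S.D * z → 0ℚ ≤ z → Y ≤ T.D * w → w ≤ z → IsEnd a b P
      flat {z} {w} e z≥0 le w≤z = grounded (trans e (trans (cong (S.D *_) z≡0) (zeroʳ S.D)))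
        where
        bound : S.D * z ≤ T.D * z
        bound = ≤-trans (subst (_≤ T.D * w) e le)
          (subst₂ _≤_ (*-comm w T.D) (*-comm z T.D) (*-mono-≤ (<⇒≤ T.D>0) w≤z))
        z≡0 : z ≡ 0ℚ
        z≡0 = ≤-antisym (*-pos-≤0 k>0 (subst₂ _≤_ (solve 3 (λ D D′ z → D :* z :+ :- (D′ :* z) := (D :- D′) :* z) refl S.D T.D z)
          (+-inverseʳ (T.D * z)) (+-mono-≤ bound (≤-refl { - (T.D * z)})))) z≥0
      go : Y ≡ S.D * (X - (a + a)) ⊎ Y ≡ S.D * ((b + b) - X) → IsEnd a b P
      go (inj₁ e) = flat e (*-pos-≥0 S.D>0 (≤-trans S.Y≥0 S.left)) T.left
        (+-mono-≤ (≤-refl {X}) (neg-mono-≤ (+-mono-≤ a≤c a≤c)))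
      go (inj₂ e) = flat e (*-pos-≥0 S.D>0 (≤-trans S.Y≥0 S.right)) T.right
        (+-mono-≤ (+-mono-≤ d≤b d≤b) (≤-refl { - X}))

  tents-opposite : ∀ {a b c d P} → a < b → c < d → Tent true a b P → Tent false c d P → IsEnd a b P
  tents-opposite {P = P} a<b c<d S T = ground (λ e → <-irrefl e a<b) S (≤-antisym y≤0 (Bounds.Y≥0 a<b S))
    where
    y≤0 : proj₂ P ≤ 0ℚ
    y≤0 = subst₂ _≤_ (neg-neg (proj₂ P)) (signed-0 false) (neg-mono-≤ (Bounds.Y≥0 c<d T))

-- Plane drawings from book embeddings with two pages

module BookEmbeddings where

  open import Defs
  open Rationals
  open Segments using (+-pos; x-y≡0⇒x≡y; end-on; OnSegment-sym)
  open Tents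
  open import Data.Bool using (Bool; true; false; _≟_)
  open import Data.Empty using (⊥; ⊥-elim)
  open import Data.Integer using () renaming (+_ to pos)
  open import Data.List using (List; []; _∷_; [_])
  open import Data.Nat as ℕ using (ℕ)
  import Data.Nat.Properties as ℕ
  open import Data.Rational using (ℚ; 0ℚ; 1ℚ; _<_; _≤_)
  open import Data.Rational.Properties using (<-irrefl; <⇒≤; ≤-reflexive; <-cmp)
  open import Data.Product using (_×_; _,_; proj₁; proj₂; ∃-syntax)
  open import Data.Sum using (_⊎_; inj₁; inj₂; swap; [_,_]′)
  open import Data.Unit using (tt)
  open import Relation.Binary using (Tri; tri<; tri≈; tri>)
  open import Relation.Binary.PropositionalEquality hiding ([_])
  open import Relation.Nullary using (¬_; yes; no)

  peak-high : ∀ up {a b} → a ≢ b → proj₂ (peak up a b) ≢ 0ℚ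
  peak-high up {a} {b} a≢b e = <-irrefl (sym (trans (sym (signed-involutive up ((b - a) * (b - a))))
    (trans (cong (signed up) e) (signed-0 up)))) (square-pos a≢b)

  -- Equal heights give equal levels on both sides, and equal first coordinates then make the level
  -- 1.
  sides-meet : ∀ up {a b P} → a ≢ b → OnSegment (base a) (peak up a b) P → OnSegment (base b) (peak up b a) P →
               P ≡ peak up a b
  sides-meet up {a} {b} {P} a≢b on on′ = top (slope-tent up on) (slope-tent up on′)
    where
    k>0 : 0ℚ < (b - a) * (b - a)
    k>0 = square-pos a≢b
    top : ∃[ s ] 0ℚ ≤ s × s ≤ 1ℚ × signed up (proj₂ P) ≡ s * ((b - a) * (b - a)) × proj₁ P ≡ (a + a) + s * (b - a) →
          ∃[ s ] 0ℚ ≤ s × s ≤ 1ℚ × signed up (proj₂ P) ≡ s * ((a - b) * (a - b)) × proj₁ P ≡ (b + b) + s * (a - b) →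
          P ≡ peak up a b
    top (s , _ , _ , h , w) (t , _ , _ , h′ , w′) = cong₂ _,_ first second
      where
      s≡t : s ≡ t
      s≡t = x-y≡0⇒x≡y (*-cancel-0 k>0 (trans
        (solve 4 (λ s t a b → (s :- t) :* ((b :- a) :* (b :- a)) := s :* ((b :- a) :* (b :- a)) :- t :* ((a :- b) :* (a :- b))) refl s t a b)
        (trans (cong₂ _-_ (sym h) (sym h′)) (+-inverseʳ (signed up (proj₂ P))))))
      s≡1 : s ≡ 1ℚ
      s≡1 = sym (x-y≡0⇒x≡y (*-cancel-0 (+-pos k>0 k>0) (trans
        (solve 3 (λ s a b → (con (pos 1) :- s) :* ((b :- a) :* (b :- a) :+ (b :- a) :* (b :- a))
           := (b :- a) :* (((b :+ b) :+ s :* (a :- b)) :- ((a :+ a) :+ s :* (b :- a)))) refl s a b)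
        (trans (cong ((b - a) *_) (trans (cong₂ _-_ (trans (cong (λ s → (b + b) + s * (a - b)) s≡t) (sym w′)) (sym w))
          (+-inverseʳ (proj₁ P)))) (zeroʳ (b - a))))))
      first : proj₁ P ≡ a + b
      first = trans w (trans (cong (λ s → (a + a) + s * (b - a)) s≡1)
        (solve 2 (λ a b → (a :+ a) :+ con (pos 1) :* (b :- a) := a :+ b) refl a b))
      second : proj₂ P ≡ signed up ((b - a) * (b - a))
      second = trans (sym (signed-involutive up (proj₂ P))) (cong (signed up) (trans h (trans (cong (_* ((b - a) * (b - a))) s≡1) (*-identityˡ _))))

  -- A book embedding with two pages: the vertices are placed on the horizontal
  -- axis, and an edge is a tent above or below it.
  module Book (G : Graph) where
    open Graph G hiding (sym)

    module Embedding (spine : V → ℕ) (spine-inj : ∀ {u v} → spine u ≡ spine v → u ≡ v)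
                     (page : V → V → Bool) (page-sym : ∀ {u v} → u ~ v → page v u ≡ page u v)
                     (noCross : ∀ {u v x y} → u ~ v → x ~ y → page u v ≡ page x y →
                                spine u ℕ.< spine x → spine x ℕ.< spine v → spine v ℕ.< spine y → ⊥) where

      private
        X : V → ℚ
        X v = fromℕ (spine v)

        X-mono : ∀ {u v} → spine u ℕ.< spine v → X u < X v
        X-mono = fromℕ-mono

        X-mono-≤ : ∀ {u v} → spine u ℕ.≤ spine v → X u ≤ X v
        X-mono-≤ le = [ (λ lt → <⇒≤ (fromℕ-mono lt)) , (λ e → ≤-reflexive (cong fromℕ e)) ]′ (ℕ.m≤n⇒m<n∨m≡n le)

        X-inj : ∀ {u v} → X u ≡ X v → u ≡ v
        X-inj {u} {v} e with ℕ.<-cmp (spine u) (spine v)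
        ... | tri< lt _ _ = ⊥-elim (<-irrefl e (fromℕ-mono lt))
        ... | tri≈ _ p _ = spine-inj p
        ... | tri> _ _ gt = ⊥-elim (<-irrefl (sym e) (fromℕ-mono gt))

        double-inj : ∀ {a b} → a + a ≡ b + b → a ≡ b
        double-inj {a} {b} e with <-cmp a b
        ... | tri< lt _ _ = ⊥-elim (<-irrefl e (+-mono-< lt lt))
        ... | tri≈ _ p _ = p
        ... | tri> _ _ gt = ⊥-elim (<-irrefl (sym e) (+-mono-< gt gt))

        posV : V → Point
        posV v = base (X v)

        posV-inj : ∀ {u v} → posV u ≡ posV v → u ≡ v
        posV-inj e = X-inj (double-inj (cong proj₁ e))

        bend : V → V → Point
        bend u v = peak (page u v) (X u) (X v)

        arcs : V → V → List Point
        arcs u v = posV u ∷ bend u v ∷ posV v ∷ []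

        ~-≢ : ∀ {u v} → u ~ v → X u ≢ X v
        ~-≢ e p = irrefl (X-inj p) e

        turn : ∀ {u v P} → OnSegment (bend u v) (posV v) P → OnSegment (posV v) (peak (page u v) (X v) (X u)) P
        turn {u} {v} {P} on = subst (λ Q → OnSegment (posV v) Q P) (peak-sym (page u v) (X u) (X v)) (OnSegment-sym on)

        second-half : ∀ {u v P} → OnArc (bend u v ∷ posV v ∷ []) P → OnSegment (posV v) (peak (page u v) (X v) (X u)) P
        second-half (inj₁ on) = turn on
        second-half {u} {v} (inj₂ e) = subst (OnSegment (posV v) _) (sym e) (turn (end-on (bend u v) (posV v)))

        arc-Tent : ∀ {u v P} → OnArc (arcs u v) P → Tent (page u v) (X u) (X v) P
        arc-Tent {u} {v} (inj₁ on) = slope-Tent (page u v) on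
        arc-Tent {u} {v} (inj₂ on) = Tent-swap (slope-Tent (page u v) (second-half on))

        pages : ∀ p q {a b c d P} → a < b → c < d → p ≢ q → Tent p a b P → Tent q c d P → IsEnd a b P
        pages true true _ _ ne = ⊥-elim (ne refl)
        pages false false _ _ ne = ⊥-elim (ne refl)
        pages true false a<b c<d _ S T = tents-opposite a<b c<d S T
        pages false true {a} {b} {c} {d} {P} a<b c<d _ S T = ground (λ e → <-irrefl e a<b) S (flat (tents-opposite c<d a<b T S))
          where
          flat : IsEnd c d P → proj₂ P ≡ 0ℚ
          flat (inj₁ e) = cong proj₂ e
          flat (inj₂ e) = cong proj₂ e

        widths : ∀ {a b c d} → a ≤ c → d < b → d - c < b - a
        widths a≤c d<b = +-mono-<-≤ d<b (neg-mono-≤ a≤c)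

        widths′ : ∀ {a b c d} → a < c → d ≤ b → d - c < b - a
        widths′ {a} {b} {c} {d} a<c d≤b = subst₂ _<_ (+-comm (- c) d) (+-comm (- a) b) (+-mono-<-≤ (neg-mono-< a<c) d≤b)

        module _ {a b c d : V} {P : Point} (ab : a ~ b) (cd : c ~ d) (diff : ¬ (a ≡ c × b ≡ d))
                 (a<b : spine a ℕ.< spine b) (c<d : spine c ℕ.< spine d)
                 (S : Tent (page a b) (X a) (X b) P) (T : Tent (page c d) (X c) (X d) P) where

          Ends : Set
          Ends = IsEnd (X a) (X b) P ⊎ IsEnd (X c) (X d) P

          outer-ab : ∀ {p q} → p ≡ q → Tent p (X a) (X b) P → Tent q (X c) (X d) P → X a ≤ X c → X d ≤ X b →
                     X d - X c < X b - X a → Ends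
          outer-ab refl S T le le′ lt = inj₁ (tents-nested (X-mono a<b) (X-mono c<d) S T le le′ lt)

          outer-cd : ∀ {p q} → p ≡ q → Tent p (X a) (X b) P → Tent q (X c) (X d) P → X c ≤ X a → X b ≤ X d →
                     X b - X a < X d - X c → Ends
          outer-cd refl S T le le′ lt = inj₂ (tents-nested (X-mono c<d) (X-mono a<b) T S le le′ lt)

          apart-ab : ∀ {p q} → p ≡ q → Tent p (X a) (X b) P → Tent q (X c) (X d) P → X b ≤ X c → Ends
          apart-ab refl S T le = inj₁ (tents-apart (X-mono a<b) (X-mono c<d) S T le)

          apart-cd : ∀ {p q} → p ≡ q → Tent p (X a) (X b) P → Tent q (X c) (X d) P → X d ≤ X a → Ends
          apart-cd refl S T le = inj₂ (tents-apart (X-mono c<d) (X-mono a<b) T S le)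

          -- Two intervals on a page are apart, interleaved or nested. Intervals with a common left
          -- or right end count as nested; they differ in width because the edges differ.
          same-page : page a b ≡ page c d → Tri (spine a ℕ.< spine c) (spine a ≡ spine c) (spine c ℕ.< spine a) →
            Tri (spine b ℕ.< spine d) (spine b ≡ spine d) (spine d ℕ.< spine b) →
            spine b ℕ.≤ spine c ⊎ spine c ℕ.< spine b → spine d ℕ.≤ spine a ⊎ spine a ℕ.< spine d → Ends
          same-page p _ _ (inj₁ bc) _ = apart-ab p S T (X-mono-≤ bc)
          same-page p _ _ _ (inj₁ da) = apart-cd p S T (X-mono-≤ da)
          same-page p (tri< ac _ _) (tri< bd _ _) (inj₂ cb) _ = ⊥-elim (noCross ab cd p ac cb bd)
          same-page p (tri> _ _ ca) (tri> _ _ db) _ (inj₂ ad) = ⊥-elim (noCross cd ab (sym p) ca ad db)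
          same-page p (tri< ac _ _) (tri≈ _ bd _) _ _ =
            outer-ab p S T (<⇒≤ (X-mono ac)) (X-mono-≤ (ℕ.≤-reflexive (sym bd))) (widths′ (X-mono ac) (X-mono-≤ (ℕ.≤-reflexive (sym bd))))
          same-page p (tri< ac _ _) (tri> _ _ db) _ _ =
            outer-ab p S T (<⇒≤ (X-mono ac)) (<⇒≤ (X-mono db)) (widths (<⇒≤ (X-mono ac)) (X-mono db))
          same-page p (tri≈ _ ac _) (tri< bd _ _) _ _ =
            outer-cd p S T (X-mono-≤ (ℕ.≤-reflexive (sym ac))) (<⇒≤ (X-mono bd)) (widths (X-mono-≤ (ℕ.≤-reflexive (sym ac))) (X-mono bd))
          same-page p (tri≈ _ ac _) (tri≈ _ bd _) _ _ = ⊥-elim (diff (spine-inj ac , spine-inj bd))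
          same-page p (tri≈ _ ac _) (tri> _ _ db) _ _ =
            outer-ab p S T (X-mono-≤ (ℕ.≤-reflexive ac)) (<⇒≤ (X-mono db)) (widths (X-mono-≤ (ℕ.≤-reflexive ac)) (X-mono db))
          same-page p (tri> _ _ ca) (tri< bd _ _) _ _ =
            outer-cd p S T (<⇒≤ (X-mono ca)) (<⇒≤ (X-mono bd)) (widths (<⇒≤ (X-mono ca)) (X-mono bd))
          same-page p (tri> _ _ ca) (tri≈ _ bd _) _ _ =
            outer-cd p S T (<⇒≤ (X-mono ca)) (X-mono-≤ (ℕ.≤-reflexive bd)) (widths′ (X-mono ca) (X-mono-≤ (ℕ.≤-reflexive bd)))

          directed : Ends
          directed with page a b ≟ page c d
          ... | yes p = same-page p (ℕ.<-cmp (spine a) (spine c)) (ℕ.<-cmp (spine b) (spine d))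
                          (ℕ.≤-<-connex (spine b) (spine c)) (ℕ.≤-<-connex (spine d) (spine a))
          ... | no ne = inj₁ (pages _ _ (X-mono a<b) (X-mono c<d) ne S T)

        flip-Tent : ∀ {u v P} → u ~ v → Tent (page u v) (X u) (X v) P → Tent (page v u) (X v) (X u) P
        flip-Tent {u} {v} {P} e T = subst (λ p → Tent p (X v) (X u) P) (sym (page-sym e)) (Tent-swap T)

        meet-at-end : ∀ {u v x y P} → u ~ v → x ~ y → ¬ SameEdge u v x y →
          Tent (page u v) (X u) (X v) P → Tent (page x y) (X x) (X y) P →
          Tri (spine u ℕ.< spine v) (spine u ≡ spine v) (spine v ℕ.< spine u) →
          Tri (spine x ℕ.< spine y) (spine x ≡ spine y) (spine y ℕ.< spine x) →
          IsEnd (X u) (X v) P ⊎ IsEnd (X x) (X y) P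
        meet-at-end uv xy diff S T (tri≈ _ e _) _ = ⊥-elim (irrefl (spine-inj e) uv)
        meet-at-end uv xy diff S T _ (tri≈ _ e _) = ⊥-elim (irrefl (spine-inj e) xy)
        meet-at-end uv xy diff S T (tri< a _ _) (tri< b _ _) = directed uv xy (λ p → diff (inj₁ p)) a b S T
        meet-at-end uv xy diff S T (tri< a _ _) (tri> _ _ b) =
          [ inj₁ , (λ p → inj₂ (swap p)) ]′ (directed uv (Graph.sym G xy) (λ p → diff (inj₂ p)) a b S (flip-Tent xy T))
        meet-at-end uv xy diff S T (tri> _ _ a) (tri< b _ _) =
          [ (λ p → inj₁ (swap p)) , inj₂ ]′ (directed (Graph.sym G uv) xy (λ (p , q) → diff (inj₂ (q , p))) a b (flip-Tent uv S) T)
        meet-at-end uv xy diff S T (tri> _ _ a) (tri> _ _ b) =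
          [ (λ p → inj₁ (swap p)) , (λ p → inj₂ (swap p)) ]′
            (directed (Graph.sym G uv) (Graph.sym G xy) (λ (p , q) → diff (inj₁ (q , p))) a b (flip-Tent uv S) (flip-Tent xy T))

        Inside : V → V → Point → Set
        Inside u v P = OnArc (arcs u v) P × P ≢ posV u × P ≢ posV v

        not-end : ∀ {u v P} → Inside u v P → ¬ IsEnd (X u) (X v) P
        not-end (_ , p , _) (inj₁ e) = p e
        not-end (_ , _ , q) (inj₂ e) = q e

        avoids-vertices : ∀ {u v} → u ~ v → ∀ w → ¬ Inside u v (posV w)
        avoids-vertices e w i = not-end i (ground (~-≢ e) (arc-Tent (proj₁ i)) refl)

        avoids-arcs : ∀ {u v x y} → u ~ v → x ~ y → ¬ SameEdge u v x y → ∀ P → Inside u v P → ¬ OnArc (arcs x y) P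
        avoids-arcs {u} {v} {x} {y} uv xy diff P i on =
          [ not-end i , [ at x , at y ]′ ]′ (meet-at-end uv xy diff (arc-Tent (proj₁ i)) (arc-Tent on)
            (ℕ.<-cmp (spine u) (spine v)) (ℕ.<-cmp (spine x) (spine y)))
          where
          at : ∀ w → P ≡ posV w → ⊥
          at w refl = avoids-vertices uv w i

        simple : ∀ {u v} → u ~ v → SimpleArc (arcs u v)
        simple {u} {v} e =
          (λ p → peak-high (page u v) (~-≢ e) (sym (cong proj₂ p))) ,
          (λ P on on′ → sides-meet (page u v) (~-≢ e) on (second-half on′)) ,
          (λ p → peak-high (page u v) (~-≢ e) (cong proj₂ p)) ,
          (λ P _ p → p) , tt

      planeDrawing : PlaneDrawing G
      planeDrawing = record
        { pos = posV
        ; pos-injective = posV-inj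
        ; bends = λ u v → [ bend u v ]
        ; bends-sym = λ {u} {v} e → cong [_] (trans (cong (λ p → peak p (X v) (X u)) (page-sym e)) (peak-sym (page u v) (X v) (X u)))
        ; arc-simple = simple
        ; no-vertex = avoids-vertices
        ; no-crossing = avoids-arcs
        }

-- The example graph and its spine

module GadgetGraph where

  open import Data.Empty using (⊥; ⊥-elim)
  open import Data.Fin as Fin using (Fin; zero; suc; toℕ; combine)
  open import Data.Fin.Properties as Fin using (toℕ<n; toℕ-injective; toℕ-combine; combine-injective; +↔⊎; *↔×; 1↔⊤)
  open import Data.List using (List; []; _∷_; _++_)
  open import Data.List.Membership.Propositional using (_∈_)
  import Data.List.Membership.DecPropositional as DecMembership
  open import Data.List.Relation.Unary.Any using (here; there)
  open import Data.Nat as ℕ using (ℕ; zero; suc; _+_; _*_; _≤_; _<_; z≤n; s≤s)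
  open import Data.Nat.Properties as ℕ using (≤-trans; ≤-refl; ≤-reflexive; <-trans; <-irrefl; <-≤-trans; ≤-<-trans; <-cmp)
  open import Data.Product using (_×_; _,_)
  open import Data.Product.Function.NonDependent.Propositional using (_×-↔_)
  import Data.Product.Properties as Product
  open import Data.Sum as Sum using (_⊎_; inj₁; inj₂; [_,_]′)
  open import Data.Sum.Function.Propositional using (_⊎-↔_)
  import Data.Sum.Properties as Sum
  open import Data.Unit using (⊤; tt)
  import Data.Unit.Properties as Unit
  open import Function using (_↔_; Inverse)
  open import Function.Properties.Inverse using (↔-refl; ↔-trans)
  open import Relation.Binary using (DecidableEquality; tri<; tri≈; tri>)
  open import Relation.Binary.PropositionalEquality
  open import Relation.Nullary using (¬_)

  radix-lex : ∀ {m q q′ r r′} → r′ < m → q * m + r < q′ * m + r′ → q < q′ ⊎ (q ≡ q′ × r < r′)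
  radix-lex {m} {q} {q′} {r} {r′} r′<m lt with <-cmp q q′
  ... | tri< p _ _ = inj₁ p
  ... | tri≈ _ refl _ = inj₂ (refl , ℕ.+-cancelˡ-< (q * m) r r′ lt)
  ... | tri> _ _ p = ⊥-elim (<-irrefl refl (≤-<-trans (begin
    q′ * m + r′   ≤⟨ ℕ.+-monoʳ-≤ (q′ * m) (ℕ.<⇒≤ r′<m) ⟩
    q′ * m + m    ≡⟨ ℕ.+-comm (q′ * m) m ⟩
    suc q′ * m    ≤⟨ ℕ.*-monoˡ-≤ m p ⟩
    q * m         ≤⟨ ℕ.m≤m+n (q * m) r ⟩
    q * m + r     ∎) lt))
    where open ℕ.≤-Reasoning

  lex-radix : ∀ {m q q′ r r′} → r < m → q < q′ ⊎ (q ≡ q′ × r < r′) → q * m + r < q′ * m + r′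
  lex-radix {m} {q} {q′} {r} {r′} r<m (inj₁ lt) = begin-strict
    q * m + r     <⟨ ℕ.+-monoʳ-< (q * m) r<m ⟩
    q * m + m     ≡⟨ ℕ.+-comm (q * m) m ⟩
    suc q * m     ≤⟨ ℕ.*-monoˡ-≤ m lt ⟩
    q′ * m        ≤⟨ ℕ.m≤m+n (q′ * m) r′ ⟩
    q′ * m + r′   ∎
    where open ℕ.≤-Reasoning
  lex-radix {m} {q} r<m (inj₂ (refl , lt)) = ℕ.+-monoʳ-< (q * m) lt

  radix-inj : ∀ {m q q′ r r′} → r < m → r′ < m → q * m + r ≡ q′ * m + r′ → q ≡ q′ × r ≡ r′
  radix-inj {m} {q} {q′} {r} {r′} r<m r′<m e with <-cmp q q′ | <-cmp r r′
  ... | tri< p _ _ | _ = ⊥-elim (<-irrefl e (lex-radix r<m (inj₁ p)))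
  ... | tri> _ _ p | _ = ⊥-elim (<-irrefl (sym e) (lex-radix r′<m (inj₁ p)))
  ... | tri≈ _ p _ | tri< l _ _ = ⊥-elim (<-irrefl e (lex-radix r<m (inj₂ (p , l))))
  ... | tri≈ _ p _ | tri> _ _ l = ⊥-elim (<-irrefl (sym e) (lex-radix r′<m (inj₂ (sym p , l))))
  ... | tri≈ _ p _ | tri≈ _ l _ = p , l

  module Construction (N M K : ℕ) where

    -- The types are nested as in the drawing: a block holds x, x′ and groups, and a group holds t
    -- and the pairs s, s′.
    Inner Block Vtx : Set
    Inner = ⊤ ⊎ (Fin K × Fin 2)
    Block = ⊤ ⊎ (⊤ ⊎ (Fin M × Inner))
    Vtx   = ⊤ ⊎ (⊤ ⊎ (Fin N × Block))

    pattern U = inj₁ tt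
    pattern V = inj₂ (inj₁ tt)
    pattern In j b = inj₂ (inj₂ (j , b))
    pattern X j = In j (inj₁ tt)
    pattern X′ j = In j (inj₂ (inj₁ tt))
    pattern Sub j i c = In j (inj₂ (inj₂ (i , c)))
    pattern T j i = Sub j i (inj₁ tt)
    pattern S j i k = Sub j i (inj₂ (k , zero))
    pattern S′ j i k = Sub j i (inj₂ (k , suc zero))

    infixr 5 _⊞_
    infixr 6 _⊠_
    _⊞_ : ∀ {m n} {A B : Set} → Fin m ↔ A → Fin n ↔ B → Fin (m + n) ↔ (A ⊎ B)
    f ⊞ g = ↔-trans +↔⊎ (f ⊎-↔ g)
    _⊠_ : ∀ {m n} {A B : Set} → Fin m ↔ A → Fin n ↔ B → Fin (m * n) ↔ (A × B)
    f ⊠ g = ↔-trans *↔× (f ×-↔ g)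

    order : ℕ
    order = 1 + (1 + N * (1 + (1 + M * (1 + K * 2))))

    numbering : Fin order ↔ Vtx
    numbering = 1↔⊤ ⊞ 1↔⊤ ⊞ ↔-refl ⊠ (1↔⊤ ⊞ 1↔⊤ ⊞ ↔-refl ⊠ (1↔⊤ ⊞ ↔-refl ⊠ ↔-refl))

    opaque
      decode : Fin order → Vtx
      decode = Inverse.to numbering

      encode : Vtx → Fin order
      encode = Inverse.from numbering

      decode-encode : ∀ a → decode (encode a) ≡ a
      decode-encode = Inverse.strictlyInverseˡ numbering

      encode-decode : ∀ i → encode (decode i) ≡ i
      encode-decode = Inverse.strictlyInverseʳ numbering

    _≟_ : DecidableEquality Vtx
    _≟_ = Sum.≡-dec Unit._≟_ (Sum.≡-dec Unit._≟_ (Product.≡-dec Fin._≟_ (Sum.≡-dec Unit._≟_ (Sum.≡-dec Unit._≟_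
            (Product.≡-dec Fin._≟_ (Sum.≡-dec Unit._≟_ (Product.≡-dec Fin._≟_ Fin._≟_)))))))

    -- The edges are directed away from the vertex at which they are listed. On
    -- the spine those of ups go left, and those of downs go right.
    ups downs out : Vtx → List Vtx
    ups U = []
    ups V = []
    ups (X j) = U ∷ []
    ups (X′ j) = U ∷ []
    ups (Sub j i c) = X j ∷ []

    downs U = []
    downs V = []
    downs (X j) = V ∷ X′ j ∷ []
    downs (X′ j) = V ∷ []
    downs (T j i) = X′ j ∷ []
    downs (S j i k) = T j i ∷ S′ j i k ∷ []
    downs (S′ j i k) = T j i ∷ []

    out a = ups a ++ downs a

    offᴵ : Inner → ℕ
    offᴵ (inj₁ _) = K * 2
    offᴵ (inj₂ (k , b)) = toℕ (combine k b)

    subᴮ offᴮ : Block → ℕ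
    subᴮ (inj₁ _) = 0
    subᴮ (inj₂ (inj₁ _)) = suc M
    subᴮ (inj₂ (inj₂ (i , _))) = suc (toℕ i)
    offᴮ (inj₂ (inj₂ (_ , c))) = offᴵ c
    offᴮ _ = 0

    blk sub off : Vtx → ℕ
    blk U = 0
    blk V = suc N
    blk (In j b) = suc (toℕ j)
    sub (In j b) = subᴮ b
    sub _ = 0
    off (In j b) = offᴮ b
    off _ = 0

    sub< : ∀ a → sub a < 2 + M
    sub< U = s≤s z≤n
    sub< V = s≤s z≤n
    sub< (X j) = s≤s z≤n
    sub< (X′ j) = ≤-refl
    sub< (Sub j i c) = s≤s (s≤s (ℕ.<⇒≤ (toℕ<n i)))

    off< : ∀ a → off a < 1 + K * 2
    off< U = s≤s z≤n
    off< V = s≤s z≤n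
    off< (X j) = s≤s z≤n
    off< (X′ j) = s≤s z≤n
    off< (T j i) = ≤-refl
    off< (Sub j i (inj₂ (k , b))) = ℕ.<⇒≤ (s≤s (toℕ<n (combine k b)))

    opaque
      -- A number with three digits in mixed radix, for the lexicographic order by block, group and
      -- place. `X` opens its block and `X′` closes it, `T` closes its group, and each `S` directly
      -- precedes its `S′`.
      spine : Vtx → ℕ
      spine a = (blk a * (2 + M) + sub a) * (1 + K * 2) + off a

    offᴵ-inj : ∀ {a b} → offᴵ a ≡ offᴵ b → a ≡ b
    offᴵ-inj {inj₁ _} {inj₁ _} e = refl
    offᴵ-inj {inj₁ _} {inj₂ (k , b)} e = ⊥-elim (<-irrefl (sym e) (toℕ<n (combine k b)))
    offᴵ-inj {inj₂ (k , b)} {inj₁ _} e = ⊥-elim (<-irrefl e (toℕ<n (combine k b)))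
    offᴵ-inj {inj₂ (k , b)} {inj₂ (l , c)} e with combine-injective k b l c (toℕ-injective e)
    ... | refl , refl = refl

    block-inj : ∀ {a b} → subᴮ a ≡ subᴮ b → offᴮ a ≡ offᴮ b → a ≡ b
    block-inj {inj₁ _} {inj₁ _} e f = refl
    block-inj {inj₁ _} {inj₂ (inj₁ _)} () f
    block-inj {inj₁ _} {inj₂ (inj₂ _)} () f
    block-inj {inj₂ (inj₁ _)} {inj₁ _} () f
    block-inj {inj₂ (inj₂ _)} {inj₁ _} () f
    block-inj {inj₂ (inj₁ _)} {inj₂ (inj₁ _)} e f = refl
    block-inj {inj₂ (inj₁ _)} {inj₂ (inj₂ (i , _))} e f = ⊥-elim (<-irrefl (sym (ℕ.suc-injective e)) (toℕ<n i))
    block-inj {inj₂ (inj₂ (i , _))} {inj₂ (inj₁ _)} e f = ⊥-elim (<-irrefl (ℕ.suc-injective e) (toℕ<n i))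
    block-inj {inj₂ (inj₂ (i , c))} {inj₂ (inj₂ (i′ , c′))} e f with toℕ-injective (ℕ.suc-injective e) | offᴵ-inj {c} {c′} f
    ... | refl | refl = refl

    key-inj : ∀ {a b} → blk a ≡ blk b → sub a ≡ sub b → off a ≡ off b → a ≡ b
    key-inj {U} {U} d e f = refl
    key-inj {U} {V} () e f
    key-inj {U} {In _ _} () e f
    key-inj {V} {U} () e f
    key-inj {In _ _} {U} () e f
    key-inj {V} {V} d e f = refl
    key-inj {V} {In j _} d e f = ⊥-elim (<-irrefl (sym (ℕ.suc-injective d)) (toℕ<n j))
    key-inj {In j _} {V} d e f = ⊥-elim (<-irrefl (ℕ.suc-injective d) (toℕ<n j))
    key-inj {In j a} {In j′ b} d e f with toℕ-injective (ℕ.suc-injective d) | block-inj {a} {b} e f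
    ... | refl | refl = refl

    opaque
      unfolding spine

      spine-inj : ∀ {a b} → spine a ≡ spine b → a ≡ b
      spine-inj {a} {b} e =
        let (e₁ , p) = radix-inj (off< a) (off< b) e
            (q , r) = radix-inj {q = blk a} {blk b} (sub< a) (sub< b) e₁
        in key-inj q r p

    data Lex (a b : Vtx) : Set where
      by-blk : blk a < blk b → Lex a b
      by-sub : blk a ≡ blk b → sub a < sub b → Lex a b
      by-off : blk a ≡ blk b → sub a ≡ sub b → off a < off b → Lex a b

    opaque
      unfolding spine

      spine⇒Lex : ∀ {a b} → spine a < spine b → Lex a b
      spine⇒Lex {a} {b} lt with radix-lex (off< b) lt
      ... | inj₁ lt′ = [ by-blk , (λ (e , l) → by-sub e l) ]′ (radix-lex {q = blk a} {blk b} (sub< b) lt′)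
      ... | inj₂ (e , l) =
        let (p , q) = radix-inj {q = blk a} {blk b} (sub< a) (sub< b) e in by-off p q l

      Lex⇒spine : ∀ {a b} → Lex a b → spine a < spine b
      Lex⇒spine {a} {b} (by-blk lt) = lex-radix (off< a) (inj₁ (lex-radix (sub< a) (inj₁ lt)))
      Lex⇒spine {a} {b} (by-sub e lt) = lex-radix (off< a) (inj₁ (lex-radix {q = blk a} {blk b} (sub< a) (inj₂ (e , lt))))
      Lex⇒spine {a} {b} (by-off e f lt) = lex-radix (off< a) (inj₂ (cong₂ (λ p q → p * (2 + M) + q) e f , lt))

    Lex-irrefl : ∀ {a} → ¬ Lex a a
    Lex-irrefl l = <-irrefl refl (Lex⇒spine l)

    blk-mono : ∀ {a b} → Lex a b → blk a ≤ blk b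
    blk-mono (by-blk lt) = ℕ.<⇒≤ lt
    blk-mono (by-sub e _) = ≤-reflexive e
    blk-mono (by-off e _ _) = ≤-reflexive e

    same-blk : ∀ {a b c} → blk a ≡ blk b → Lex a c → Lex c b → blk c ≡ blk b
    same-blk e ac cb = ℕ.≤-antisym (blk-mono cb) (≤-trans (≤-reflexive (sym e)) (blk-mono ac))

    sub-mono : ∀ {a b} → blk a ≡ blk b → Lex a b → sub a ≤ sub b
    sub-mono e (by-blk lt) = ⊥-elim (<-irrefl e lt)
    sub-mono e (by-sub _ lt) = ℕ.<⇒≤ lt
    sub-mono e (by-off _ f _) = ≤-reflexive f

    same-sub : ∀ {a b c} → blk a ≡ blk b → sub a ≡ sub b → Lex a c → Lex c b → sub c ≡ sub b
    same-sub e f ac cb = ℕ.≤-antisym (sub-mono (same-blk e ac cb) cb)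
      (≤-trans (≤-reflexive (sym f)) (sub-mono (trans e (sym (same-blk e ac cb))) ac))

    off-mono : ∀ {a b} → blk a ≡ blk b → sub a ≡ sub b → Lex a b → off a < off b
    off-mono e f (by-blk lt) = ⊥-elim (<-irrefl e lt)
    off-mono e f (by-sub _ lt) = ⊥-elim (<-irrefl f lt)
    off-mono e f (by-off _ _ lt) = lt

    block-≡ : ∀ {n} {i j : Fin n} → suc (toℕ i) ≡ suc (toℕ j) → i ≡ j
    block-≡ e = toℕ-injective (ℕ.suc-injective e)

    nothing-left : ∀ {a} → ¬ Lex a U
    nothing-left (by-blk ())
    nothing-left (by-sub _ ())
    nothing-left (by-off _ _ ())

    nothing-right : ∀ {a} → ¬ Lex V a
    nothing-right {a} l = <-irrefl refl (<-≤-trans (Lex⇒spine l) (last a))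
      where
      last : ∀ a → spine a ≤ spine V
      last U = ℕ.<⇒≤ (Lex⇒spine {U} {V} (by-blk (s≤s z≤n)))
      last V = ≤-refl
      last a@(In j b) = ℕ.<⇒≤ (Lex⇒spine {a} {V} (by-blk (s≤s (toℕ<n j))))

    ups-left : ∀ {a b} → b ∈ ups a → Lex b a
    ups-left {X j} (here refl) = by-blk (s≤s z≤n)
    ups-left {X′ j} (here refl) = by-blk (s≤s z≤n)
    ups-left {Sub j i c} (here refl) = by-sub refl (s≤s z≤n)

    S<S′ : ∀ k → toℕ (combine {K} {2} k (suc zero)) ≡ suc (toℕ (combine {K} {2} k zero))
    S<S′ k = trans (toℕ-combine {K} {2} k (suc zero)) (trans (ℕ.+-comm (2 * toℕ k) 1)
      (cong suc (sym (trans (toℕ-combine {K} {2} k zero) (ℕ.+-identityʳ _)))))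

    downs-right : ∀ {a b} → b ∈ downs a → Lex a b
    downs-right {X j} (here refl) = by-blk (s≤s (toℕ<n j))
    downs-right {X j} (there (here refl)) = by-sub refl (s≤s z≤n)
    downs-right {X′ j} (here refl) = by-blk (s≤s (toℕ<n j))
    downs-right {T j i} (here refl) = by-sub refl (s≤s (toℕ<n i))
    downs-right {S j i k} (here refl) = by-off refl refl (toℕ<n (combine k zero))
    downs-right {S j i k} (there (here refl)) = by-off refl refl (≤-reflexive (sym (S<S′ k)))
    downs-right {S′ j i k} (here refl) = by-off refl refl (toℕ<n (combine k (suc zero)))

    X′-last : ∀ {j i c} → ¬ Lex (X′ j) (Sub j i c)
    X′-last {i = i} l = <-irrefl refl (≤-trans (sub-mono refl l) (toℕ<n i))

    -- The edges above are stars at their left ends. The star of `U` starts before everything, and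
    -- that of `X j` stays within its block, where no other star starts.
    ups-noCross : ∀ {a b c d} → a ∈ ups b → c ∈ ups d → Lex a c → Lex c b → Lex b d → ⊥
    ups-noCross {d = X j} _ (here refl) ac _ _ = nothing-left ac
    ups-noCross {d = X′ j} _ (here refl) ac _ _ = nothing-left ac
    ups-noCross {b = X j′} {d = Sub j i s} (here refl) (here refl) ac cb bd with block-≡ {i = j′} {j} (same-blk refl cb bd)
    ... | refl = Lex-irrefl cb
    ups-noCross {b = X′ j′} {d = Sub j i s} (here refl) (here refl) ac cb bd with block-≡ {i = j′} {j} (same-blk refl cb bd)
    ... | refl = X′-last bd
    ups-noCross {b = Sub j′ i′ s′} {d = Sub j i s} (here refl) (here refl) ac cb bd with block-≡ {i = j′} {j} (same-blk refl cb bd)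
    ... | refl = Lex-irrefl ac

    -- Of the vertices of a block only X j is joined to something beyond X′ j.
    within-block : ∀ {j c d} → blk c ≡ suc (toℕ j) → c ≢ X j → d ∈ downs c → Lex c (X′ j) → Lex (X′ j) d → ⊥
    within-block {j} {V} e ne ()
    within-block {j} {In j′ b} e ne d∈ cb bd with block-≡ {i = j′} {j} e
    within-block {j} {X _} e ne d∈ cb bd | refl = ne refl
    within-block {j} {X′ _} e ne d∈ cb bd | refl = Lex-irrefl cb
    within-block {j} {T _ i} e ne (here refl) cb bd | refl = Lex-irrefl bd
    within-block {j} {S _ i k} e ne (here refl) cb bd | refl = X′-last bd
    within-block {j} {S _ i k} e ne (there (here refl)) cb bd | refl = X′-last bd
    within-block {j} {S′ _ i k} e ne (here refl) cb bd | refl = X′-last bd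

    T-last : ∀ {j i c} → ¬ Lex (T j i) (Sub j i c)
    T-last {j} {i} {inj₁ _} l = Lex-irrefl l
    T-last {j} {i} {inj₂ (k , b)} l = <-irrefl refl (<-trans (off-mono refl refl l) (toℕ<n (combine k b)))

    -- `T` closes its group, and below the spine no other vertex of the group is joined to anything
    -- beyond it.
    within-sub : ∀ {j i c d} → blk c ≡ suc (toℕ j) → sub c ≡ suc (toℕ i) → d ∈ downs c → Lex c (T j i) → Lex (T j i) d → ⊥
    within-sub {j} {i} {V} e () d∈ cb bd
    within-sub {j} {i} {X _} e () d∈ cb bd
    within-sub {j} {i} {X′ _} e f d∈ cb bd = <-irrefl (sym (ℕ.suc-injective f)) (toℕ<n i)
    within-sub {j} {i} {Sub j′ i′ c} e f d∈ cb bd with block-≡ {i = j′} {j} e | block-≡ {i = i′} {i} f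
    within-sub {j} {i} {T _ _} e f d∈ cb bd | refl | refl = Lex-irrefl cb
    within-sub {j} {i} {S _ _ k} e f (here refl) cb bd | refl | refl = Lex-irrefl bd
    within-sub {j} {i} {S _ _ k} e f (there (here refl)) cb bd | refl | refl = T-last bd
    within-sub {j} {i} {S′ _ _ k} e f (here refl) cb bd | refl | refl = Lex-irrefl bd

    -- Every right end is a barrier: `V` for the whole spine, `X′` for its block, `T` for its group.
    -- Between `S` and its `S′` there is nothing.
    downs-noCross : ∀ {a b c d} → b ∈ downs a → d ∈ downs c → Lex a c → Lex c b → Lex b d → ⊥
    downs-noCross {X j} (here refl) d∈ ac cb bd = nothing-right bd
    downs-noCross {X j} (there (here refl)) d∈ ac cb bd =
      within-block (same-blk refl ac cb) (λ { refl → Lex-irrefl ac }) d∈ cb bd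
    downs-noCross {X′ j} (here refl) d∈ ac cb bd = nothing-right bd
    downs-noCross {T j i} (here refl) d∈ ac cb bd =
      within-block (same-blk refl ac cb) (λ { refl → X-first ac }) d∈ cb bd
      where
      X-first : ¬ Lex (T j i) (X j)
      X-first l with sub-mono refl l
      ... | ()
    downs-noCross {S j i k} (here refl) d∈ ac cb bd =
      within-sub (same-blk refl ac cb) (same-sub refl refl ac cb) d∈ cb bd
    downs-noCross {a@(S j i k)} {b} {c} (there (here refl)) d∈ ac cb bd =
      <-irrefl refl (<-≤-trans (≤-<-trans (off-mono (sym e) (sym f) ac) (off-mono e f cb)) (≤-reflexive (S<S′ k)))
      where
      e : blk c ≡ blk b
      e = same-blk refl ac cb
      f : sub c ≡ sub b
      f = same-sub refl refl ac cb
    downs-noCross {S′ j i k} (here refl) d∈ ac cb bd =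
      within-sub (same-blk refl ac cb) (same-sub refl refl ac cb) d∈ cb bd

-- The local queue number of the example

module LocalQueueNumber3 where

  open import Defs
  open StarLayouts using (isLocal; nest-disjoint)
  open TwoLocalLayouts using (Layout₂)
  open LowerBound using (#x; #t; #s; Gadget; no-2-local-layout)
  open BookEmbeddings using (module Book)
  open GadgetGraph
  open import Data.Bool using (Bool; true; false; _∨_)
  open import Data.Bool.Properties using (∨-comm; ∨-zeroʳ)
  open import Data.Empty using (⊥; ⊥-elim)
  open import Data.Fin using (suc)
  open import Data.List using (List; []; _∷_; length)
  open import Data.List.Membership.Propositional using (_∈_; _∉_)
  import Data.List.Membership.DecPropositional as DecMembership
  open import Data.List.Membership.Propositional.Properties
    using (∈-++⁻; ∈-deduplicate⁺; ∈-map⁺; ∈-filter⁺; ∈-allFin)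
  open import Data.List.Relation.Unary.Any using (here; there)
  open import Data.Nat as ℕ using (ℕ; suc; _<_; _≤_; z≤n; s≤s)
  import Data.Nat.Properties as ℕ
  open import Data.Product using (_×_; _,_)
  open import Data.Sum as Sum using (_⊎_; inj₁; inj₂; [_,_]′)
  open import Relation.Binary using (IsStrictTotalOrder; tri<; tri≈; tri>)
  open import Relation.Binary.Structures.Biased using (isStrictTotalOrderᶜ)
  open import Relation.Binary.PropositionalEquality
  open import Relation.Nullary using (¬_; yes; no; does)
  open import Relation.Nullary.Decidable using (_⊎-dec_)

  two-labels : ∀ {qs : List ℕ} {p q r} → length qs ≤ 2 → p ∈ qs → q ∈ qs → r ∈ qs → p ≡ q ⊎ p ≡ r ⊎ q ≡ r
  two-labels {_ ∷ _ ∷ _ ∷ _} (s≤s (s≤s ()))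
  two-labels {_ ∷ []} _ (here refl) (here refl) _ = inj₁ refl
  two-labels {_ ∷ _ ∷ []} _ (here refl) (here refl) _ = inj₁ refl
  two-labels {_ ∷ _ ∷ []} _ (here refl) (there _) (here refl) = inj₂ (inj₁ refl)
  two-labels {_ ∷ _ ∷ []} _ (here refl) (there (here refl)) (there (here refl)) = inj₂ (inj₂ refl)
  two-labels {_ ∷ _ ∷ []} _ (there (here refl)) (here refl) (here refl) = inj₂ (inj₂ refl)
  two-labels {_ ∷ _ ∷ []} _ (there (here refl)) (here refl) (there (here refl)) = inj₂ (inj₁ refl)
  two-labels {_ ∷ _ ∷ []} _ (there (here refl)) (there (here refl)) _ = inj₁ refl

  layout₂ : {G : Graph} (L : QueueLayout G) → IsLocal G 2 L → Layout₂ (Graph.V G)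
  layout₂ {G} L local = record
    { _≺_ = _≺_ ; sto = ≺-isOrder ; _~_ = _~_ ; ~-sym = Graph.sym G ; ~-irrefl = irrefl refl
    ; queue = queue ; queue-sym = queue-sym
    ; noNest = λ {q} e f ac cd db → isQueue q e f (inj₁ (ac , cd , db))
    ; two = λ {v} e f g → two-labels (local v) (label e) (label f) (label g) }
    where
    open Graph G
    open QueueLayout L
    label : ∀ {v w} → v ~ w → queue v w ∈ queuesAt v
    label {v} {w} e = ∈-deduplicate⁺ ℕ._≟_ (∈-map⁺ (queue v) (∈-filter⁺ (v ~?_) (∈-allFin w) e))

  module Example (N M K : ℕ) where
    open Construction N M K
    open DecMembership _≟_ using (_∈?_)

    Adj : Vtx → Vtx → Set
    Adj a b = b ∈ out a ⊎ a ∈ out b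

    out-≢ : ∀ {a} → a ∉ out a
    out-≢ {a} p = [ (λ q → Lex-irrefl (ups-left q)) , (λ q → Lex-irrefl (downs-right {a} q)) ]′ (∈-++⁻ (ups a) p)

    graph : Graph
    graph = record
      { order = order
      ; _~_ = λ i j → Adj (decode i) (decode j)
      ; _~?_ = λ i j → (decode j ∈? out (decode i)) ⊎-dec (decode i ∈? out (decode j))
      ; sym = Sum.swap
      ; irrefl = λ { refl e → [ out-≢ , out-≢ ]′ e }
      }

    open Graph graph using (_~_) renaming (V to Vertex)

    decode-inj : ∀ {i j} → decode i ≡ decode j → i ≡ j
    decode-inj {i} {j} e = trans (sym (encode-decode i)) (trans (cong encode e) (encode-decode j))

    spineᵛ : Vertex → ℕ
    spineᵛ i = spine (decode i)

    spineᵛ-inj : ∀ {i j} → spineᵛ i ≡ spineᵛ j → i ≡ j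
    spineᵛ-inj e = decode-inj (spine-inj e)

    upper : Vtx → Vtx → Bool
    upper a b = does (b ∈? ups a) ∨ does (a ∈? ups b)

    -- The page tells at which end an edge is listed: at the right end above the spine, at the left
    -- end below it. This is the form in which the two crossing lemmas take edges.
    classify : ∀ {a b} → Adj a b → Lex a b → (upper a b ≡ true × a ∈ ups b) ⊎ (upper a b ≡ false × b ∈ downs a)
    classify {a} {b} adj ab with a ∈? ups b
    ... | yes p = inj₁ (∨-zeroʳ _ , p)
    ... | no ¬p with b ∈? ups a
    ...   | yes q = ⊥-elim (ℕ.<-asym (Lex⇒spine ab) (Lex⇒spine (ups-left q)))
    ...   | no ¬q with adj
    ...     | inj₁ r = inj₂ (refl , [ (λ q → ⊥-elim (¬q q)) , (λ d → d) ]′ (∈-++⁻ (ups a) r))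
    ...     | inj₂ r = ⊥-elim ([ ¬p , (λ d → ℕ.<-asym (Lex⇒spine ab) (Lex⇒spine (downs-right {b} d))) ]′ (∈-++⁻ (ups b) r))

    noCross : ∀ {a b c d} → Adj a b → Adj c d → upper a b ≡ upper c d →
              spine a < spine c → spine c < spine b → spine b < spine d → ⊥
    noCross {a} {b} {c} {d} ab cd p ac cb bd =
      go (classify ab (spine⇒Lex (ℕ.<-trans ac cb))) (classify cd (spine⇒Lex (ℕ.<-trans cb bd)))
      where
      true≢false : true ≢ false
      true≢false ()
      go : (upper a b ≡ true × a ∈ ups b) ⊎ (upper a b ≡ false × b ∈ downs a) →
           (upper c d ≡ true × c ∈ ups d) ⊎ (upper c d ≡ false × d ∈ downs c) → ⊥
      go (inj₁ (_ , e)) (inj₁ (_ , f)) = ups-noCross {b = b} e f (spine⇒Lex ac) (spine⇒Lex cb) (spine⇒Lex bd)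
      go (inj₂ (_ , e)) (inj₂ (_ , f)) = downs-noCross {a} e f (spine⇒Lex ac) (spine⇒Lex cb) (spine⇒Lex bd)
      go (inj₁ (q , _)) (inj₂ (r , _)) = true≢false (trans (sym q) (trans p r))
      go (inj₂ (q , _)) (inj₁ (r , _)) = true≢false (trans (sym r) (trans (sym p) q))

    planar : Planar graph
    planar = Book.Embedding.planeDrawing graph spineᵛ spineᵛ-inj (λ i j → upper (decode i) (decode j))
      (λ {i} {j} _ → ∨-comm (does (decode i ∈? ups (decode j))) (does (decode j ∈? ups (decode i)))) noCross

    spine-isOrder : IsStrictTotalOrder _≡_ (λ i j → spineᵛ i < spineᵛ j)
    spine-isOrder = isStrictTotalOrderᶜ record
      { isEquivalence = isEquivalence
      ; trans = ℕ.<-trans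
      ; compare = compare
      }
      where
      compare : ∀ i j → _
      compare i j with ℕ.<-cmp (spineᵛ i) (spineᵛ j)
      ... | tri< a b c = tri< a (λ e → b (cong spineᵛ e)) c
      ... | tri≈ a b c = tri≈ a (spineᵛ-inj b) c
      ... | tri> a b c = tri> a (λ e → b (cong spineᵛ e)) c

    headOf : Vtx → Vtx → Vtx
    headOf a b with b ∈? out a
    ... | yes _ = b
    ... | no _ = a

    -- Each edge lies in the star at its head, except that the stars at U and V
    -- are joined to one queue.
    code : Vtx → ℕ
    code U = 0
    code V = 0
    code a@(In _ _) = suc (spine a)

    ups-downs : ∀ {a b} → b ∈ ups a → a ∉ downs b
    ups-downs {X _} (here refl) ()
    ups-downs {X′ _} (here refl) ()
    ups-downs {Sub _ _ _} (here refl) (there (there ()))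

    out-asym : ∀ {a b} → b ∈ out a → a ∉ out b
    out-asym {a} {b} p q with ∈-++⁻ (ups a) p | ∈-++⁻ (ups b) q
    ... | inj₁ r | inj₁ s = ℕ.<-asym (Lex⇒spine (ups-left r)) (Lex⇒spine (ups-left s))
    ... | inj₂ r | inj₂ s = ℕ.<-asym (Lex⇒spine (downs-right {a} r)) (Lex⇒spine (downs-right {b} s))
    ... | inj₁ r | inj₂ s = ups-downs r s
    ... | inj₂ r | inj₁ s = ups-downs s r

    headOf-sym : ∀ {a b} → Adj a b → headOf a b ≡ headOf b a
    headOf-sym {a} {b} e with b ∈? out a | a ∈? out b
    ... | yes p | yes q = ⊥-elim (out-asym {a} p q)
    ... | yes _ | no _ = refl
    ... | no _ | yes _ = refl
    ... | no p | no q = ⊥-elim ([ p , q ]′ e)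

    headOf-end : ∀ a b → headOf a b ≡ a ⊎ headOf a b ≡ b
    headOf-end a b with b ∈? out a
    ... | yes _ = inj₂ refl
    ... | no _ = inj₁ refl

    code-≡ : ∀ {a b} → code a ≡ code b → a ≡ b ⊎ (a ≡ U ⊎ a ≡ V) × (b ≡ U ⊎ b ≡ V)
    code-≡ {U} {U} e = inj₁ refl
    code-≡ {U} {V} e = inj₂ (inj₁ refl , inj₂ refl)
    code-≡ {V} {U} e = inj₂ (inj₂ refl , inj₁ refl)
    code-≡ {V} {V} e = inj₁ refl
    code-≡ {In j a} {In j′ b} e = inj₁ (spine-inj (ℕ.suc-injective e))

    -- U and V are the ends of the spine, so no edge at them is nested.
    inner : ∀ {a b x y} → spine a < spine x → spine x < spine y → spine y < spine b → ∀ {h} →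
            h ≡ U ⊎ h ≡ V → h ≡ x ⊎ h ≡ y → ⊥
    inner ax xy yb (inj₁ refl) (inj₁ refl) = nothing-left (spine⇒Lex ax)
    inner ax xy yb (inj₁ refl) (inj₂ refl) = nothing-left (spine⇒Lex xy)
    inner ax xy yb (inj₂ refl) (inj₁ refl) = nothing-right (spine⇒Lex xy)
    inner ax xy yb (inj₂ refl) (inj₂ refl) = nothing-right (spine⇒Lex yb)

    layout : QueueLayout graph
    layout = record
      { _≺_ = λ i j → spineᵛ i < spineᵛ j
      ; ≺-isOrder = spine-isOrder
      ; queue = λ i j → code (headOf (decode i) (decode j))
      ; queue-sym = λ e → cong code (headOf-sym e)
      ; isQueue = λ { q {i} {j} {k} {l} (_ , refl) (_ , p) n → distinct (headOf-end (decode i) (decode j)) (headOf-end (decode k) (decode l))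
                       (code-≡ {headOf (decode i) (decode j)} {headOf (decode k) (decode l)} (sym p)) n }
      }
      where
      distinct : ∀ {i j k l h h′} → h ≡ decode i ⊎ h ≡ decode j → h′ ≡ decode k ⊎ h′ ≡ decode l →
        h ≡ h′ ⊎ (h ≡ U ⊎ h ≡ V) × (h′ ≡ U ⊎ h′ ≡ V) → ¬ Nest graph (λ i j → spineᵛ i < spineᵛ j) i j k l
      distinct s t (inj₂ (c , d)) (inj₁ (ik , kl , lj)) = inner {b = decode _} ik kl lj d t
      distinct s t (inj₂ (c , d)) (inj₂ (ki , ij , jl)) = inner {b = decode _} ki ij jl c s
      distinct s t (inj₁ refl) n with s | t | nest-disjoint {graph} spine-isOrder n
      ... | inj₁ p | inj₁ q | (r , _) , _ = r (decode-inj (trans (sym p) q))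
      ... | inj₁ p | inj₂ q | (_ , r) , _ = r (decode-inj (trans (sym p) q))
      ... | inj₂ p | inj₁ q | _ , (r , _) = r (decode-inj (trans (sym p) q))
      ... | inj₂ p | inj₂ q | _ , (_ , r) = r (decode-inj (trans (sym p) q))

    -- Three labels suffice at `X` because `U` and `V` share the label 0, and at `S` because no edge
    -- is directed to it, so that it has no star of its own.
    labels : Vtx → List ℕ
    labels U = 0 ∷ []
    labels V = 0 ∷ []
    labels (X j) = 0 ∷ code (X′ j) ∷ code (X j) ∷ []
    labels (X′ j) = 0 ∷ code (X′ j) ∷ []
    labels (T j i) = code (X j) ∷ code (X′ j) ∷ code (T j i) ∷ []
    labels (S j i k) = code (X j) ∷ code (T j i) ∷ code (S′ j i k) ∷ []
    labels (S′ j i k) = code (X j) ∷ code (T j i) ∷ code (S′ j i k) ∷ []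

    labels≤3 : ∀ a → length (labels a) ≤ 3
    labels≤3 U = s≤s z≤n
    labels≤3 V = s≤s z≤n
    labels≤3 (X j) = ℕ.≤-refl
    labels≤3 (X′ j) = s≤s (s≤s z≤n)
    labels≤3 (T j i) = ℕ.≤-refl
    labels≤3 (S j i k) = ℕ.≤-refl
    labels≤3 (S′ j i k) = ℕ.≤-refl

    out-label : ∀ {a b} → b ∈ out a → code b ∈ labels a
    out-label {X j} (here refl) = here refl
    out-label {X j} (there (here refl)) = here refl
    out-label {X j} (there (there (here refl))) = there (here refl)
    out-label {X′ j} (here refl) = here refl
    out-label {X′ j} (there (here refl)) = here refl
    out-label {T j i} (here refl) = here refl
    out-label {T j i} (there (here refl)) = there (here refl)
    out-label {S j i k} (here refl) = here refl
    out-label {S j i k} (there (here refl)) = there (here refl)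
    out-label {S j i k} (there (there (here refl))) = there (there (here refl))
    out-label {S′ j i k} (here refl) = here refl
    out-label {S′ j i k} (there (here refl)) = there (here refl)

    S-source : ∀ {b j i k} → S j i k ∉ out b
    S-source {X _} (there (there (there ())))
    S-source {X′ _} (there (there ()))
    S-source {T _ _} (there (there ()))
    S-source {S _ _ _} (there (there (there ())))
    S-source {S′ _ _ _} (there (there ()))

    own-label : ∀ a {b} → a ∈ out b → code a ∈ labels a
    own-label U _ = here refl
    own-label V _ = here refl
    own-label (X j) _ = there (there (here refl))
    own-label (X′ j) _ = there (here refl)
    own-label (T j i) _ = there (there (here refl))
    own-label (S j i k) {b} p = ⊥-elim (S-source {b} p)
    own-label (S′ j i k) _ = there (there (here refl))

    head-label : ∀ {a b} → Adj a b → code (headOf a b) ∈ labels a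
    head-label {a} {b} e with b ∈? out a
    ... | yes p = out-label {a} p
    ... | no p = own-label a {b} ([ (λ q → ⊥-elim (p q)) , (λ q → q) ]′ e)

    -- The local queue number is a minimum that has to be attained, hence an explicit layout besides
    -- the lower bound.
    local₃ : HasLocalQueueLayout graph 3
    local₃ = layout , isLocal layout (λ i → labels (decode i)) (λ {i} {j} e → head-label {decode i} {decode j} e) (λ i → labels≤3 (decode i))

    edge : ∀ {a b} → b ∈ out a ⊎ a ∈ out b → encode a ~ encode b
    edge {a} {b} e = subst₂ Adj (sym (decode-encode a)) (sym (decode-encode b)) e

    encode-≢ : ∀ {a b} → a ≢ b → encode a ≢ encode b
    encode-≢ {a} {b} ne e = ne (trans (sym (decode-encode a)) (trans (cong decode e) (decode-encode b)))

  open Example #x #t #s using (edge; encode-≢)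
  open Construction #x #t #s

  gadget : Gadget (Graph._~_ (Example.graph #x #t #s))
  gadget = record
    { u = E U ; v = E V ; x = λ j → E (X j) ; x′ = λ j → E (X′ j) ; t = λ j i → E (T j i)
    ; s = λ j i k → E (S j i k) ; s′ = λ j i k → E (S′ j i k)
    ; ux = λ j → edge (inj₂ (here refl)) ; vx = λ j → edge (inj₂ (there (here refl)))
    ; ux′ = λ j → edge (inj₂ (here refl)) ; vx′ = λ j → edge (inj₂ (there (here refl)))
    ; xx′ = λ j → edge (inj₁ (there (there (here refl))))
    ; xt = λ j i → edge (inj₂ (here refl)) ; x′t = λ j i → edge (inj₂ (there (here refl)))
    ; xs = λ j i k → edge (inj₂ (here refl)) ; xs′ = λ j i k → edge (inj₂ (here refl))
    ; ts = λ j i k → edge (inj₂ (there (here refl))) ; ts′ = λ j i k → edge (inj₂ (there (here refl)))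
    ; ss′ = λ j i k → edge (inj₁ (there (there (here refl))))
    ; u≢v = encode-≢ λ ()
    ; x-inj = λ ne → encode-≢ λ { refl → ne refl } ; x′-inj = λ ne → encode-≢ λ { refl → ne refl }
    ; x≢x′ = encode-≢ λ ()
    ; t≢u = encode-≢ λ () ; t≢v = encode-≢ λ () ; t≢x = encode-≢ λ () ; t≢x′ = encode-≢ λ ()
    ; t-inj = λ ne → encode-≢ λ { refl → ne refl }
    ; s≢u = encode-≢ λ () ; s≢v = encode-≢ λ () ; s≢x = encode-≢ λ () ; s≢x′ = encode-≢ λ ()
    ; s′≢u = encode-≢ λ () ; s′≢v = encode-≢ λ () ; s′≢x = encode-≢ λ () ; s′≢x′ = encode-≢ λ ()
    ; s-inj = λ ne → encode-≢ λ { refl → ne refl } ; s′-inj = λ ne → encode-≢ λ { refl → ne refl }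
    ; s≢s′ = encode-≢ λ ()
    }
    where
    E = encode

  example : Graph
  example = Example.graph #x #t #s

  example-planar : Planar example
  example-planar = Example.planar #x #t #s

  no-2-local : ∀ {m} → HasLocalQueueLayout example m → 3 ≤ m
  no-2-local {m} (L , local) with 3 ℕ.≤? m
  ... | yes p = p
  ... | no p = ⊥-elim (no-2-local-layout (layout₂ L (λ v → ℕ.≤-trans (local v) (ℕ.s≤s⁻¹ (ℕ.≰⇒> p)))) gadget)

  example-number : IsLocalQueueNumber example 3
  example-number = Example.local₃ #x #t #s , λ m → no-2-local

open StarLayouts using (planar⇒4-local)
open LocalQueueNumber3 using (example; example-planar; example-number)
open import Data.Nat.Properties using (≤-refl)
open import Data.Product using (_,_)

corollary6 : (∀ (G : Graph) → Planar G → HasLocalQueueLayout G 4) ×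
    (∃[ G ] Planar G × (∃[ k ] IsLocalQueueNumber G k × k ≥ 3))
corollary6 = planar⇒4-local , example , example-planar , 3 , example-number , ≤-refl
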